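{- Let $\mathcal{G}=(H,\sigma,\alpha,h_0)$ be a rooted combinatorial map whose underlying graph $G=(V,E)$ has at least one edge, let $v_0$ be its root-vertex, let $T_G$ be its Tutte polynomial and let $[x^i]P(x)$ denote the coefficient of $x^i$ in a polynomial $P$. For every $i\ge 0$: $[x^i]T_G(1+x,2)$ (resp. $[x^i]T_G(1+x,1)$, $[x^i]T_G(1+x,0)$) is the number of orientations (resp. minimal orientations, acyclic orientations) of $G$ having exactly $i+1$ non-empty root-components; and $[x^i]T_G(x,2)$ (resp. $[x^i]T_G(x,1)$, $[x^i]T_G(x,0)$) is the number of $v_0$-connected orientations (resp. minimal $v_0$-connected orientations, acyclic $v_0$-connected orientations) having exactly $i+1$ non-empty root-strong-components.
   Context: Tutte polynomial: $T_G(x,y)=\sum_{S\subseteq E}(x-1)^{c(S)-1}(y-1)^{|S|+c(S)-|V|}$. A rooted combinatorial map is $\mathcal{G}=(H,\sigma,\alpha,h_0)$ with $H$ a finite set of half-edges, $\sigma$ a permutation, $\alpha$ a fixed-point-free involution, $\langle\sigma,\alpha\rangle$ transitive on $H$, root $h_0$; underlying graph: vertices the cycles of $\sigma$, edges the pairs $\{h,\alpha(h)\}$; $v_0$ is the vertex containing $h_0$. Subgraphs are spanning, identified with edge sets. An orientation assigns to each edge $\{h,h'\}$ an ordered pair $(h,h')$ (tail $h$, head $h'$); $v_0$-connected means every vertex is reachable from $v_0$; acyclic means no directed cycle. For a spanning tree $T$: edges in $T$ are internal, others external; the motion function $t(h)=\sigma\alpha(h)$ if the edge of $h$ is internal, $\sigma(h)$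 otherwise, is a cyclic permutation of $H$; the $(\mathcal{G},T)$-order on $H$ is $h_0<t(h_0)<\dots<t^{|H|-1}(h_0)$, edges compared via their smaller half-edge. Fundamental cycle of external $e$: set of $e'$ with $T-e'+e$ a spanning tree; fundamental cocycle of internal $e$: set of $e'$ with $T-e+e'$ a spanning tree; an edge is $(\mathcal{G},T)$-active if minimal in its fundamental cycle/cocycle. $[T^-,T^+]$: subgraphs obtained from $T$ by removing some internal active edges and adding some external active edges; each subgraph lies in exactly one. $\Phi(S)$ for $S\in[T^-,T^+]$: for $e=\{h_1,h_2\}$, $h_1<h_2$, $\Phi(S)(e)=(h_1,h_2)$ if either ($e\in T$ and its fundamental cocycle contains no edge of $S\triangle T$) or ($e\notin T$ and its fundamental cycle contains some edge of $S\triangle T$); otherwise $(h_2,h_1)$; $\Phi$ is a bijection onto orientations. For an orientation $\mathcal{O}$ let $T_{\mathcal{O}}$ be the spanning tree with $\Phi^{ -1}(\mathcal{O})\in[T_{\mathcal{O}}^-,T_{\mathcal{O}}^+]$ and compare edges/half-edges in the $(\mathcal{G},T_{\mathcal{O}})$-order. $\mathcal{O}$ is minimal if no $\mathcal{O}$-directed cycle has a tail as its smallest half-edge. Root-components of $\mathcal{O}$: $V_0$ is the set of vertices reachable from $v_0$; if $W_k=V_0\cup\dots\cup V_k\ne V$, let $e_k$ be the minimal edge with one endpoint in $W_k$ and the other endpoint $v_k\notin W_k$, and let $V_{k+1}$ be the set of vertices outside $W_k$ reachable from $v_k$. Root-strong-components of a $v_0$-connected $\mathcal{O}$: $U_0$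 is the set of vertices from which $v_0$ is reachable; if $W_k=U_0\cup\dots\cup U_k\ne V$, let $e_k$ be the minimal edge with one endpoint in $W_k$ and the other $v_k\notin W_k$, and let $U_{k+1}$ be the set of vertices outside $W_k$ from which $v_k$ is reachable. -}

module Defs where

open import Data.Nat using (ℕ; zero; suc; _+_; _∸_; _⊓_; _≤_; _<_; _≡ᵇ_; _≤ᵇ_; _<ᵇ_)
open import Data.Bool using (Bool; true; false; not; _∧_; _∨_; _xor_; if_then_else_)
open import Data.Fin using (Fin; toℕ) renaming (_≟_ to _≟F_)
open import Data.Fin.Permutation using (Permutation′; _⟨$⟩ʳ_; _⟨$⟩ˡ_)
open import Data.Integer using (ℤ; +_; -_) renaming (_+_ to _+ℤ_; _*_ to _*ℤ_; _-_ to _-ℤ_; _^_ to _^ℤ_)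
open import Data.List using (List; []; _∷_; _∷ʳ_; length; map; foldr; filterᵇ; takeWhileᵇ; allFin; upTo; concatMap)
open import Data.Bool.ListAction using (any; all)
open import Data.List.Membership.Propositional using (_∈_)
open import Data.List.Relation.Unary.All using (All)
open import Data.List.Relation.Unary.Any using (Any)
open import Data.List.Relation.Unary.AllPairs using (AllPairs)
open import Data.List.Relation.Unary.Linked using (Linked)
open import Data.List.Relation.Unary.Unique.Propositional using (Unique)
open import Data.Vec using (Vec; []; _∷_; lookup; tabulate)
open import Data.Product using (Σ; _×_; ∃; ∃-syntax; _,_)
open import Function.Bundles using (_⇔_)
open import Relation.Binary.PropositionalEquality using (_≡_; _≢_)
open import Relation.Binary.Construct.Closure.ReflexiveTransitive using (Star)
open import Relation.Nullary using (¬_)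
open import Relation.Nullary.Decidable using (⌊_⌋)

-- Univariate integer polynomials, as coefficient lists (constant term first)

Poly : Set
Poly = List ℤ

_+P_ : Poly → Poly → Poly
[] +P q = q
(a ∷ p) +P [] = a ∷ p
(a ∷ p) +P (b ∷ q) = (a +ℤ b) ∷ (p +P q)

scaleP : ℤ → Poly → Poly
scaleP c = map (c *ℤ_)

_*P_ : Poly → Poly → Poly
[] *P q = []
(a ∷ p) *P q = scaleP a q +P (+ 0 ∷ (p *P q))

constP : ℤ → Poly
constP c = c ∷ []

_^P_ : Poly → ℕ → Poly
p ^P zero = constP (+ 1)
p ^P suc k = p *P (p ^P k)

sumP : List Poly → Poly
sumP = foldr _+P_ []

coeff : Poly → ℕ → ℤ
coeff [] i = + 0
coeff (a ∷ p) zero = a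
coeff (a ∷ p) (suc i) = coeff p i

onePlusX : Poly
onePlusX = + 1 ∷ + 1 ∷ []

varX : Poly
varX = + 0 ∷ + 1 ∷ []

allVecs : (m : ℕ) → List (Vec Bool m)
allVecs zero = [] ∷ []
allVecs (suc m) = concatMap (λ v → (false ∷ v) ∷ (true ∷ v) ∷ []) (allVecs m)

count : ∀ {A : Set} → (A → Bool) → List A → ℕ
count p xs = length (filterᵇ p xs)

iter : ∀ {A : Set} → (A → A) → ℕ → A → A
iter f zero a = a
iter f (suc k) a = f (iter f k a)

HasCount : ∀ {A : Set} → (A → Set) → ℕ → Set
HasCount {A} P k = Σ (List A) λ L → Unique L × (∀ a → (a ∈ L) ⇔ P a) × length L ≡ k

data MapStep {n : ℕ} (σ : Permutation′ n) (α : Fin n → Fin n) (h : Fin n) : Fin n → Set where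
  byσ  : MapStep σ α h (σ ⟨$⟩ʳ h)
  byσ⁻ : MapStep σ α h (σ ⟨$⟩ˡ h)
  byα  : MapStep σ α h (α h)

record RootedMap (n : ℕ) : Set where
  field
    σ        : Permutation′ n
    α        : Fin n → Fin n
    α-invol  : ∀ h → α (α h) ≡ h
    α-fpf    : ∀ h → α h ≢ h
    transitive : ∀ h h' → Star (MapStep σ α) h h'
    h₀       : Fin n

module MapDefs {n : ℕ} (M : RootedMap n) where
  open RootedMap M

  σf : Fin n → Fin n
  σf h = σ ⟨$⟩ʳ h

  H : List (Fin n)
  H = allFin n

  _==_ : Fin n → Fin n → Bool
  a == b = ⌊ a ≟F b ⌋

  -- h and h' lie in the same cycle of σ (i.e. at the same vertex)
  sameV : Fin n → Fin n → Bool
  sameV h h' = any (λ k → iter σf k h == h') (upTo n)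

  -- reachability along a step relation between half-edges (paths have < n steps)
  closure : (Fin n → Fin n → Bool) → ℕ → Fin n → Fin n → Bool
  closure st zero h h' = h == h'
  closure st (suc k) h h' = closure st k h h' ∨ any (λ m → closure st k h m ∧ st m h') H

  reach : (Fin n → Fin n → Bool) → Fin n → Fin n → Bool
  reach st = closure st n

  -- number of classes of a (symmetric, reflexive-transitive) relation = number of minimal representatives
  numClasses : (Fin n → Fin n → Bool) → ℕ
  numClasses r = count (λ h → all (λ h' → not (r h h') ∨ (toℕ h ≤ᵇ toℕ h')) H) H

  numV : ℕ
  numV = numClasses sameV

  -- Subgraphs (spanning, = edge sets) are the α-invariant subsets of H
  isSubgraph : Vec Bool n → Bool
  isSubgraph S = all (λ h → not (lookup S h xor lookup S (α h))) H

  allSubgraphs : List (Vec Bool n)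
  allSubgraphs = filterᵇ isSubgraph (allVecs n)

  numE : Vec Bool n → ℕ
  numE S = count (λ h → lookup S h ∧ (toℕ h <ᵇ toℕ (α h))) H

  ustep : Vec Bool n → Fin n → Fin n → Bool
  ustep S h h' = sameV h h' ∨ (lookup S h ∧ (α h == h'))

  numComp : Vec Bool n → ℕ
  numComp S = numClasses (reach (ustep S))

  tutteAt : Poly → ℤ → Poly
  tutteAt X y = sumP (map term allSubgraphs)
    where
    term : Vec Bool n → Poly
    term S = ((X +P constP (- + 1)) ^P (numComp S ∸ 1))
             *P constP ((y -ℤ + 1) ^ℤ (numE S + numComp S ∸ numV))

  -- Orientations: O h = true iff h is the tail of its edge

  isOrientation : Vec Bool n → Bool
  isOrientation O = all (λ h → lookup O h xor lookup O (α h)) H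

  dstep : Vec Bool n → Fin n → Fin n → Bool
  dstep O h h' = sameV h h' ∨ (lookup O h ∧ (α h == h'))

  reachD : Vec Bool n → Fin n → Fin n → Bool
  reachD O = reach (dstep O)

  v0Connected : Vec Bool n → Bool
  v0Connected O = all (λ h → reachD O h₀ h) H

  -- an O-directed cycle, given by the list of tails of its edges h ∷ rest in cyclic order,
  -- through pairwise distinct vertices
  DirectedCycle : Vec Bool n → Fin n → List (Fin n) → Set
  DirectedCycle O h rest =
    All (λ a → lookup O a ≡ true) (h ∷ rest)
    × Linked (λ a b → sameV (α a) b ≡ true) ((h ∷ rest) ∷ʳ h)
    × AllPairs (λ a b → sameV a b ≡ false) (h ∷ rest)

  Acyclic : Vec Bool n → Set
  Acyclic O = ∀ h rest → ¬ DirectedCycle O h rest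

  isSpanningTree : Vec Bool n → Bool
  isSpanningTree T = isSubgraph T ∧ (numComp T ≡ᵇ 1) ∧ (numE T + 1 ≡ᵇ numV)

  motion : Vec Bool n → Fin n → Fin n
  motion T h = if lookup T h then σf (α h) else σf h

  -- position of h in the (G,T)-order: least k with t^k(h₀) = h
  pos : Vec Bool n → Fin n → ℕ
  pos T h = length (takeWhileᵇ (λ k → not (iter (motion T) k h₀ == h)) (upTo n))

  edgeRank : Vec Bool n → Fin n → ℕ
  edgeRank T h = pos T h ⊓ pos T (α h)

  sameEdge : Fin n → Fin n → Bool
  sameEdge x h = (x == h) ∨ (x == α h)

  addRemove : Vec Bool n → Fin n → Fin n → Vec Bool n
  addRemove T e e' = tabulate λ x → (lookup T x ∨ sameEdge x e) ∧ not (sameEdge x e')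

  removeAdd : Vec Bool n → Fin n → Fin n → Vec Bool n
  removeAdd T e e' = tabulate λ x → (lookup T x ∧ not (sameEdge x e)) ∨ sameEdge x e'

  inFundCycle : Vec Bool n → Fin n → Fin n → Bool
  inFundCycle T e e' = isSpanningTree (addRemove T e e')

  inFundCocycle : Vec Bool n → Fin n → Fin n → Bool
  inFundCocycle T e e' = isSpanningTree (removeAdd T e e')

  fund : Vec Bool n → Fin n → Fin n → Bool
  fund T e e' = if lookup T e then inFundCocycle T e e' else inFundCycle T e e'

  active : Vec Bool n → Fin n → Bool
  active T e = all (λ e' → not (fund T e e') ∨ (edgeRank T e ≤ᵇ edgeRank T e')) H

  inInterval : Vec Bool n → Vec Bool n → Bool
  inInterval T S = isSpanningTree T ∧ isSubgraph S
                   ∧ all (λ h → not (lookup S h xor lookup T h) ∨ active T h) H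

  Φ : Vec Bool n → Vec Bool n → Vec Bool n
  Φ T S = tabulate λ h → not ((pos T h <ᵇ pos T (α h)) xor cond h)
    where
    meetsΔ : Fin n → Bool
    meetsΔ h = any (λ h' → fund T h h' ∧ (lookup S h' xor lookup T h')) H
    cond : Fin n → Bool
    cond h = if lookup T h then not (meetsΔ h) else meetsΔ h

  TreeOf : Vec Bool n → Vec Bool n → Set
  TreeOf O T = ∃[ S ] (inInterval T S ≡ true × Φ T S ≡ O)

  SmallestIsTail : Vec Bool n → List (Fin n) → Set
  SmallestIsTail T C = Any (λ a → All (λ b → (pos T a ≤ pos T b) × (pos T a < pos T (α b))) C) C

  MinimalWrt : Vec Bool n → Vec Bool n → Set
  MinimalWrt T O = ∀ h rest → DirectedCycle O h rest → ¬ SmallestIsTail T (h ∷ rest)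

  minCrossing : Vec Bool n → (Fin n → Bool) → List (Fin n) → Fin n → Fin n
  minCrossing T W [] best = best
  minCrossing T W (h ∷ hs) best =
    if (W h ∧ not (W (α h))) ∧ (edgeRank T h <ᵇ edgeRank T best)
    then minCrossing T W hs h else minCrossing T W hs best

  firstCrossing : (Fin n → Bool) → List (Fin n) → List (Fin n)
  firstCrossing W [] = []
  firstCrossing W (h ∷ hs) = if W h ∧ not (W (α h)) then h ∷ [] else firstCrossing W hs

  -- grow: given current W_k and the vertex v_k (as a half-edge), the new W_{k+1}
  countParts : Vec Bool n → ((Fin n → Bool) → Fin n → Fin n → Bool) → ℕ → (Fin n → Bool) → ℕ
  countParts T grow zero W = 1
  countParts T grow (suc f) W with firstCrossing W H
  ... | [] = 1
  ... | h ∷ _ = suc (countParts T grow f (λ x → grow W (α (minCrossing T W H h)) x))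

  numRootComps : Vec Bool n → Vec Bool n → ℕ
  numRootComps T O =
    countParts T (λ W v x → W x ∨ (reachD O v x ∧ not (W x))) n (λ x → reachD O h₀ x)

  numRootStrongComps : Vec Bool n → Vec Bool n → ℕ
  numRootStrongComps T O =
    countParts T (λ W v x → W x ∨ (reachD O x v ∧ not (W x))) n (λ x → reachD O x h₀)

  RC : ℕ → Vec Bool n → Set
  RC i O = ∃[ T ] (TreeOf O T × numRootComps T O ≡ suc i)

  RSC : ℕ → Vec Bool n → Set
  RSC i O = ∃[ T ] (TreeOf O T × numRootStrongComps T O ≡ suc i)

  Minimal : Vec Bool n → Set
  Minimal O = ∃[ T ] (TreeOf O T × MinimalWrt T O)

  CoeffsCount : Poly → (ℕ → Vec Bool n → Set) → Set
  CoeffsCount P Q = ∀ i → ∃[ k ] (HasCount (Q i) k × coeff P i ≡ + k)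

{-# OPTIONS --safe #-}
module Submission where

-- Fix a spanning tree T. Cutting the tour of T at a tree edge {b, αb} with b first leaves the arc
-- U b of half-edges from just after b up to αb: it is the component of T - {b, αb} avoiding the root,
-- and an external edge lies in the fundamental cocycle of b iff exactly one of its half-edges is in U b.
-- Orient tree edges from their first to their second half-edge and external edges backwards. Then
-- the fundamental cocycle (cycle) of an edge is directed iff the edge is active, and Φ reverses the
-- union of the fundamental cycles and cocycles of the active edges toggled between T and S.
--
-- Every subgraph lies in some interval: read the tour backwards, and exchange an inactive edge on
-- which T and S disagree with a smaller edge of its fundamental cycle or cocycle. This changes
-- neither the later part of the tour nor the activities there.
-- Φ is injective: at the first half-edge where the tours of two preimages of an orientation
-- disagree, a directed cycle of one meets a directed cut of the other. There are as many
-- orientations as subgraphs, so Φ is bijective and intervals are disjoint.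
--
-- In the orientation of S, the sets U b of the toggled tree edges b have no incoming edge, while
-- untoggled tree edges can be followed downwards; hence the root-components are the vertex sets of
-- the components of S. If no tree edge is toggled, a similar argument with reversed reachability
-- gives one root-strong-component for the root and one for each active tree edge.
-- The coefficients follow by summing over the states of the active edges one at a time.

open import Defs
open import Data.Nat using (ℕ; zero; suc; _+_; _∸_; _≤_; _<_; z≤n; s≤s; _≤ᵇ_; _<ᵇ_; _≡ᵇ_)
import Data.Nat.Properties as ℕₚ
open import Data.Bool using (Bool; true; false; not; _∧_; _∨_; _xor_; if_then_else_; T?) renaming (T to IsTrue)
import Data.Bool.Properties as 𝔹ₚ
open import Data.Bool.ListAction using (any; all)
open import Data.Integer using (ℤ; +_; -_) renaming (_+_ to _+ℤ_; _*_ to _*ℤ_; _-_ to _-ℤ_; _^_ to _^ℤ_)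
import Data.Integer.Properties as ℤₚ
open import Data.Integer.Solver using (module +-*-Solver)
open import Data.Fin using (Fin; toℕ; fromℕ<)
import Data.Fin.Properties as Finₚ
open import Data.Fin.Permutation using (_⟨$⟩ˡ_; inverseˡ; inverseʳ)
open import Data.List using (List; []; _∷_; _++_; _∷ʳ_; _ʳ++_; length; map; foldr; filterᵇ; takeWhileᵇ; allFin; upTo; applyUpTo; concatMap)
import Data.List.Properties as Listₚ
open import Data.List.Membership.Propositional using (_∈_)
open import Data.List.Membership.Propositional.Properties using (∈-allFin; ∈-∃++; ∈-++⁻; ∈-++⁺ˡ; ∈-++⁺ʳ; ∈-filter⁺; ∈-filter⁻; ∈-upTo⁺; ∈-map⁺; ∈-map⁻)
open import Data.List.Membership.Propositional.Properties.WithK using (unique∧set⇒bag)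
open import Data.List.Relation.Binary.BagAndSetEquality using (∼bag⇒↭)
open import Data.List.Relation.Binary.Permutation.Propositional using (_↭_)
import Data.List.Relation.Binary.Permutation.Propositional as ↭
open import Data.List.Relation.Unary.Any using (Any; here; there; any?)
open import Data.List.Relation.Unary.All using (All; []; _∷_)
import Data.List.Relation.Unary.All as All
import Data.List.Relation.Unary.All.Properties as Allₚ
open import Data.List.Relation.Unary.AllPairs using (AllPairs; []; _∷_)
import Data.List.Relation.Unary.AllPairs as AllPairs
import Data.List.Relation.Unary.AllPairs.Properties as AllPairsₚ
open import Data.List.Relation.Unary.Linked using (Linked; [-]; _∷_)
open import Data.List.Relation.Unary.Unique.Propositional using (Unique)
import Data.List.Relation.Unary.Unique.Propositional.Properties as Uniqueₚ
open import Data.Vec using (Vec; []; _∷_; lookup; tabulate)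
open import Data.Vec.Properties using (lookup∘tabulate; tabulate-cong; tabulate∘lookup; ≡-dec)
open import Data.Product using (Σ; _×_; ∃; _,_; proj₁; proj₂)
open import Data.Sum using (_⊎_; inj₁; inj₂; [_,_]′)
open import Data.Empty using (⊥; ⊥-elim)
open import Function using (_∘_)
open import Function.Bundles using (mk⇔)
open import Relation.Binary.Construct.Closure.ReflexiveTransitive using (Star; ε; _◅_)
open import Relation.Binary.Definitions using (tri<; tri≈; tri>)
open import Relation.Nullary using (Dec; yes; no)
open import Relation.Nullary.Decidable using (⌊_⌋)
open import Relation.Binary.PropositionalEquality using (_≡_; _≢_; refl; sym; trans; cong; cong₂; subst; subst₂; module ≡-Reasoning)

-- A tree edge and an external edge of its fundamental cocycle interleave in the tour, and the one
-- that comes later is inactive. So an active tree edge and an active external edge never lie in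
-- each other's fundamental cocycle and cycle. This is why the reversals in `Φ` do not interfere and
-- the toggled cuts and cycles stay directed. Disjointness of the intervals is not attacked
-- directly. Injectivity is stated for pairs `(T, S)`, before a subgraph is known to have only one
-- tree; uniqueness of the tree then falls out of the count. Within an interval each toggled tree
-- edge adds one component to S and each toggled external edge adds one to its nullity; these are
-- the exponents of x - 1 and y - 1 in the Tutte polynomial. At y = 2, 1, 0 the external weight is
-- 1^k, 0^k, (-1)^k: the value y = 1 keeps the subgraphs with no toggled external edge, and y = 0
-- cancels every interval whose tree has an active external edge.

t≢f : ∀ {a} → a ≡ true → a ≡ false → ⊥
t≢f refl ()

tf-dec : ∀ a → a ≡ true ⊎ a ≡ false
tf-dec true = inj₁ refl
tf-dec false = inj₂ refl

not-f : ∀ {a} → (a ≡ false → ⊥) → a ≡ true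
not-f {true} _ = refl
not-f {false} h = ⊥-elim (h refl)

not-t : ∀ {a} → (a ≡ true → ⊥) → a ≡ false
not-t {false} _ = refl
not-t {true} h = ⊥-elim (h refl)

∧-intro : ∀ {a b} → a ≡ true → b ≡ true → a ∧ b ≡ true
∧-intro refl refl = refl

∧-fst : ∀ {a b} → a ∧ b ≡ true → a ≡ true
∧-fst {true} _ = refl

∧-snd : ∀ {a b} → a ∧ b ≡ true → b ≡ true
∧-snd {true} p = p

∨-inl : ∀ {a b} → a ≡ true → a ∨ b ≡ true
∨-inl refl = refl

∨-inr : ∀ {a b} → b ≡ true → a ∨ b ≡ true
∨-inr {true} _ = refl
∨-inr {false} p = p

∨-elim : ∀ {a b} → a ∨ b ≡ true → a ≡ true ⊎ b ≡ true
∨-elim {true} _ = inj₁ refl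
∨-elim {false} p = inj₂ p

not-≡t : ∀ {a} → a ≡ false → not a ≡ true
not-≡t refl = refl

not-≡f : ∀ {a} → not a ≡ true → a ≡ false
not-≡f {false} _ = refl

≡not-irrefl : ∀ {a} → a ≡ not a → ⊥
≡not-irrefl {true} ()
≡not-irrefl {false} ()

xor-cancelʳ : ∀ {a b} c → a xor c ≡ b xor c → a ≡ b
xor-cancelʳ {true} {true} c _ = refl
xor-cancelʳ {false} {false} c _ = refl
xor-cancelʳ {true} {false} true ()
xor-cancelʳ {true} {false} false ()
xor-cancelʳ {false} {true} true ()
xor-cancelʳ {false} {true} false ()

bool-ext : ∀ {a b} → (a ≡ true → b ≡ true) → (b ≡ true → a ≡ true) → a ≡ b
bool-ext {true} f g = sym (f refl)
bool-ext {false} {true} f g = g refl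
bool-ext {false} {false} f g = refl

xor-diff : ∀ {a b} → a xor b ≡ true → a ≡ not b
xor-diff {true} {false} _ = refl
xor-diff {false} {true} _ = refl

xor-same : ∀ {a b} → not (a xor b) ≡ true → a ≡ b
xor-same {true} {true} _ = refl
xor-same {false} {false} _ = refl

same-xor : ∀ {a b} → a ≡ b → not (a xor b) ≡ true
same-xor {true} refl = refl
same-xor {false} refl = refl

<ᵇ-t : ∀ {m k} → m < k → (m <ᵇ k) ≡ true
<ᵇ-t {m} {k} p with m <ᵇ k | ℕₚ.<⇒<ᵇ p
... | true | _ = refl

<ᵇ-⇒ : ∀ {m k} → (m <ᵇ k) ≡ true → m < k
<ᵇ-⇒ {m} {k} p = ℕₚ.<ᵇ⇒< m k (subst (λ b → IsTrue b) (sym p) _)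

<ᵇ-f : ∀ {m k} → k ≤ m → (m <ᵇ k) ≡ false
<ᵇ-f p = not-t (λ q → ℕₚ.<-irrefl refl (ℕₚ.<-≤-trans (<ᵇ-⇒ q) p))

<ᵇ-f⇒ : ∀ {m k} → (m <ᵇ k) ≡ false → k ≤ m
<ᵇ-f⇒ p = ℕₚ.≮⇒≥ (λ q → t≢f (<ᵇ-t q) p)

≤ᵇ-t : ∀ {m k} → m ≤ k → (m ≤ᵇ k) ≡ true
≤ᵇ-t {m} {k} p with m ≤ᵇ k | ℕₚ.≤⇒≤ᵇ p
... | true | _ = refl

≤ᵇ-⇒ : ∀ {m k} → (m ≤ᵇ k) ≡ true → m ≤ k
≤ᵇ-⇒ {m} {k} p = ℕₚ.≤ᵇ⇒≤ m k (subst (λ b → IsTrue b) (sym p) _)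

≡ᵇ-t : ∀ {m k} → m ≡ k → (m ≡ᵇ k) ≡ true
≡ᵇ-t {m} {k} p with m ≡ᵇ k | ℕₚ.≡⇒≡ᵇ m k p
... | true | _ = refl

≡ᵇ-⇒ : ∀ {m k} → (m ≡ᵇ k) ≡ true → m ≡ k
≡ᵇ-⇒ {m} {k} p = ℕₚ.≡ᵇ⇒≡ m k (subst (λ b → IsTrue b) (sym p) _)

-- Counting and pigeonhole arguments in lists.

𝟙 : Bool → ℕ
𝟙 true = 1
𝟙 false = 0

module _ {A : Set} where

  all-elim : ∀ (p : A → Bool) {xs x} → all p xs ≡ true → x ∈ xs → p x ≡ true
  all-elim p {y ∷ ys} e (here refl) = ∧-fst e
  all-elim p {y ∷ ys} e (there i) = all-elim p (∧-snd {p y} e) i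

  all-intro : ∀ (p : A → Bool) xs → (∀ x → x ∈ xs → p x ≡ true) → all p xs ≡ true
  all-intro p [] h = refl
  all-intro p (y ∷ ys) h = ∧-intro (h y (here refl)) (all-intro p ys (λ x i → h x (there i)))

  any-intro : ∀ (p : A → Bool) {xs x} → x ∈ xs → p x ≡ true → any p xs ≡ true
  any-intro p {y ∷ ys} (here refl) e = ∨-inl e
  any-intro p {y ∷ ys} (there i) e = ∨-inr {p y} (any-intro p i e)

  any-elim : ∀ (p : A → Bool) xs → any p xs ≡ true → ∃ λ x → x ∈ xs × p x ≡ true
  any-elim p (y ∷ ys) e with ∨-elim {p y} e
  ... | inj₁ q = y , here refl , q
  ... | inj₂ q with any-elim p ys q
  ... | x , i , r = x , there i , r

  all-false : ∀ (p : A → Bool) xs → all p xs ≡ false → ∃ λ x → x ∈ xs × p x ≡ false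
  all-false p (y ∷ ys) e with tf-dec (p y)
  ... | inj₂ q = y , here refl , q
  ... | inj₁ q with all-false p ys (subst (λ b → b ∧ all p ys ≡ false) q e)
  ... | x , i , r = x , there i , r

  ∈-filterᵇ⁺ : ∀ (p : A → Bool) {xs x} → x ∈ xs → p x ≡ true → x ∈ filterᵇ p xs
  ∈-filterᵇ⁺ p i e = ∈-filter⁺ (T? ∘ p) i (subst IsTrue (sym e) _)

  ∈-filterᵇ⁻ : ∀ (p : A → Bool) {xs x} → x ∈ filterᵇ p xs → x ∈ xs × p x ≡ true
  ∈-filterᵇ⁻ p {xs} {x} i with ∈-filter⁻ (T? ∘ p) {xs = xs} i
  ... | j , q with p x
  ... | true = j , refl

  count-∷ : ∀ (p : A → Bool) x xs → count p (x ∷ xs) ≡ 𝟙 (p x) + count p xs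
  count-∷ p x xs with p x
  ... | true = refl
  ... | false = refl

  -- Two counts on each side let a counting identity that would need subtraction be checked
  -- pointwise in ℕ.
  count-balance : ∀ (p q r s : A → Bool) xs → (∀ x → x ∈ xs → 𝟙 (p x) + 𝟙 (q x) ≡ 𝟙 (r x) + 𝟙 (s x)) →
                  count p xs + count q xs ≡ count r xs + count s xs
  count-balance p q r s [] h = refl
  count-balance p q r s (x ∷ xs) h
    rewrite count-∷ p x xs | count-∷ q x xs | count-∷ r x xs | count-∷ s x xs = begin
      (𝟙 (p x) + count p xs) + (𝟙 (q x) + count q xs) ≡⟨ inter (𝟙 (p x)) _ _ _ ⟩
      (𝟙 (p x) + 𝟙 (q x)) + (count p xs + count q xs) ≡⟨ cong₂ _+_ (h x (here refl))
          (count-balance p q r s xs (λ y i → h y (there i))) ⟩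
      (𝟙 (r x) + 𝟙 (s x)) + (count r xs + count s xs) ≡⟨ inter (𝟙 (r x)) _ _ _ ⟨
      (𝟙 (r x) + count r xs) + (𝟙 (s x) + count s xs) ∎
    where
    open ≡-Reasoning
    open import Algebra.Properties.CommutativeSemigroup ℕₚ.+-commutativeSemigroup using () renaming (interchange to inter)

  count-cong : ∀ (p q : A → Bool) xs → (∀ x → x ∈ xs → p x ≡ q x) → count p xs ≡ count q xs
  count-cong p q [] h = refl
  count-cong p q (x ∷ xs) h rewrite count-∷ p x xs | count-∷ q x xs =
    cong₂ (λ a b → 𝟙 a + b) (h x (here refl)) (count-cong p q xs (λ y i → h y (there i)))

  count-none : ∀ (p : A → Bool) xs → (∀ x → x ∈ xs → p x ≡ false) → count p xs ≡ 0
  count-none p [] h = refl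
  count-none p (x ∷ xs) h rewrite count-∷ p x xs | h x (here refl) = count-none p xs (λ y i → h y (there i))

  count-0 : ∀ (p : A → Bool) {xs x} → count p xs ≡ 0 → x ∈ xs → p x ≡ false
  count-0 p {y ∷ ys} {x} e i rewrite count-∷ p y ys with p y in py
  count-0 p {y ∷ ys} e (here refl) | false = py
  count-0 p {y ∷ ys} e (there i) | false = count-0 p e i

  count-∧-filterᵇ : ∀ (p q : A → Bool) xs → count (λ x → p x ∧ q x) xs ≡ count p (filterᵇ q xs)
  count-∧-filterᵇ p q [] = refl
  count-∧-filterᵇ p q (x ∷ xs) rewrite count-∷ (λ x → p x ∧ q x) x xs with q x
  ... | true rewrite count-∷ p x (filterᵇ q xs) = cong₂ (λ a b → 𝟙 a + b) (𝔹ₚ.∧-identityʳ (p x))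
      (count-∧-filterᵇ p q xs)
  ... | false rewrite 𝔹ₚ.∧-zeroʳ (p x) = count-∧-filterᵇ p q xs

  -- Pigeonhole for a relation instead of a function, so that it serves for injections as well as
  -- for comparing families of class representatives. The witness of the head can be deleted from
  -- `ys` because no later element is related to it.
  rel-pigeon : ∀ (R : A → A → Set) xs ys → (∀ x → x ∈ xs → ∃ λ y → y ∈ ys × R x y) →
               AllPairs (λ x x' → ∀ y → R x y → R x' y → ⊥) xs → length xs ≤ length ys
  rel-pigeon R [] ys h a = z≤n
  rel-pigeon R (x ∷ xs) ys h (ax ∷ a) with h x (here refl)
  ... | y , y∈ , rxy with ∈-∃++ y∈
  ... | us , vs , refl = subst (suc (length xs) ≤_) (sym len) (s≤s (rel-pigeon R xs (us ++ vs) h' a))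
    where
    len : length (us ++ y ∷ vs) ≡ suc (length (us ++ vs))
    len = trans (Listₚ.length-++ us) (trans (ℕₚ.+-suc _ _) (cong suc (sym (Listₚ.length-++ us))))
    h' : ∀ x' → x' ∈ xs → ∃ λ y' → y' ∈ us ++ vs × R x' y'
    h' x' i with h x' (there i)
    ... | y' , y'∈ , r with ∈-++⁻ us y'∈
    ... | inj₁ j = y' , ∈-++⁺ˡ j , r
    ... | inj₂ (here refl) = ⊥-elim (All.lookup ax i y' rxy r)
    ... | inj₂ (there j) = y' , ∈-++⁺ʳ us j , r

  ∈⇒AllPairs : ∀ {R : A → A → Set} {xs} → Unique xs → (∀ x y → x ∈ xs → y ∈ xs → x ≢ y → R x y) → AllPairs R xs
  ∈⇒AllPairs {xs = []} _ h = []
  ∈⇒AllPairs {xs = x ∷ xs} (ux ∷ u) h =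
    All.tabulate (λ {y} i → h x y (here refl) (there i) (All.lookup ux i))
    ∷ ∈⇒AllPairs u (λ a b i j → h a b (there i) (there j))

  unique-filterᵇ : ∀ (p : A → Bool) {xs} → Unique xs → Unique (filterᵇ p xs)
  unique-filterᵇ p u = Uniqueₚ.filter⁺ (T? ∘ p) u

count-injection : ∀ {A : Set} (f : A → A) (p q : A → Bool) {xs} → Unique xs → (∀ x → p x ≡ true → q (f x) ≡ true) →
  (∀ x → x ∈ xs → f x ∈ xs) → (∀ x y → p x ≡ true → p y ≡ true → f x ≡ f y → x ≡ y) → count p xs ≤ count q xs
count-injection f p q {xs} u pq fi inj =
  rel-pigeon (λ x y → f x ≡ y) (filterᵇ p xs) (filterᵇ q xs)
    (λ x i → let j , e = ∈-filterᵇ⁻ p i in f x , ∈-filterᵇ⁺ q (fi x j) (pq x e) , refl)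
    (∈⇒AllPairs (unique-filterᵇ p u) (λ x y i j ne z e e' →
       ne (inj x y (proj₂ (∈-filterᵇ⁻ p {xs} i)) (proj₂ (∈-filterᵇ⁻ p {xs} j)) (trans e (sym e')))))

module _ {n : ℕ} where

  allF : ∀ (p : Fin n → Bool) → all p (allFin n) ≡ true → ∀ x → p x ≡ true
  allF p e x = all-elim p {allFin n} e (∈-allFin x)

  allF⁺ : ∀ (p : Fin n → Bool) → (∀ x → p x ≡ true) → all p (allFin n) ≡ true
  allF⁺ p h = all-intro p (allFin n) (λ x _ → h x)

  anyF⁺ : ∀ (p : Fin n → Bool) x → p x ≡ true → any p (allFin n) ≡ true
  anyF⁺ p x e = any-intro p (∈-allFin x) e

  anyF : ∀ (p : Fin n → Bool) → any p (allFin n) ≡ true → ∃ λ x → p x ≡ true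
  anyF p e = let x , _ , q = any-elim p (allFin n) e in x , q

  uniqueF : Unique (allFin n)
  uniqueF = Uniqueₚ.allFin⁺ n

  count-≤n : ∀ (p : Fin n → Bool) → count p (allFin n) ≤ n
  count-≤n p = subst (count p (allFin n) ≤_) (Listₚ.length-tabulate {n = n} (λ i → i))
      (Listₚ.length-filter (T? ∘ p) (allFin n))

  count-mono : ∀ (p q : Fin n → Bool) → (∀ x → p x ≡ true → q x ≡ true) → count p (allFin n) ≤ count q (allFin n)
  count-mono p q h = count-injection (λ x → x) p q uniqueF h (λ _ i → i) (λ _ _ _ _ e → e)

  count-single : ∀ (y : Fin n) (p : Fin n → Bool) → p y ≡ true → (∀ x → p x ≡ true → x ≡ y) → count p (allFin n) ≡ 1
  count-single y p e h = ℕₚ.≤-antisym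
    (rel-pigeon (λ a b → b ≡ y) (filterᵇ p (allFin n)) (y ∷ []) (λ x i → y , here refl , refl)
      (∈⇒AllPairs (unique-filterᵇ p uniqueF) λ a b i j ne _ _ _ →
        ne (trans (h a (proj₂ (∈-filterᵇ⁻ p {allFin n} i))) (sym (h b (proj₂ (∈-filterᵇ⁻ p {allFin n} j)))))))
    (rel-pigeon _≡_ (y ∷ []) (filterᵇ p (allFin n)) (λ { x (here refl) → x , ∈-filterᵇ⁺ p (∈-allFin x) e , refl })
        ([] ∷ []))

  count-strict : ∀ (p q : Fin n → Bool) y → (∀ x → p x ≡ true → q x ≡ true) → p y ≡ false → q y ≡ true →
                 count p (allFin n) < count q (allFin n)
  count-strict p q y h py qy = subst (_≤ count q (allFin n)) eq (count-mono r q r⇒q)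
    where
    y? : Fin n → Bool
    y? x = ⌊ x Finₚ.≟ y ⌋
    y?⇒ : ∀ x → y? x ≡ true → x ≡ y
    y?⇒ x e with x Finₚ.≟ y
    ... | yes q = q
    y?y : y? y ≡ true
    y?y with y Finₚ.≟ y
    ... | yes _ = refl
    ... | no q = ⊥-elim (q refl)
    r : Fin n → Bool
    r x = p x ∨ y? x
    r⇒q : ∀ x → r x ≡ true → q x ≡ true
    r⇒q x e with ∨-elim {p x} e
    ... | inj₁ a = h x a
    ... | inj₂ b with y?⇒ x b
    ... | refl = qy
    z : Fin n → Bool
    z _ = false
    pt : ∀ x → 𝟙 (r x) + 𝟙 (z x) ≡ 𝟙 (p x) + 𝟙 (y? x)
    pt x with p x in px | y? x in yx
    ... | true | true = ⊥-elim (t≢f px (trans (cong p (y?⇒ x yx)) py))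
    ... | true | false = refl
    ... | false | true = refl
    ... | false | false = refl
    eq : count r (allFin n) ≡ suc (count p (allFin n))
    eq = trans (sym (ℕₚ.+-identityʳ _))
       (trans (cong (λ k → count r (allFin n) + k) (sym (count-none z (allFin n) (λ _ _ → refl))))
       (trans (count-balance r z p y? (allFin n) (λ x _ → pt x))
       (trans (cong (λ k → count p (allFin n) + k) (count-single y y? y?y y?⇒)) (ℕₚ.+-comm _ 1))))

-- Orbits of an injection of a finite set.

iter-+ : ∀ {A : Set} (f : A → A) j k x → iter f (j + k) x ≡ iter f j (iter f k x)
iter-+ f zero k x = refl
iter-+ f (suc j) k x = cong f (iter-+ f j k x)

iter-cong : ∀ {A : Set} (f g : A → A) → (∀ x → f x ≡ g x) → ∀ k x → iter f k x ≡ iter g k x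
iter-cong f g h zero x = refl
iter-cong f g h (suc k) x = trans (h _) (cong g (iter-cong f g h k x))

module Orbit {n : ℕ} (f : Fin n → Fin n) (inj : ∀ x y → f x ≡ f y → x ≡ y) where

  Orb : Fin n → Fin n → Set
  Orb x y = ∃ λ k → iter f k x ≡ y

  iter-inj : ∀ k x y → iter f k x ≡ iter f k y → x ≡ y
  iter-inj zero x y e = e
  iter-inj (suc k) x y e = iter-inj k x y (inj _ _ e)

  period : ∀ x → ∃ λ m → m < n × iter f (suc m) x ≡ x
  period x with Finₚ.pigeonhole {n} {suc n} (ℕₚ.n<1+n n) (λ i → iter f (toℕ i) x)
  ... | i , j , i<j , e = m , m<n , iter-inj (toℕ i) _ _ e'
    where
    m : ℕ
    m = toℕ j ∸ suc (toℕ i)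
    j≡ : toℕ j ≡ toℕ i + suc m
    j≡ = sym (trans (ℕₚ.+-suc (toℕ i) m) (ℕₚ.m+[n∸m]≡n i<j))
    m<n : m < n
    m<n = ℕₚ.≤-trans (ℕₚ.m≤n+m (suc m) (toℕ i)) (subst (_≤ n) j≡ (Finₚ.toℕ≤pred[n] j))
    e' : iter f (toℕ i) (iter f (suc m) x) ≡ iter f (toℕ i) x
    e' = trans (sym (iter-+ f (toℕ i) (suc m) x)) (trans (cong (λ k → iter f k x) (sym j≡)) (sym e))

  Orb-trans : ∀ {x y z} → Orb x y → Orb y z → Orb x z
  Orb-trans {x} (j , refl) (k , refl) = k + j , iter-+ f k j x

  Orb-unstep : ∀ x → Orb (f x) x
  Orb-unstep x with period x
  ... | m , _ , e = m , trans (sym (trans (cong (λ k → iter f k x) (sym (ℕₚ.+-comm m 1))) (iter-+ f m 1 x))) e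

  Orb-sym : ∀ {x y} → Orb x y → Orb y x
  Orb-sym (zero , refl) = 0 , refl
  Orb-sym {x} (suc k , refl) = Orb-trans (Orb-unstep (iter f k x)) (Orb-sym (k , refl))

  Orb-bounded : ∀ {x y} → Orb x y → ∃ λ k → k < n × iter f k x ≡ y
  Orb-bounded {x} (zero , e) = 0 , ℕₚ.≤-trans (s≤s z≤n) (proj₁ (proj₂ (period x))) , e
  Orb-bounded {x} (suc k , refl) with Orb-bounded {x} (k , refl)
  ... | j , j<n , e with ℕₚ.m≤n⇒m<n∨m≡n j<n
  ... | inj₁ sj<n = suc j , sj<n , cong f e
  -- The exponent would become `n` here, so one period is subtracted; `sameV` tests only exponents
  -- below `n`.
  ... | inj₂ refl with period x
  ... | m , m<n , pe = j ∸ m , s≤s (ℕₚ.m∸n≤m j m) ,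
        trans (cong (iter f (j ∸ m)) (sym pe)) (trans (sym (iter-+ f (j ∸ m) (suc m) x))
          (trans (cong (λ z → iter f z x) (trans (ℕₚ.+-suc (j ∸ m) m) (cong suc (ℕₚ.m∸n+n≡m (ℕₚ.≤-pred m<n)))))
              (cong f e)))

-- The function `pos` is the length of such a prefix; this identifies that length as the least
-- exponent at which the half-edge is met.
takeWhileᵇ-least : ∀ {A : Set} (p : A → Bool) (f : ℕ → A) m i → i < m → p (f i) ≡ false →
  let j = length (takeWhileᵇ p (applyUpTo f m)) in j ≤ i × p (f j) ≡ false
takeWhileᵇ-least p f (suc m) i lt e with p (f 0) in eq
... | false = z≤n , eq
takeWhileᵇ-least p f (suc m) zero lt e | true = ⊥-elim (t≢f eq e)
takeWhileᵇ-least p f (suc m) (suc i) (s≤s lt) e | true =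
  let a , b = takeWhileᵇ-least p (λ k → f (suc k)) m i lt e in s≤s a , b

<⇒suc : ∀ {a b} → a < b → ∃ λ k → b ≡ suc k
<⇒suc (s≤s {n = k} _) = k , refl

vec-ext : ∀ {A : Set} {n} {v w : Vec A n} → (∀ x → lookup v x ≡ lookup w x) → v ≡ w
vec-ext {v = v} {w} h = trans (sym (tabulate∘lookup v)) (trans (tabulate-cong h) (tabulate∘lookup w))

≡not-cases : ∀ {a b} → a ≡ not b → (a ≡ true × b ≡ false) ⊎ (a ≡ false × b ≡ true)
≡not-cases {true} {false} _ = inj₁ (refl , refl)
≡not-cases {false} {true} _ = inj₂ (refl , refl)

≢⇒≡not : ∀ {a b} → (a ≡ b → ⊥) → a ≡ not b
≢⇒≡not {true} {true} h = ⊥-elim (h refl)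
≢⇒≡not {true} {false} h = refl
≢⇒≡not {false} {true} h = refl
≢⇒≡not {false} {false} h = ⊥-elim (h refl)

least-failure : ∀ {Q : ℕ → Set} → (∀ k → Q k ⊎ (Q k → ⊥)) → ∀ m →
  (∀ k → k < m → Q k) ⊎ ∃ λ k → k < m × (Q k → ⊥) × (∀ j → j < k → Q j)
least-failure dec zero = inj₁ (λ k ())
least-failure dec (suc m) with least-failure dec m
... | inj₂ (k , lt , fails , all) = inj₂ (k , ℕₚ.m<n⇒m<1+n lt , fails , all)
... | inj₁ all with dec m
... | inj₂ fails = inj₂ (m , ℕₚ.n<1+n m , fails , all)
... | inj₁ q = inj₁ go
  where
  go : ∀ k → k < suc m → _
  go k lt with ℕₚ.m≤n⇒m<n∨m≡n (ℕₚ.≤-pred lt)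
  ... | inj₁ l = all k l
  ... | inj₂ refl = q

argmin : ∀ {A : Set} (f : A → ℕ) x xs → ∃ λ m → m ∈ (x ∷ xs) × (∀ y → y ∈ (x ∷ xs) → f m ≤ f y)
argmin f x [] = x , here refl , λ { y (here refl) → ℕₚ.≤-refl }
argmin f x (z ∷ zs) with argmin f z zs
... | m , i , le with ℕₚ.≤-total (f x) (f m)
... | inj₁ l = x , here refl , λ { y (here refl) → ℕₚ.≤-refl ; y (there j) → ℕₚ.≤-trans l (le y j) }
... | inj₂ l = m , there i , λ { y (here refl) → l ; y (there j) → le y j }

-- Coefficients of polynomials and sums over lists.

coeff-+P : ∀ p q i → coeff (p +P q) i ≡ coeff p i +ℤ coeff q i
coeff-+P [] q i = sym (ℤₚ.+-identityˡ _)
coeff-+P (a ∷ p) [] i = sym (ℤₚ.+-identityʳ _)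
coeff-+P (a ∷ p) (b ∷ q) zero = refl
coeff-+P (a ∷ p) (b ∷ q) (suc i) = coeff-+P p q i

coeff-scaleP : ∀ c p i → coeff (scaleP c p) i ≡ c *ℤ coeff p i
coeff-scaleP c [] i = sym (ℤₚ.*-zeroʳ c)
coeff-scaleP c (a ∷ p) zero = refl
coeff-scaleP c (a ∷ p) (suc i) = coeff-scaleP c p i

coeff-*constP : ∀ p c i → coeff (p *P constP c) i ≡ coeff p i *ℤ c
coeff-*constP [] c i = refl
coeff-*constP (a ∷ p) c zero = ℤₚ.+-identityʳ _
coeff-*constP (a ∷ p) c (suc i) = coeff-*constP p c i

coeff-0∷ : ∀ i → coeff (+ 0 ∷ []) i ≡ + 0
coeff-0∷ zero = refl
coeff-0∷ (suc i) = refl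

coeff-1*P : ∀ p i → coeff ((+ 1 ∷ []) *P p) i ≡ coeff p i
coeff-1*P p i = begin
  coeff (scaleP (+ 1) p +P (+ 0 ∷ [])) i            ≡⟨ coeff-+P (scaleP (+ 1) p) _ i ⟩
  coeff (scaleP (+ 1) p) i +ℤ coeff (+ 0 ∷ []) i    ≡⟨ cong₂ _+ℤ_ (coeff-scaleP (+ 1) p i) (coeff-0∷ i) ⟩
  + 1 *ℤ coeff p i +ℤ + 0                           ≡⟨ ℤₚ.+-identityʳ _ ⟩
  + 1 *ℤ coeff p i                                  ≡⟨ ℤₚ.*-identityˡ _ ⟩
  coeff p i                                         ∎
  where open ≡-Reasoning

coeff-linear-0 : ∀ a p → coeff ((a ∷ + 1 ∷ []) *P p) 0 ≡ a *ℤ coeff p 0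
coeff-linear-0 a p = trans (coeff-+P (scaleP a p) _ 0) (trans (ℤₚ.+-identityʳ _) (coeff-scaleP a p 0))

coeff-linear-suc : ∀ a p i → coeff ((a ∷ + 1 ∷ []) *P p) (suc i) ≡ a *ℤ coeff p (suc i) +ℤ coeff p i
coeff-linear-suc a p i = trans (coeff-+P (scaleP a p) _ (suc i))
    (cong₂ _+ℤ_ (coeff-scaleP a p (suc i)) (coeff-1*P p i))

⟦_⟧ : Bool → ℤ
⟦ true ⟧ = + 1
⟦ false ⟧ = + 0

coeff-x^ : ∀ k i → coeff ((+ 0 ∷ + 1 ∷ []) ^P k) i ≡ ⟦ k ≡ᵇ i ⟧
coeff-x^ zero zero = refl
coeff-x^ zero (suc i) = refl
coeff-x^ (suc k) zero = trans (coeff-linear-0 (+ 0) ((+ 0 ∷ + 1 ∷ []) ^P k)) refl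
coeff-x^ (suc k) (suc i) = trans (coeff-linear-suc (+ 0) ((+ 0 ∷ + 1 ∷ []) ^P k) i)
  (trans (ℤₚ.+-identityˡ _) (coeff-x^ k i))

-- the coefficient of x^i in (x - 1)^u x^m
shifted : ℕ → ℕ → ℕ → ℤ
shifted zero m i = ⟦ m ≡ᵇ i ⟧
shifted (suc u) m i = shifted u (suc m) i -ℤ shifted u m i

shifted-0 : ∀ u m → shifted u (suc m) 0 ≡ + 0
shifted-0 zero m = refl
shifted-0 (suc u) m rewrite shifted-0 u (suc m) | shifted-0 u m = refl

shifted-suc : ∀ u m i → shifted u (suc m) (suc i) ≡ shifted u m i
shifted-suc zero m i = refl
shifted-suc (suc u) m i = cong₂ _-ℤ_ (shifted-suc u (suc m) i) (shifted-suc u m i)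

coeff-[x-1]^ : ∀ u i → coeff ((- + 1 ∷ + 1 ∷ []) ^P u) i ≡ shifted u 0 i
coeff-[x-1]^ zero zero = refl
coeff-[x-1]^ zero (suc i) = refl
coeff-[x-1]^ (suc u) zero = begin
  coeff ((- + 1 ∷ + 1 ∷ []) *P p) 0     ≡⟨ coeff-linear-0 (- + 1) p ⟩
  - + 1 *ℤ coeff p 0                    ≡⟨ cong (- + 1 *ℤ_) (coeff-[x-1]^ u 0) ⟩
  - + 1 *ℤ shifted u 0 0                ≡⟨ ℤₚ.-1*i≡-i _ ⟩
  - shifted u 0 0                       ≡⟨ ℤₚ.+-identityˡ _ ⟨
  + 0 -ℤ shifted u 0 0                  ≡⟨ cong (_-ℤ shifted u 0 0) (shifted-0 u 0) ⟨
  shifted u 1 0 -ℤ shifted u 0 0        ∎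
  where
  open ≡-Reasoning
  p : Poly
  p = (- + 1 ∷ + 1 ∷ []) ^P u
coeff-[x-1]^ (suc u) (suc i) = begin
  coeff ((- + 1 ∷ + 1 ∷ []) *P p) (suc i)              ≡⟨ coeff-linear-suc (- + 1) p i ⟩
  - + 1 *ℤ coeff p (suc i) +ℤ coeff p i                ≡⟨ cong₂ (λ a b → - + 1 *ℤ a +ℤ b) (coeff-[x-1]^ u (suc i))
      (coeff-[x-1]^ u i) ⟩
  - + 1 *ℤ shifted u 0 (suc i) +ℤ shifted u 0 i        ≡⟨ cong (_+ℤ shifted u 0 i)
      (ℤₚ.-1*i≡-i (shifted u 0 (suc i))) ⟩
  - shifted u 0 (suc i) +ℤ shifted u 0 i               ≡⟨ ℤₚ.+-comm (- shifted u 0 (suc i)) _ ⟩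
  shifted u 0 i -ℤ shifted u 0 (suc i)                 ≡⟨ cong (_-ℤ shifted u 0 (suc i)) (shifted-suc u 0 i) ⟨
  shifted u 1 (suc i) -ℤ shifted u 0 (suc i)           ∎
  where
  open ≡-Reasoning
  p : Poly
  p = (- + 1 ∷ + 1 ∷ []) ^P u

sumOver : ∀ {A : Set} → (A → ℤ) → List A → ℤ
sumOver f xs = foldr _+ℤ_ (+ 0) (map f xs)

coeff-sumP : ∀ {A : Set} (f : A → Poly) xs i → coeff (sumP (map f xs)) i ≡ sumOver (λ x → coeff (f x) i) xs
coeff-sumP f [] i = refl
coeff-sumP f (x ∷ xs) i = trans (coeff-+P (f x) _ i) (cong (coeff (f x) i +ℤ_) (coeff-sumP f xs i))

module _ {A : Set} where

  sumOver-cong : ∀ (f g : A → ℤ) xs → (∀ x → x ∈ xs → f x ≡ g x) → sumOver f xs ≡ sumOver g xs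
  sumOver-cong f g [] h = refl
  sumOver-cong f g (x ∷ xs) h = cong₂ _+ℤ_ (h x (here refl)) (sumOver-cong f g xs (λ y i → h y (there i)))

  sumOver-+ : ∀ (f g : A → ℤ) xs → sumOver (λ x → f x +ℤ g x) xs ≡ sumOver f xs +ℤ sumOver g xs
  sumOver-+ f g [] = refl
  sumOver-+ f g (x ∷ xs) = trans (cong (f x +ℤ g x +ℤ_) (sumOver-+ f g xs))
    (solve 4 (λ a b c d → (a :+ b) :+ (c :+ d) := (a :+ c) :+ (b :+ d)) refl (f x) (g x) (sumOver f xs)
        (sumOver g xs))
    where open +-*-Solver

  sumOver-↭ : ∀ (f : A → ℤ) {xs ys} → xs ↭ ys → sumOver f xs ≡ sumOver f ys
  sumOver-↭ f ↭.refl = refl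
  sumOver-↭ f (↭.prep x p) = cong (f x +ℤ_) (sumOver-↭ f p)
  sumOver-↭ f {ys = _ ∷ _ ∷ ys} (↭.swap x y p) = trans (cong (λ z → f x +ℤ (f y +ℤ z)) (sumOver-↭ f p))
    (solve 3 (λ a b c → a :+ (b :+ c) := b :+ (a :+ c)) refl (f x) (f y) (sumOver f ys))
    where open +-*-Solver
  sumOver-↭ f (↭.trans p q) = trans (sumOver-↭ f p) (sumOver-↭ f q)

  sumOver-map : ∀ (f : A → ℤ) (τ : A → A) xs → sumOver f (map τ xs) ≡ sumOver (λ x → f (τ x)) xs
  sumOver-map f τ [] = refl
  sumOver-map f τ (x ∷ xs) = cong (f (τ x) +ℤ_) (sumOver-map f τ xs)

  sumOver-count : ∀ (χ : A → Bool) xs → sumOver (λ x → ⟦ χ x ⟧) xs ≡ + count χ xs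
  sumOver-count χ [] = refl
  sumOver-count χ (x ∷ xs) rewrite count-∷ χ x xs | sumOver-count χ xs with χ x
  ... | true = refl
  ... | false = refl

  map-unique : ∀ (τ : A → A) {xs} → Unique xs → (∀ x y → x ∈ xs → y ∈ xs → τ x ≡ τ y → x ≡ y) → Unique (map τ xs)
  map-unique τ [] inj = []
  map-unique τ {x ∷ xs} (a ∷ u) inj = All.tabulate differ ∷ map-unique τ u (λ y z i j → inj y z (there i) (there j))
    where
    differ : ∀ {z} → z ∈ map τ xs → τ x ≢ z
    differ i e with ∈-map⁻ τ i
    ... | y , j , refl = All.lookup a j (inj x y (here refl) (there j) e)

  -- Doubling both sums and pairing x with τ x
  sumOver-involution : ∀ (f g : A → ℤ) (τ : A → A) {xs} → Unique xs → (∀ x → x ∈ xs → τ x ∈ xs) →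
      (∀ x → x ∈ xs → τ (τ x) ≡ x) →
    (∀ x → x ∈ xs → f x +ℤ f (τ x) ≡ g x +ℤ g (τ x)) → sumOver f xs ≡ sumOver g xs
  sumOver-involution f g τ {xs} u cl inv pt = double (trans (twice f)
      (trans (sumOver-cong _ _ xs pt) (sym (twice g))))
    where
    perm : map τ xs ↭ xs
    perm = ∼bag⇒↭ (unique∧set⇒bag (map-unique τ u (λ x y i j e → trans (sym (inv x i))
        (trans (cong τ e) (inv y j)))) u
      (λ {z} → mk⇔ (λ i → let y , j , e = ∈-map⁻ τ i in subst (_∈ xs) (sym e) (cl y j))
           (λ i → subst (_∈ map τ xs) (inv z i) (∈-map⁺ τ (cl z i)))))
    twice : ∀ f → sumOver f xs +ℤ sumOver f xs ≡ sumOver (λ x → f x +ℤ f (τ x)) xs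
    twice f = trans (cong (sumOver f xs +ℤ_) (sym (trans (sym (sumOver-map f τ xs)) (sumOver-↭ f perm))))
        (sym (sumOver-+ f _ xs))
    double : ∀ {a b} → a +ℤ a ≡ b +ℤ b → a ≡ b
    double {a} {b} e = ℤₚ.*-cancelˡ-≡ (+ 2) a b (trans (two a) (trans e (sym (two b))))
      where
      two : ∀ c → + 2 *ℤ c ≡ c +ℤ c
      two c = trans (ℤₚ.*-distribʳ-+ c (+ 1) (+ 1)) (cong₂ _+ℤ_ (ℤₚ.*-identityˡ c) (ℤₚ.*-identityˡ c))

private
  extend : ∀ {m} → List (Vec Bool m) → List (Vec Bool (suc m))
  extend = concatMap (λ v → (false ∷ v) ∷ (true ∷ v) ∷ [])

  ∈-extend⁺ : ∀ {m} b (v : Vec Bool m) vs → v ∈ vs → (b ∷ v) ∈ extend vs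
  ∈-extend⁺ false v (w ∷ vs) (here refl) = here refl
  ∈-extend⁺ true v (w ∷ vs) (here refl) = there (here refl)
  ∈-extend⁺ b v (w ∷ vs) (there i) = there (there (∈-extend⁺ b v vs i))

  ∈-extend⁻ : ∀ {m} b (v : Vec Bool m) vs → (b ∷ v) ∈ extend vs → v ∈ vs
  ∈-extend⁻ b v (w ∷ vs) (here refl) = here refl
  ∈-extend⁻ b v (w ∷ vs) (there (here refl)) = here refl
  ∈-extend⁻ b v (w ∷ vs) (there (there i)) = there (∈-extend⁻ b v vs i)

  extend-unique : ∀ {m} {vs : List (Vec Bool m)} → Unique vs → Unique (extend vs)
  extend-unique [] = []
  extend-unique {vs = v ∷ vs} (a ∷ u) =
    ((λ ()) ∷ All.tabulate (λ i → fresh false i)) ∷ All.tabulate (λ i → fresh true i) ∷ extend-unique u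
    where
    fresh : ∀ b {w} → w ∈ extend vs → (b ∷ v) ≢ w
    fresh b i refl = All.lookup a (∈-extend⁻ b v vs i) refl

∈-allVecs : ∀ {m} (v : Vec Bool m) → v ∈ allVecs m
∈-allVecs [] = here refl
∈-allVecs (b ∷ v) = ∈-extend⁺ b v _ (∈-allVecs v)

allVecs-unique : ∀ m → Unique (allVecs m)
allVecs-unique zero = [] ∷ []
allVecs-unique (suc m) = extend-unique (allVecs-unique m)

count-ʳ++ : ∀ {A : Set} (p : A → Bool) xs ys → count p (xs ʳ++ ys) ≡ count p xs + count p ys
count-ʳ++ p [] ys = refl
count-ʳ++ p (x ∷ xs) ys = trans (count-ʳ++ p xs (x ∷ ys)) (trans (cong (λ z → count p xs + z) (count-∷ p x ys))
  (trans (sym (ℕₚ.+-assoc (count p xs) (𝟙 (p x)) (count p ys)))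
    (cong (_+ count p ys) (trans (ℕₚ.+-comm (count p xs) (𝟙 (p x))) (sym (count-∷ p x xs))))))

⟦⟧-∧ : ∀ a b → ⟦ a ⟧ *ℤ ⟦ b ⟧ ≡ ⟦ a ∧ b ⟧
⟦⟧-∧ true true = refl
⟦⟧-∧ true false = refl
⟦⟧-∧ false true = refl
⟦⟧-∧ false false = refl

if-⟦⟧ : ∀ a b → (if a then ⟦ b ⟧ else + 0) ≡ ⟦ a ∧ b ⟧
if-⟦⟧ true b = refl
if-⟦⟧ false b = refl

0^ : ∀ k → (+ 0) ^ℤ k ≡ ⟦ k ≡ᵇ 0 ⟧
0^ zero = refl
0^ (suc k) = refl

-- the value of (y - 1)^u y^m at y = 0
signed : ℕ → ℕ → ℤ
signed u m = (- + 1) ^ℤ u *ℤ (+ 0) ^ℤ m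

signed-rec : ∀ u m → signed (suc u) m +ℤ signed u m ≡ signed u (suc m)
signed-rec u m = solve 2 (λ a b → (con (- + 1) :* a) :* b :+ a :* b := a :* (con (+ 0) :* b)) refl ((- + 1) ^ℤ u)
    ((+ 0) ^ℤ m)
  where open +-*-Solver

-- Vertices, edges and components of a rooted map.

module Map {n : ℕ} (M : RootedMap n) where
  open RootedMap M
  open MapDefs M

  ==-refl : ∀ x → (x == x) ≡ true
  ==-refl x with x Finₚ.≟ x
  ... | yes _ = refl
  ... | no q = ⊥-elim (q refl)

  ==⇒ : ∀ {x y} → (x == y) ≡ true → x ≡ y
  ==⇒ {x} {y} e with x Finₚ.≟ y
  ... | yes q = q

  sameEdge⇒ : ∀ {x e} → sameEdge x e ≡ true → x ≡ e ⊎ x ≡ α e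
  sameEdge⇒ {x} {e} p with ∨-elim {x == e} p
  ... | inj₁ q = inj₁ (==⇒ q)
  ... | inj₂ q = inj₂ (==⇒ q)

  sameEdge-refl : ∀ e → sameEdge e e ≡ true
  sameEdge-refl e = ∨-inl (==-refl e)

  sameEdge-α : ∀ e → sameEdge (α e) e ≡ true
  sameEdge-α e = ∨-inr {α e == e} (==-refl (α e))

  sameEdge-no : ∀ {x e} → x ≢ e → x ≢ α e → sameEdge x e ≡ false
  sameEdge-no {x} {e} p q = not-t (λ r → [ p , q ]′ (sameEdge⇒ {x} {e} r))

  α-inj : ∀ {x y} → α x ≡ α y → x ≡ y
  α-inj {x} {y} e = trans (sym (α-invol x)) (trans (cong α e) (α-invol y))

  α≢ : ∀ {x} → x ≢ α x
  α≢ {x} e = α-fpf x (sym e)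

  σ-inj : ∀ x y → σf x ≡ σf y → x ≡ y
  σ-inj x y e = trans (sym (inverseˡ σ)) (trans (cong (σ ⟨$⟩ˡ_) e) (inverseˡ σ))

  module σO = Orbit σf σ-inj

  -- A wrapper around the Boolean equation, so that the two half-edges can be recovered from the
  -- type.
  record _≈_ (x y : Fin n) : Set where
    constructor mk≈
    field un≈ : sameV x y ≡ true
  open _≈_ public

  ≈⇒Orb : ∀ {x y} → x ≈ y → σO.Orb x y
  ≈⇒Orb {x} {y} (mk≈ e) with any-elim (λ k → iter σf k x == y) (upTo n) e
  ... | k , _ , q = k , ==⇒ q

  Orb⇒≈ : ∀ {x y} → σO.Orb x y → x ≈ y
  Orb⇒≈ {x} {y} o with σO.Orb-bounded o
  ... | k , k<n , refl = mk≈ (any-intro (λ j → iter σf j x == iter σf k x) (∈-upTo⁺ k<n) (==-refl _))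

  ≈-refl : ∀ {x} → x ≈ x
  ≈-refl = Orb⇒≈ (0 , refl)

  ≈-sym : ∀ {x y} → x ≈ y → y ≈ x
  ≈-sym e = Orb⇒≈ (σO.Orb-sym (≈⇒Orb e))

  ≈-trans : ∀ {x y z} → x ≈ y → y ≈ z → x ≈ z
  ≈-trans e f = Orb⇒≈ (σO.Orb-trans (≈⇒Orb e) (≈⇒Orb f))

  ≈σ : ∀ x → x ≈ σf x
  ≈σ x = Orb⇒≈ (1 , refl)

  ≈σ⁻ : ∀ x → x ≈ (σ ⟨$⟩ˡ x)
  ≈σ⁻ x = ≈-sym (subst (λ z → (σ ⟨$⟩ˡ x) ≈ z) (inverseʳ σ) (≈σ (σ ⟨$⟩ˡ x)))

  -- The bounded closure is already transitively closed, because the reached set gains an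
  -- element at every step until it stabilises.

  module _ (st : Fin n → Fin n → Bool) where

    closure-mono : ∀ {h x} d k → closure st k h x ≡ true → closure st (d + k) h x ≡ true
    closure-mono zero k p = p
    closure-mono (suc d) k p = ∨-inl (closure-mono d k p)

    closure-ind : ∀ {h} (X : Fin n → Set) → X h → (∀ m x → X m → st m x ≡ true → X x) →
                  ∀ k x → closure st k h x ≡ true → X x
    closure-ind X xh step zero x p = subst X (==⇒ p) xh
    closure-ind {h} X xh step (suc k) x p with ∨-elim {closure st k h x} p
    ... | inj₁ q = closure-ind X xh step k x q
    ... | inj₂ q with anyF (λ m → closure st k h m ∧ st m x) q
    ... | m , r = step m x (closure-ind X xh step k m (∧-fst r)) (∧-snd {closure st k h m} r)

    Stable : Fin n → ℕ → Set
    Stable h k = ∀ m x → closure st k h m ≡ true → st m x ≡ true → closure st k h x ≡ true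

    grows : ∀ h k → (∃ λ j → j ≤ k × Stable h j) ⊎ k < count (closure st k h) H
    grows h zero = inj₂ (ℕₚ.≤-reflexive (sym (count-single h (closure st 0 h) (==-refl h) (λ x e → sym (==⇒ e)))))
    grows h (suc k) with grows h k
    ... | inj₁ (j , j≤k , s) = inj₁ (j , ℕₚ.m≤n⇒m≤1+n j≤k , s)
    ... | inj₂ lt with all (λ x → not (closure st (suc k) h x) ∨ closure st k h x) H in eq
    ... | true = inj₁ (k , ℕₚ.n≤1+n k , stab)
      where
      stab : Stable h k
      stab m x p q with ∨-elim {not (closure st (suc k) h x)} (allF _ eq x)
      ... | inj₂ r = r
      ... | inj₁ r = ⊥-elim (t≢f (∨-inr {closure st k h x} (anyF⁺ (λ m → closure st k h m ∧ st m x) m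
          (∧-intro p q))) (not-≡f r))
    ... | false with all-false _ H eq
    ... | x , _ , e = inj₂ (ℕₚ.≤-trans (s≤s lt)
          (count-strict (closure st k h) (closure st (suc k) h) x (λ y → ∨-inl) (f e) (g e)))
      where
      f : ∀ {a b} → not a ∨ b ≡ false → b ≡ false
      f {true} p = p
      g : ∀ {a b} → not a ∨ b ≡ false → a ≡ true
      g {true} p = refl

    reach-refl : ∀ h → reach st h h ≡ true
    reach-refl h = subst (λ k → closure st k h h ≡ true) (ℕₚ.+-identityʳ n) (closure-mono n 0 (==-refl h))

    reach-snoc : ∀ {h m x} → reach st h m ≡ true → st m x ≡ true → reach st h x ≡ true
    reach-snoc {h} {m} {x} p q with grows h n
    ... | inj₂ lt = ⊥-elim (ℕₚ.<-irrefl refl (ℕₚ.<-≤-trans lt (count-≤n (closure st n h))))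
    ... | inj₁ (j , j≤n , s) =
      subst (λ k → closure st k h x ≡ true) (ℕₚ.m∸n+n≡m j≤n) (closure-mono (n ∸ j) j (s m x
        (closure-ind (λ y → closure st j h y ≡ true)
          (subst (λ k → closure st k h h ≡ true) (ℕₚ.+-identityʳ j) (closure-mono j 0 (==-refl h))) s n m p) q))

    reach-ind : ∀ {h} (X : Fin n → Set) → X h → (∀ m x → X m → st m x ≡ true → X x) →
                ∀ {x} → reach st h x ≡ true → X x
    reach-ind X xh step {x} = closure-ind X xh step n x

    reach-trans : ∀ {x y z} → reach st x y ≡ true → reach st y z ≡ true → reach st x z ≡ true
    reach-trans {x} p q = reach-ind (λ w → reach st x w ≡ true) p (λ m w → reach-snoc) q

  record IsEquiv (r : Fin n → Fin n → Bool) : Set where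
    field
      r-refl : ∀ x → r x x ≡ true
      r-sym : ∀ {x y} → r x y ≡ true → r y x ≡ true
      r-trans : ∀ {x y z} → r x y ≡ true → r y z ≡ true → r x z ≡ true

  module Classes (r : Fin n → Fin n → Bool) (eqv : IsEquiv r) where
    open IsEquiv eqv

    isRep : Fin n → Bool
    isRep h = all (λ h' → not (r h h') ∨ (toℕ h ≤ᵇ toℕ h')) H

    reps : List (Fin n)
    reps = filterᵇ isRep H

    reps-cover : ∀ x → ∃ λ m → m ∈ reps × r m x ≡ true
    reps-cover x = go (toℕ x) x ℕₚ.≤-refl
      where
      go : ∀ k x → toℕ x ≤ k → ∃ λ m → m ∈ reps × r m x ≡ true
      go k x le with isRep x in eq
      ... | true = x , ∈-filterᵇ⁺ isRep (∈-allFin x) eq , r-refl x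
      ... | false with all-false _ H eq
      ... | y , _ , e = low k le
        where
        f : ∀ {a b} → not a ∨ b ≡ false → a ≡ true × b ≡ false
        f {true} p = refl , p
        lt : toℕ y < toℕ x
        lt = ℕₚ.≰⇒> (λ q → t≢f (≤ᵇ-t q) (proj₂ (f {r x y} e)))
        low : ∀ k → toℕ x ≤ k → ∃ λ m → m ∈ reps × r m x ≡ true
        low zero le = ⊥-elim (ℕₚ.n≮0 (ℕₚ.<-≤-trans lt le))
        low (suc k) le with go k y (ℕₚ.≤-pred (ℕₚ.<-≤-trans lt le))
        ... | m , i , q = m , i , r-trans q (r-sym (proj₁ (f {r x y} e)))

    reps-indep : AllPairs (λ x y → r x y ≡ true → ⊥) reps
    reps-indep = ∈⇒AllPairs (unique-filterᵇ isRep uniqueF) λ x y i j ne e →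
      ne (Finₚ.toℕ-injective (ℕₚ.≤-antisym (le i e) (le j (r-sym e))))
      where
      le : ∀ {x y} → x ∈ reps → r x y ≡ true → toℕ x ≤ toℕ y
      le {x} {y} i e with ∨-elim {not (r x y)} (allF _ (proj₂ (∈-filterᵇ⁻ isRep {H} i)) y)
      ... | inj₁ q = ⊥-elim (t≢f e (not-≡f q))
      ... | inj₂ q = ≤ᵇ-⇒ q

    -- Covering families bound the number of classes from above, independent families from below.
    -- Component counts are obtained by exhibiting such families, without knowing the minimal
    -- representatives.
    classes-≤ : ∀ L → (∀ x → ∃ λ m → m ∈ L × r m x ≡ true) → numClasses r ≤ length L
    classes-≤ L cov = rel-pigeon (λ x y → r y x ≡ true) reps L (λ x _ → cov x)
      (AllPairs.map (λ h y p q → h (r-trans (r-sym p) q)) reps-indep)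

    classes-≥ : ∀ L → AllPairs (λ x y → r x y ≡ true → ⊥) L → length L ≤ numClasses r
    classes-≥ L ind = rel-pigeon (λ x y → r y x ≡ true) L reps (λ x _ → reps-cover x)
      (AllPairs.map (λ h y p q → h (r-trans (r-sym p) q)) ind)

  record Sub (S : Vec Bool n) : Set where
    constructor mkSub
    field inv : ∀ h → lookup S h ≡ lookup S (α h)
  open Sub public

  sub⇒ : ∀ S → isSubgraph S ≡ true → Sub S
  sub⇒ S p = mkSub (λ h → xor-same (allF _ p h))

  ⇒sub : ∀ {S} → Sub S → isSubgraph S ≡ true
  ⇒sub p = allF⁺ _ (λ h → same-xor (inv p h))

  opaque
    conn : Vec Bool n → Fin n → Fin n → Bool
    conn S = reach (ustep S)

    numComp≡ : ∀ S → numComp S ≡ numClasses (conn S)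
    numComp≡ S = refl

  module _ (S : Vec Bool n) where

    opaque
      unfolding conn

      conn-refl : ∀ x → conn S x x ≡ true
      conn-refl = reach-refl (ustep S)

      conn-trans : ∀ {x y z} → conn S x y ≡ true → conn S y z ≡ true → conn S x z ≡ true
      conn-trans = reach-trans (ustep S)

      conn-≈ : ∀ {x y z} → conn S x y ≡ true → y ≈ z → conn S x z ≡ true
      conn-≈ p q = reach-snoc (ustep S) p (∨-inl (un≈ q))

      conn-α : ∀ {x y} → conn S x y ≡ true → lookup S y ≡ true → conn S x (α y) ≡ true
      conn-α {x} {y} p q = reach-snoc (ustep S) p (∨-inr {sameV y (α y)} (∧-intro q (==-refl (α y))))

      conn-ind : ∀ {h} (X : Fin n → Set) → X h → (∀ x y → X x → x ≈ y → X y) →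
                 (∀ x → X x → lookup S x ≡ true → X (α x)) → ∀ {x} → conn S h x ≡ true → X x
      conn-ind X xh s1 s2 = reach-ind (ustep S) X xh stp
        where
        stp : ∀ m x → X m → ustep S m x ≡ true → X x
        stp m x xm e with ∨-elim {sameV m x} e
        ... | inj₁ q = s1 m x xm (mk≈ q)
        ... | inj₂ q = subst X (==⇒ (∧-snd {lookup S m} q)) (s2 m xm (∧-fst q))

    conn-sym : Sub S → ∀ {x y} → conn S x y ≡ true → conn S y x ≡ true
    conn-sym sub {x} = conn-ind (λ y → conn S y x ≡ true) (conn-refl x)
      (λ y z p q → conn-trans (conn-≈ (conn-refl z) (≈-sym q)) p)
      (λ y p q → conn-trans (subst (λ w → conn S (α y) w ≡ true) (α-invol y)
        (conn-α (conn-refl (α y)) (trans (sym (inv sub y)) q))) p)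

    conn-equiv : Sub S → IsEquiv (conn S)
    conn-equiv sub = record { r-refl = conn-refl ; r-sym = conn-sym sub ; r-trans = conn-trans }

  sameV-equiv : IsEquiv sameV
  sameV-equiv = record
    { r-refl = λ x → un≈ (≈-refl {x}) ; r-sym = λ p → un≈ (≈-sym (mk≈ p)) ; r-trans = λ p q → un≈
        (≈-trans (mk≈ p) (mk≈ q)) }

  module VC = Classes sameV sameV-equiv
  module CC (S : Vec Bool n) (sub : Sub S) where
    private module C = Classes (conn S) (conn-equiv S sub)
    open C public using (reps; reps-cover; reps-indep)

    classes-≤ : ∀ L → (∀ x → ∃ λ m → m ∈ L × conn S m x ≡ true) → numComp S ≤ length L
    classes-≤ L h = subst (_≤ length L) (sym (numComp≡ S)) (C.classes-≤ L h)

    classes-≥ : ∀ L → AllPairs (λ x y → conn S x y ≡ true → ⊥) L → length L ≤ numComp S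
    classes-≥ L h = subst (length L ≤_) (sym (numComp≡ S)) (C.classes-≥ L h)

    length-reps : length reps ≡ numComp S
    length-reps = sym (numComp≡ S)

  Connected : Vec Bool n → Set
  Connected S = ∀ x y → conn S x y ≡ true

  numComp-1⇒ : ∀ {S} → Sub S → numComp S ≤ 1 → Connected S
  numComp-1⇒ {S} sub le x y = not-f λ e → ℕₚ.<-irrefl refl
    (ℕₚ.≤-trans (CC.classes-≥ S sub (x ∷ y ∷ []) (((λ p → t≢f p e) ∷ []) ∷ [] ∷ [])) le)

  ⇒numComp-≤1 : ∀ {S} → Sub S → (∀ x → conn S h₀ x ≡ true) → numComp S ≤ 1
  ⇒numComp-≤1 {S} sub c = CC.classes-≤ S sub (h₀ ∷ []) (λ x → h₀ , here refl , c x)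

  numComp-≥1 : ∀ {S} → Sub S → 1 ≤ numComp S
  numComp-≥1 {S} sub = CC.classes-≥ S sub (h₀ ∷ []) ([] ∷ [])

  -- Selects one half-edge of every edge by label, so that the selection is the same for all
  -- spanning trees.
  canon : Fin n → Bool
  canon x = toℕ x <ᵇ toℕ (α x)

  canon-or : ∀ x → canon x ≡ true ⊎ canon (α x) ≡ true
  canon-or x with ℕₚ.<-cmp (toℕ x) (toℕ (α x))
  ... | tri< a _ _ = inj₁ (<ᵇ-t a)
  ... | tri≈ _ b _ = ⊥-elim (α≢ (Finₚ.toℕ-injective b))
  ... | tri> _ _ c = inj₂ (<ᵇ-t (subst (λ z → toℕ (α x) < toℕ z) (sym (α-invol x)) c))

  canon-not : ∀ x → canon x ≡ true → canon (α x) ≡ false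
  canon-not x p = <ᵇ-f (subst (λ z → toℕ z ≤ toℕ (α x)) (sym (α-invol x)) (ℕₚ.<⇒≤ (<ᵇ-⇒ p)))

  count-edge : ∀ e → count (λ x → sameEdge x e ∧ canon x) H ≡ 1
  count-edge e with canon-or e
  ... | inj₁ c = count-single e _ (∧-intro (sameEdge-refl e) c) λ x p → f x (∧-snd {sameEdge x e} p)
      (sameEdge⇒ {x} {e} (∧-fst p))
    where
    f : ∀ x → canon x ≡ true → x ≡ e ⊎ x ≡ α e → x ≡ e
    f x q (inj₁ r) = r
    f x q (inj₂ refl) = ⊥-elim (t≢f q (canon-not e c))
  ... | inj₂ c = count-single (α e) _ (∧-intro (sameEdge-α e) c) λ x p → f x (∧-snd {sameEdge x e} p)
      (sameEdge⇒ {x} {e} (∧-fst p))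
    where
    f : ∀ x → canon x ≡ true → x ≡ e ⊎ x ≡ α e → x ≡ α e
    f x q (inj₂ r) = r
    f x q (inj₁ refl) = ⊥-elim (t≢f (subst (λ z → canon z ≡ true) (sym (α-invol x)) q) (canon-not (α x) c))

  numE-diff : ∀ {S S'} e → (∀ x → sameEdge x e ≡ true → lookup S x ≡ true × lookup S' x ≡ false) →
              (∀ x → sameEdge x e ≡ false → lookup S x ≡ lookup S' x) → numE S ≡ suc (numE S')
  numE-diff {S} {S'} e h1 h2 = trans (sym (ℕₚ.+-identityʳ (numE S)))
    (trans (cong (λ k → numE S + k) (sym (count-none (λ _ → false) H (λ _ _ → refl))))
    (trans (count-balance _ (λ _ → false) (λ x → lookup S' x ∧ canon x) (λ x → sameEdge x e ∧ canon x) H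
        (λ x _ → pt x))
    (trans (cong (λ k → numE S' + k) (count-edge e)) (ℕₚ.+-comm (numE S') 1))))
    where
    pt : ∀ x → 𝟙 (lookup S x ∧ canon x) + 0 ≡ 𝟙 (lookup S' x ∧ canon x) + 𝟙 (sameEdge x e ∧ canon x)
    pt x with sameEdge x e in se
    ... | true rewrite proj₁ (h1 x se) | proj₂ (h1 x se) = ℕₚ.+-identityʳ _
    ... | false rewrite h2 x se = refl

  del : Vec Bool n → Fin n → Vec Bool n
  del S e = tabulate λ x → lookup S x ∧ not (sameEdge x e)

  add : Vec Bool n → Fin n → Vec Bool n
  add S e = tabulate λ x → lookup S x ∨ sameEdge x e

  sameEdge-inv : ∀ x e → sameEdge x e ≡ sameEdge (α x) e
  sameEdge-inv x e = bool-ext f g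
    where
    f : sameEdge x e ≡ true → sameEdge (α x) e ≡ true
    f p with sameEdge⇒ {x} {e} p
    ... | inj₁ refl = sameEdge-α x
    ... | inj₂ refl = subst (λ z → sameEdge z e ≡ true) (sym (α-invol e)) (sameEdge-refl e)
    g : sameEdge (α x) e ≡ true → sameEdge x e ≡ true
    g p with sameEdge⇒ {α x} {e} p
    ... | inj₁ refl = subst (λ z → sameEdge z (α x) ≡ true) (α-invol x) (sameEdge-α (α x))
    ... | inj₂ q rewrite α-inj q = sameEdge-refl e

  sameEdge-inv₂ : ∀ x e → sameEdge x (α e) ≡ sameEdge x e
  sameEdge-inv₂ x e rewrite α-invol e = 𝔹ₚ.∨-comm (x == α e) (x == e)

  del-sub : ∀ {S} e → Sub S → Sub (del S e)
  del-sub {S} e sub .inv x rewrite lookup∘tabulate (λ x → lookup S x ∧ not (sameEdge x e)) x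
    | lookup∘tabulate (λ x → lookup S x ∧ not (sameEdge x e)) (α x) | inv sub x | sameEdge-inv x e = refl

  add-sub : ∀ {S} e → Sub S → Sub (add S e)
  add-sub {S} e sub .inv x rewrite lookup∘tabulate (λ x → lookup S x ∨ sameEdge x e) x
    | lookup∘tabulate (λ x → lookup S x ∨ sameEdge x e) (α x) | inv sub x | sameEdge-inv x e = refl

  numE-del : ∀ {S} e → Sub S → lookup S e ≡ true → numE S ≡ suc (numE (del S e))
  numE-del {S} e sub p = numE-diff {S} {del S e} e h1 h2
    where
    h1 : ∀ x → sameEdge x e ≡ true → lookup S x ≡ true × lookup (del S e) x ≡ false
    h1 x se rewrite lookup∘tabulate (λ x → lookup S x ∧ not (sameEdge x e)) x | se | 𝔹ₚ.∧-zeroʳ (lookup S x) with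
        sameEdge⇒ {x} {e} se
    ... | inj₁ refl = p , refl
    ... | inj₂ refl = trans (sym (inv sub e)) p , refl
    h2 : ∀ x → sameEdge x e ≡ false → lookup S x ≡ lookup (del S e) x
    h2 x se rewrite lookup∘tabulate (λ x → lookup S x ∧ not (sameEdge x e)) x | se = sym (𝔹ₚ.∧-identityʳ (lookup S x))

  numE-add : ∀ {S} e → Sub S → lookup S e ≡ false → numE (add S e) ≡ suc (numE S)
  numE-add {S} e sub p = numE-diff {add S e} {S} e h1 h2
    where
    h1 : ∀ x → sameEdge x e ≡ true → lookup (add S e) x ≡ true × lookup S x ≡ false
    h1 x se rewrite lookup∘tabulate (λ x → lookup S x ∨ sameEdge x e) x | se | 𝔹ₚ.∨-zeroʳ (lookup S x) with
        sameEdge⇒ {x} {e} se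
    ... | inj₁ refl = refl , p
    ... | inj₂ refl = refl , trans (sym (inv sub e)) p
    h2 : ∀ x → sameEdge x e ≡ false → lookup (add S e) x ≡ lookup S x
    h2 x se rewrite lookup∘tabulate (λ x → lookup S x ∨ sameEdge x e) x | se = 𝔹ₚ.∨-identityʳ (lookup S x)

  lookup-del⁻ : ∀ {S e x} → lookup (del S e) x ≡ true → lookup S x ≡ true × x ≢ e × x ≢ α e
  lookup-del⁻ {S} {e} {x} p rewrite lookup∘tabulate (λ x → lookup S x ∧ not (sameEdge x e)) x =
    ∧-fst p , (λ { refl → t≢f (sameEdge-refl e) (not-≡f (∧-snd {lookup S x} p)) })
            , (λ { refl → t≢f (sameEdge-α e) (not-≡f (∧-snd {lookup S x} p)) })

  lookup-del⁺ : ∀ {S e x} → lookup S x ≡ true → x ≢ e → x ≢ α e → lookup (del S e) x ≡ true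
  lookup-del⁺ {S} {e} {x} p q r rewrite lookup∘tabulate (λ x → lookup S x ∧ not (sameEdge x e)) x =
    ∧-intro p (not-≡t (sameEdge-no q r))

  lookup-del-same : ∀ {S e x} → x ≢ e → x ≢ α e → lookup (del S e) x ≡ lookup S x
  lookup-del-same {S} {e} {x} q r rewrite lookup∘tabulate (λ x → lookup S x ∧ not (sameEdge x e)) x
    | sameEdge-no q r = 𝔹ₚ.∧-identityʳ _

  module OneEdge (S S' : Vec Bool n) (e : Fin n)
    (split : ∀ z → lookup S z ≡ true → lookup S' z ≡ true ⊎ (z ≡ e ⊎ z ≡ α e)) where

    ToEnd : Fin n → Set
    ToEnd y = conn S' e y ≡ true ⊎ conn S' (α e) y ≡ true

    toEnd-≈ : ∀ {y z} → ToEnd y → y ≈ z → ToEnd z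
    toEnd-≈ (inj₁ p) q = inj₁ (conn-≈ S' p q)
    toEnd-≈ (inj₂ p) q = inj₂ (conn-≈ S' p q)

    toEnd-α : ∀ {y} → ToEnd y → lookup S' y ≡ true → ToEnd (α y)
    toEnd-α (inj₁ p) q = inj₁ (conn-α S' p q)
    toEnd-α (inj₂ p) q = inj₂ (conn-α S' p q)

    -- A path of `S` either never uses `e`, or its portions before the first and after the last use
    -- of `e` are paths of `S'` that meet an end of `e`.
    conn-split : Sub S' → ∀ {x y} → conn S x y ≡ true → conn S' x y ≡ true ⊎ (ToEnd x × ToEnd y)
    conn-split sub {x} = conn-ind S (λ y → conn S' x y ≡ true ⊎ (ToEnd x × ToEnd y)) (inj₁ (conn-refl S' x)) s1 s2
      where
      s1 : ∀ y z → conn S' x y ≡ true ⊎ (ToEnd x × ToEnd y) → y ≈ z → conn S' x z ≡ true ⊎ (ToEnd x × ToEnd z)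
      s1 y z (inj₁ p) q = inj₁ (conn-≈ S' p q)
      s1 y z (inj₂ (p , r)) q = inj₂ (p , toEnd-≈ r q)
      s2 : ∀ y → conn S' x y ≡ true ⊎ (ToEnd x × ToEnd y) → lookup S y ≡ true → conn S' x (α y) ≡ true ⊎
          (ToEnd x × ToEnd (α y))
      s2 y c q with split y q
      s2 y (inj₁ p) q | inj₁ r = inj₁ (conn-α S' p r)
      s2 y (inj₂ (p , t)) q | inj₁ r = inj₂ (p , toEnd-α t r)
      s2 y (inj₁ p) q | inj₂ (inj₁ refl) = inj₂ (inj₁ (conn-sym S' sub p) , inj₂ (conn-refl S' (α y)))
      s2 y (inj₂ (p , _)) q | inj₂ (inj₁ refl) = inj₂ (p , inj₂ (conn-refl S' (α y)))
      s2 y (inj₁ p) q | inj₂ (inj₂ refl) = inj₂ (inj₂ (conn-sym S' sub p) , inj₁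
          (subst (λ z → conn S' e z ≡ true) (sym (α-invol e)) (conn-refl S' e)))
      s2 y (inj₂ (p , _)) q | inj₂ (inj₂ refl) = inj₂ (p , inj₁
          (subst (λ z → conn S' e z ≡ true) (sym (α-invol e)) (conn-refl S' e)))

    -- Only the class of `e` can break up, into the classes of its two ends. The representative `m₀`
    -- of that class accounts for one end, so adjoining the other end to the representatives of `S`
    -- gives a cover for `S'`.
    numComp-split : Sub S → Sub S' → numComp S' ≤ suc (numComp S)
    numComp-split sub sub' with CC.reps-cover S sub e
    ... | m₀ , m₀∈ , cm₀ with end
      where
      end : ToEnd m₀
      end with conn-split sub' cm₀
      ... | inj₁ p = inj₁ (conn-sym S' sub' p)
      ... | inj₂ (p , _) = p
    ... | inj₁ em₀ = subst (numComp S' ≤_) (cong suc (CC.length-reps S sub))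
        (CC.classes-≤ S' sub' (α e ∷ CC.reps S sub) cov)
      where
      cov : ∀ x → ∃ λ m → m ∈ (α e ∷ CC.reps S sub) × conn S' m x ≡ true
      cov x with CC.reps-cover S sub x
      ... | m , m∈ , cm with conn-split sub' cm
      ... | inj₁ p = m , there m∈ , p
      ... | inj₂ (_ , inj₁ p) = m₀ , there m₀∈ , conn-trans S' (conn-sym S' sub' em₀) p
      ... | inj₂ (_ , inj₂ p) = α e , here refl , p
    ... | inj₂ em₀ = subst (numComp S' ≤_) (cong suc (CC.length-reps S sub))
        (CC.classes-≤ S' sub' (e ∷ CC.reps S sub) cov)
      where
      cov : ∀ x → ∃ λ m → m ∈ (e ∷ CC.reps S sub) × conn S' m x ≡ true
      cov x with CC.reps-cover S sub x
      ... | m , m∈ , cm with conn-split sub' cm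
      ... | inj₁ p = m , there m∈ , p
      ... | inj₂ (_ , inj₁ p) = e , here refl , p
      ... | inj₂ (_ , inj₂ p) = m₀ , there m₀∈ , conn-trans S' (conn-sym S' sub' em₀) p

  conn-mono : ∀ {S' S} → (∀ z → lookup S' z ≡ true → lookup S z ≡ true) → ∀ {x y} → conn S' x y ≡ true → conn S x
      y ≡ true
  conn-mono {S'} {S} inc {x} = conn-ind S' (λ y → conn S x y ≡ true) (conn-refl S x)
    (λ y z → conn-≈ S) (λ y p q → conn-α S p (inc y q))

  split-del : ∀ S e z → lookup S z ≡ true → lookup (del S e) z ≡ true ⊎ (z ≡ e ⊎ z ≡ α e)
  split-del S e z p with z Finₚ.≟ e | z Finₚ.≟ α e
  ... | yes q | _ = inj₂ (inj₁ q)
  ... | no _ | yes q = inj₂ (inj₂ q)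
  ... | no q | no r = inj₁ (lookup-del⁺ {S} {e} p q r)

  numE-0 : ∀ {S} → Sub S → numE S ≡ 0 → ∀ x → lookup S x ≡ false
  numE-0 {S} sub e x = not-t none
    where
    none : lookup S x ≡ true → ⊥
    none p with canon-or x
    ... | inj₁ c = t≢f (∧-intro p c) (count-0 _ e (∈-allFin x))
    ... | inj₂ c = t≢f (∧-intro (trans (sym (inv sub x)) p) c) (count-0 _ e (∈-allFin (α x)))

  numE-suc : ∀ {S k} → numE S ≡ suc k → ∃ λ x → lookup S x ≡ true
  numE-suc {S} {k} e with any (lookup S) H in eq
  ... | true = anyF (lookup S) eq
  ... | false = ⊥-elim (ℕₚ.0≢1+n (trans (sym (count-none _ H (λ x _ → f x))) e))
    where
    f : ∀ x → lookup S x ∧ canon x ≡ false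
    f x = not-t (λ p → t≢f (anyF⁺ (lookup S) x (∧-fst p)) eq)

  -- Without edges the components are the vertices, and deleting an edge creates at most one further
  -- component.
  numV-≤ : ∀ S → Sub S → numV ≤ numE S + numComp S
  numV-≤ S sub = go (numE S) S sub refl
    where
    go : ∀ k S → Sub S → numE S ≡ k → numV ≤ k + numComp S
    go zero S sub e = CC.classes-≥ S sub VC.reps (AllPairs.map (λ h c → h (un≈ (toV c))) VC.reps-indep)
      where
      toV : ∀ {x y} → conn S x y ≡ true → x ≈ y
      toV {x} = conn-ind S (x ≈_) ≈-refl (λ _ _ → ≈-trans) (λ y p q → ⊥-elim (t≢f q (numE-0 sub e y)))
    go (suc k) S sub e with numE-suc {S} e
    ... | x , px = ℕₚ.≤-trans (go k (del S x) (del-sub x sub) (ℕₚ.suc-injective (trans (sym (numE-del x sub px)) e)))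
          (subst (k + numComp (del S x) ≤_) (ℕₚ.+-suc k (numComp S))
            (ℕₚ.+-monoʳ-≤ k (OneEdge.numComp-split S (del S x) x (split-del S x) sub (del-sub x sub))))

  -- Spanning trees.

  NoCycle : Vec Bool n → Set
  NoCycle S = ∀ b → lookup S b ≡ true → conn (del S b) b (α b) ≡ true → ⊥

  record Tree (T : Vec Bool n) : Set where
    constructor mkTr
    field
      tree-sub : Sub T
      tree-comp : numComp T ≡ 1
      tree-size : numE T + 1 ≡ numV
  open Tree public

  tree⇒ : ∀ T → isSpanningTree T ≡ true → Tree T
  tree⇒ T p = mkTr (sub⇒ T (∧-fst p)) (≡ᵇ-⇒ (∧-fst (∧-snd {isSubgraph T} p)))
    (≡ᵇ-⇒ (∧-snd {numComp T ≡ᵇ 1} (∧-snd {isSubgraph T} p)))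

  ⇒tree : ∀ {T} → Tree T → isSpanningTree T ≡ true
  ⇒tree t = ∧-intro (⇒sub (tree-sub t)) (∧-intro (≡ᵇ-t (tree-comp t)) (≡ᵇ-t (tree-size t)))

  tree-conn : ∀ {T} → Tree T → Connected T
  tree-conn p = numComp-1⇒ (tree-sub p) (ℕₚ.≤-reflexive (tree-comp p))

  mkTree : ∀ {T} → Sub T → (∀ x → conn T h₀ x ≡ true) → numE T + 1 ≡ numV → Tree T
  mkTree sub c e = mkTr sub (ℕₚ.≤-antisym (⇒numComp-≤1 sub c) (numComp-≥1 sub)) e

  -- If the ends of `b` stayed joined, `T` without `b` would still be connected but have too few
  -- edges for `numV-≤`.
  tree-noCycle : ∀ {T} → Tree T → NoCycle T
  tree-noCycle {T} tree b pb c = ℕₚ.<-irrefl refl (begin-strict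
      numV                                   ≤⟨ numV-≤ (del T b) sub' ⟩
      numE (del T b) + numComp (del T b)     ≤⟨ ℕₚ.+-monoʳ-≤ (numE (del T b)) (⇒numComp-≤1 sub' all') ⟩
      numE (del T b) + 1                     ≡⟨ ℕₚ.+-comm _ 1 ⟩
      suc (numE (del T b))                   ≡⟨ numE-del b sub pb ⟨
      numE T                                 <⟨ ℕₚ.≤-reflexive (ℕₚ.+-comm 1 _) ⟩
      numE T + 1                             ≡⟨ tree-size tree ⟩
      numV                                   ∎)
    where
    open ℕₚ.≤-Reasoning
    sub : Sub T
    sub = tree-sub tree
    sub' : Sub (del T b)
    sub' = del-sub b sub
    module E = OneEdge T (del T b) b (split-del T b)
    fromB : ∀ {y} → E.ToEnd y → conn (del T b) b y ≡ true
    fromB (inj₁ p) = p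
    fromB (inj₂ p) = conn-trans (del T b) c p
    all' : ∀ x → conn (del T b) h₀ x ≡ true
    all' x with E.conn-split sub' (tree-conn tree h₀ x)
    ... | inj₁ p = p
    ... | inj₂ (p , q) = conn-trans (del T b) (conn-sym (del T b) sub' (fromB p)) (fromB q)

  empty : Vec Bool n
  empty = tabulate (λ _ → false)

  lookup-empty : ∀ x → lookup empty x ≡ false
  lookup-empty x = lookup∘tabulate (λ _ → false) x

  -- Transitivity of the group generated by σ and α enters here: a union of vertices left by no edge
  -- is empty or everything.
  crossing-edge : ∀ (X : Fin n → Bool) → (∀ x y → X x ≡ true → x ≈ y → X y ≡ true) → ∀ {x y} → X x ≡ true → X y ≡
      false →
                  ∃ λ g → X g ≡ true × X (α g) ≡ false
  crossing-edge X cl {x} {y} px py with any (λ g → X g ∧ not (X (α g))) H in eq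
  ... | true with anyF _ eq
  ... | g , p = g , ∧-fst p , not-≡f (∧-snd {X g} p)
  crossing-edge X cl {x} {y} px py | false = ⊥-elim (t≢f (go (transitive x y) px) py)
    where
    αcl : ∀ z → X z ≡ true → X (α z) ≡ true
    αcl z p = not-f (λ q → t≢f (anyF⁺ (λ g → X g ∧ not (X (α g))) z (∧-intro p (not-≡t q))) eq)
    go : ∀ {x y} → Star (MapStep σ α) x y → X x ≡ true → X y ≡ true
    go ε p = p
    go (byσ ◅ r) p = go r (cl _ _ p (≈σ _))
    go (byσ⁻ ◅ r) p = go r (cl _ _ p (≈σ⁻ _))
    go (byα ◅ r) p = go r (αcl _ p)

  -- A forest is grown from the empty edge set by edges leaving the component of the root, keeping
  -- `numE F + numComp F ≡ numV`. The resulting tree is the starting point of the exchanges that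
  -- place a subgraph in an interval.
  spanning-tree : ∃ λ T → Tree T
  spanning-tree = go (numComp empty ∸ 1) empty sub∅ (sym (ℕₚ.m+[n∸m]≡n (numComp-≥1 sub∅))) size∅
    where
    sub∅ : Sub empty
    sub∅ .inv x = trans (lookup-empty x) (sym (lookup-empty (α x)))
    numE∅ : numE empty ≡ 0
    numE∅ = count-none _ H (λ x _ → cong (_∧ canon x) (lookup-empty x))
    size∅ : numE empty + numComp empty ≡ numV
    size∅ = trans (cong (_+ numComp empty) numE∅) (ℕₚ.≤-antisym
      (CC.classes-≤ empty sub∅ VC.reps (λ x → let m , i , p = VC.reps-cover x in m , i , conn-≈ empty (conn-refl empty m) (mk≈ p)))
      (subst (λ z → numV ≤ z + numComp empty) numE∅ (numV-≤ empty sub∅)))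
    go : ∀ k F → Sub F → numComp F ≡ suc k → numE F + numComp F ≡ numV → ∃ λ T → Tree T
    go zero F sub e s = F , mkTree sub (λ x → numComp-1⇒ sub (ℕₚ.≤-reflexive e) h₀ x)
        (trans (cong (λ k → numE F + k) (sym e)) s)
    go (suc k) F sub e s with all (conn F h₀) H in eq
    ... | true = ⊥-elim (ℕₚ.<-irrefl refl (ℕₚ.≤-trans (s≤s (s≤s z≤n)) (subst (_≤ 1) e (⇒numComp-≤1 sub (allF _ eq)))))
    ... | false with all-false _ H eq
    ... | x₀ , _ , nx with crossing-edge (conn F h₀) (λ x y → conn-≈ F) (conn-refl F h₀) nx
    ... | g , cg , ncg = go k F+ sub+ comp+ size+
      where
      F+ : Vec Bool n
      F+ = add F g
      sub+ : Sub F+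
      sub+ = add-sub g sub
      g∉ : lookup F g ≡ false
      g∉ = not-t (λ p → t≢f (conn-α F cg p) ncg)
      spl : ∀ z → lookup F+ z ≡ true → lookup F z ≡ true ⊎ (z ≡ g ⊎ z ≡ α g)
      spl z p with ∨-elim {lookup F z} (trans (sym (lookup∘tabulate (λ x → lookup F x ∨ sameEdge x g) z)) p)
      ... | inj₁ q = inj₁ q
      ... | inj₂ q = inj₂ (sameEdge⇒ {z} {g} q)
      inc : ∀ z → lookup F z ≡ true → lookup F+ z ≡ true
      inc z p = trans (lookup∘tabulate (λ x → lookup F x ∨ sameEdge x g) z) (∨-inl p)
      g∈ : lookup F+ g ≡ true
      g∈ = trans (lookup∘tabulate (λ x → lookup F x ∨ sameEdge x g) g) (∨-inr {lookup F g} (sameEdge-refl g))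
      g≁ : conn F g (α g) ≡ true → ⊥
      g≁ p = t≢f (conn-trans F cg p) ncg
      module E = OneEdge F+ F g spl
      merges : ∀ {x y} → E.ToEnd x → E.ToEnd y → conn F+ x y ≡ true
      merges p q = conn-trans F+ (conn-sym F+ sub+ (toG p)) (toG q)
        where
        toG : ∀ {y} → E.ToEnd y → conn F+ g y ≡ true
        toG (inj₁ p) = conn-mono {F} {F+} inc p
        toG (inj₂ p) = conn-trans F+ (conn-α F+ (conn-refl F+ g) g∈) (conn-mono {F} {F+} inc p)
      -- the end of g not joined in F to the representative of g becomes an additional class of F
      fewer : suc (numComp F+) ≤ numComp F
      fewer with CC.reps-cover F+ sub+ g
      ... | m₀ , m₀∈ , cm₀ with end
        where
        end : E.ToEnd m₀
        end with E.conn-split sub cm₀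
        ... | inj₁ p = inj₁ (conn-sym F sub p)
        ... | inj₂ (p , _) = p
      ... | d = subst (_≤ numComp F) (cong suc (CC.length-reps F+ sub+)) (CC.classes-≥ F sub (far d ∷ CC.reps F+ sub+)
                (All.tabulate (λ {y} i c → far-sep d y i c) ∷ AllPairs.map (λ h c → h (conn-mono {F} {F+} inc c))
                    (CC.reps-indep F+ sub+)))
        where
        far : E.ToEnd m₀ → Fin n
        far (inj₁ _) = α g
        far (inj₂ _) = g
        farEnd : ∀ d → E.ToEnd (far d)
        farEnd (inj₁ _) = inj₂ (conn-refl F (α g))
        farEnd (inj₂ _) = inj₁ (conn-refl F g)
        far≁m₀ : ∀ d → conn F (far d) m₀ ≡ true → ⊥
        far≁m₀ (inj₁ p) c = g≁ (conn-trans F p (conn-sym F sub c))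
        far≁m₀ (inj₂ p) c = g≁ (conn-trans F c (conn-sym F sub p))
        indep : ∀ {xs : List (Fin n)} {x y} → AllPairs (λ x y → conn F+ x y ≡ true → ⊥) xs → x ∈ xs → y ∈ xs →
            conn F+ x y ≡ true → x ≡ y
        indep (a ∷ as) (here refl) (here refl) c = refl
        indep (a ∷ as) (here refl) (there j) c = ⊥-elim (All.lookup a j c)
        indep (a ∷ as) (there i) (here refl) c = ⊥-elim (All.lookup a i (conn-sym F+ sub+ c))
        indep (a ∷ as) (there i) (there j) c = indep as i j c
        far-sep : ∀ d y → y ∈ CC.reps F+ sub+ → conn F (far d) y ≡ true → ⊥
        far-sep d y i c with indep (CC.reps-indep F+ sub+) m₀∈ i
            (conn-trans F+ (merges d (farEnd d)) (conn-mono {F} {F+} inc c))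
        ... | refl = far≁m₀ d c
      -- The invariant is restored by squeezing: `numV-≤` gives one inequality and `fewer` the
      -- other, and the exact number of components follows.
      size≥ : numV ≤ suc (numE F) + numComp F+
      size≥ = subst (λ z → numV ≤ z + numComp F+) (numE-add g sub g∉) (numV-≤ F+ sub+)
      size≤ : suc (numE F) + numComp F+ ≤ numV
      size≤ = subst (suc (numE F) + numComp F+ ≤_) s (subst (_≤ numE F + numComp F)
          (ℕₚ.+-suc (numE F) (numComp F+)) (ℕₚ.+-monoʳ-≤ (numE F) fewer))
      size+ : numE F+ + numComp F+ ≡ numV
      size+ = trans (cong (_+ numComp F+) (numE-add g sub g∉)) (ℕₚ.≤-antisym size≤ size≥)
      comp+ : numComp F+ ≡ suc k
      comp+ = ℕₚ.suc-injective (ℕₚ.+-cancelˡ-≡ (numE F) _ _ (trans (ℕₚ.+-suc (numE F) _)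
          (trans (ℕₚ.≤-antisym size≤ size≥) (trans (sym s) (cong (λ k → numE F + k) e)))))

  -- The motion function and its cycles.

  motion-in : ∀ {S x} → lookup S x ≡ true → motion S x ≡ σf (α x)
  motion-in {S} {x} p rewrite p = refl

  motion-out : ∀ {S x} → lookup S x ≡ false → motion S x ≡ σf x
  motion-out {S} {x} p rewrite p = refl

  motion-cong : ∀ {S S' x} → lookup S x ≡ lookup S' x → motion S x ≡ motion S' x
  motion-cong {S} {S'} {x} p rewrite p = refl

  motion-inj : ∀ {S} → Sub S → ∀ x y → motion S x ≡ motion S y → x ≡ y
  motion-inj {S} sub x y e with lookup S x in px | lookup S y in py
  ... | true | true = α-inj (σ-inj _ _ e)
  ... | false | false = σ-inj _ _ e
  ... | true | false = ⊥-elim (t≢f (trans (sym (inv sub x)) px) (trans (cong (lookup S) (σ-inj _ _ e)) py))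
  ... | false | true = ⊥-elim (t≢f (trans (sym (inv sub y)) py) (trans (cong (lookup S) (sym (σ-inj _ _ e))) px))

  module MO {S : Vec Bool n} (sub : Sub S) = Orbit (motion S) (motion-inj sub)

  conn-motion : ∀ {S} x → conn S x (motion S x) ≡ true
  conn-motion {S} x with lookup S x in px
  ... | true = conn-≈ S (conn-α S (conn-refl S x) px) (≈σ (α x))
  ... | false = conn-≈ S (conn-refl S x) (≈σ x)

  conn-iter : ∀ {S} k x → conn S x (iter (motion S) k x) ≡ true
  conn-iter {S} zero x = conn-refl S x
  conn-iter {S} (suc k) x = conn-trans S (conn-iter {S} k x) (conn-motion {S} (iter (motion S) k x))

  -- The motion of S is that of S - b composed with the transposition (b αb).
  -- If b and αb lie in different cycles, these are merged.
  module Merge {S : Vec Bool n} (sub : Sub S) (b : Fin n) (pb : lookup S b ≡ true)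
    (nc : conn (del S b) b (α b) ≡ true → ⊥)
    (ih : ∀ {x y} → conn (del S b) x y ≡ true → MO.Orb (del-sub b sub) x y) where

    S' : Vec Bool n
    S' = del S b
    sub' : Sub S'
    sub' = del-sub b sub
    module O = MO sub
    module O' = MO sub'

    Orb'⇒conn : ∀ {x y} → O'.Orb x y → conn S' x y ≡ true
    Orb'⇒conn {x} (k , refl) = conn-iter {S'} k x

    off : ∀ y → y ≢ b → y ≢ α b → motion S' y ≡ motion S y
    off y p q = motion-cong {S'} {S} (lookup-del-same {S} p q)

    b∉ : lookup S' b ≡ false
    b∉ = not-t (λ p → proj₁ (proj₂ (lookup-del⁻ {S} {b} p)) refl)

    αb∉ : lookup S' (α b) ≡ false
    αb∉ = trans (sym (inv sub' b)) b∉

    -- From `α c` the motion of `S` enters the old cycle of `c` and then follows it, since the two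
    -- motions differ only at `c` and `α c` and the old cycle avoids `α c`. It is stated for a
    -- general `c` to cover both `b` and `α b`.
    absorb : ∀ c → motion S (α c) ≡ motion S' c → (∀ y → y ≢ c → y ≢ α c → motion S' y ≡ motion S y) →
             (conn S' c (α c) ≡ true → ⊥) → ∀ {y} → O'.Orb c y → O.Orb (α c) y
    -- The half-edge `c` itself is met only after a full turn of its old cycle.
    absorb c e1 offc ncc = λ { (zero , refl) → let m , _ , e = O'.period c in subst (O.Orb (α c)) e (go m) ; (suc k , refl) → go k }
      where
      go : ∀ k → O.Orb (α c) (iter (motion S') (suc k) c)
      go zero = 1 , e1
      go (suc k) with iter (motion S') (suc k) c Finₚ.≟ c | iter (motion S') (suc k) c Finₚ.≟ α c
      ... | yes q | _ = 1 , trans e1 (cong (motion S') (sym q))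
      ... | no _ | yes r = ⊥-elim (ncc (Orb'⇒conn (suc k , r)))
      ... | no q | no r = O.Orb-trans (go k) (1 , sym (offc _ q r))

    absorb-b : ∀ {y} → O'.Orb b y → O.Orb (α b) y
    absorb-b = absorb b (trans (motion-in {S} (trans (sym (inv sub b)) pb))
        (trans (cong σf (α-invol b)) (sym (motion-out {S'} b∉)))) off nc

    absorb-αb : ∀ {y} → O'.Orb (α b) y → O.Orb b y
    absorb-αb {y} o = subst (λ z → O.Orb z y) (α-invol b) (absorb (α b)
      (trans (cong (motion S) (α-invol b)) (trans (motion-in {S} pb) (sym (motion-out {S'} αb∉))))
      (λ y p q → off y (λ e → q (trans e (sym (α-invol b)))) p)
      (λ c → nc (conn-sym S' sub' (subst (λ z → conn S' (α b) z ≡ true) (α-invol b) c))) o)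

    conn'⇒Orb : ∀ {y z} → conn S' y z ≡ true → O.Orb y z
    conn'⇒Orb {y} {z} c with tf-dec (conn S' b y) | tf-dec (conn S' (α b) y)
    ... | inj₁ p | _ = O.Orb-trans (O.Orb-sym (absorb-b (ih p))) (absorb-b (ih (conn-trans S' p c)))
    ... | inj₂ _ | inj₁ p = O.Orb-trans (O.Orb-sym (absorb-αb (ih p))) (absorb-αb (ih (conn-trans S' p c)))
    -- A cycle that contains neither `b` nor `α b` is unchanged.
    ... | inj₂ p | inj₂ q = let k , e = ih c in k , trans (go k) e
      where
      go : ∀ k → iter (motion S) k y ≡ iter (motion S') k y
      go zero = refl
      go (suc k) rewrite go k = sym (off _
        (λ e → t≢f (conn-sym S' sub' (subst (λ w → conn S' y w ≡ true) e (conn-iter {S'} k y))) p)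
        (λ e → t≢f (conn-sym S' sub' (subst (λ w → conn S' y w ≡ true) e (conn-iter {S'} k y))) q))

    conn⇒Orb : ∀ {x y} → conn S x y ≡ true → O.Orb x y
    conn⇒Orb {x} = conn-ind S (O.Orb x) (0 , refl)
      (λ y z o v → O.Orb-trans o (conn'⇒Orb (conn-≈ S' (conn-refl S' y) v))) s2
      where
      bα : O.Orb b (α b)
      bα = O.Orb-sym (absorb-b (0 , refl))
      s2 : ∀ y → O.Orb x y → lookup S y ≡ true → O.Orb x (α y)
      s2 y o p with split-del S b y p
      ... | inj₁ q = O.Orb-trans o (conn'⇒Orb (conn-α S' (conn-refl S' y) q))
      ... | inj₂ (inj₁ refl) = O.Orb-trans o bα
      ... | inj₂ (inj₂ refl) = O.Orb-trans o (subst (O.Orb (α b)) (sym (α-invol b)) (O.Orb-sym bα))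

  -- By induction on the number of edges: without edges the motion is σ, whose cycles are the
  -- vertices, and each added edge merges two cycles. For a spanning tree the motion is then a
  -- single cycle; for a tree without one edge its cycles are the two sides of the cut.
  conn⇒Orb : ∀ {S} (sub : Sub S) → NoCycle S → ∀ {x y} → conn S x y ≡ true → MO.Orb sub x y
  conn⇒Orb {S} sub nc = go (numE S) S sub nc refl
    where
    go : ∀ k S (sub : Sub S) → NoCycle S → numE S ≡ k → ∀ {x y} → conn S x y ≡ true → MO.Orb sub x y
    go zero S sub nc e {x} = conn-ind S (MO.Orb sub x) (0 , refl)
      (λ y z o v → MO.Orb-trans sub o (let k , q = ≈⇒Orb v in
         k , trans (iter-cong (motion S) σf (λ w → motion-out {S} (numE-0 sub e w)) k y) q))
      (λ y o p → ⊥-elim (t≢f p (numE-0 sub e y)))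
    go (suc k) S sub nc e with numE-suc {S} e
    ... | b , pb = Merge.conn⇒Orb sub b pb (nc b pb)
          (go k (del S b) (del-sub b sub) nc' (ℕₚ.suc-injective (trans (sym (numE-del b sub pb)) e)))
      where
      nc' : NoCycle (del S b)
      nc' c pc q = nc c (proj₁ (lookup-del⁻ {S} {b} pc)) (conn-mono {del (del S b) c} {del S c} (λ z r →
        let r1 , r2 , r3 = lookup-del⁻ {del S b} {c} r in lookup-del⁺ {S} {c} (proj₁ (lookup-del⁻ {S} {b} r1)) r2 r3) q)

  -- The tour of a spanning tree.

  module Tour (T : Vec Bool n) (tree : Tree T) where

    sub : Sub T
    sub = tree-sub tree

    t : Fin n → Fin n
    t = motion T

    module O = MO sub

    opaque
      P : Fin n → ℕ
      P = pos T

      P≡pos : ∀ x → P x ≡ pos T x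
      P≡pos x = refl

    -- The tour visits every half-edge, so all of them are met before the first return to `h₀`.
    period-≥n : ∀ m → iter t (suc m) h₀ ≡ h₀ → n ≤ suc m
    period-≥n m e = Finₚ.injective⇒≤ {f = f} f-inj
      where
      small : ∀ k → ∃ λ j → j ≤ m × iter t j h₀ ≡ iter t k h₀
      small zero = 0 , z≤n , refl
      small (suc k) with small k
      ... | j , j≤m , q with ℕₚ.m≤n⇒m<n∨m≡n j≤m
      ... | inj₁ j<m = suc j , j<m , cong t q
      ... | inj₂ refl = 0 , z≤n , trans (sym e) (cong t q)
      rep : ∀ x → ∃ λ j → j ≤ m × iter t j h₀ ≡ x
      rep x with conn⇒Orb sub (tree-noCycle tree) (tree-conn tree h₀ x)
      ... | k , q = let j , le , r = small k in j , le , trans r q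
      f : Fin n → Fin (suc m)
      f x = fromℕ< (s≤s (proj₁ (proj₂ (rep x))))
      f-inj : ∀ {x y} → f x ≡ f y → x ≡ y
      f-inj {x} {y} q = trans (sym (proj₂ (proj₂ (rep x)))) (trans (cong (λ k → iter t k h₀)
        (trans (sym (Finₚ.toℕ-fromℕ< _)) (trans (cong toℕ q) (Finₚ.toℕ-fromℕ< _)))) (proj₂ (proj₂ (rep y))))

    iter-n : iter t n h₀ ≡ h₀
    iter-n with O.period h₀
    ... | m , m<n , e = subst (λ k → iter t k h₀ ≡ h₀) (ℕₚ.≤-antisym m<n (period-≥n m e)) e

    opaque
      unfolding P

      pos-spec : ∀ x k → k < n → iter t k h₀ ≡ x → P x ≤ k × iter t (P x) h₀ ≡ x
      pos-spec x k lt refl with takeWhileᵇ-least (λ j → not (iter t j h₀ == x)) (λ j → j) n k lt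
                                 (cong not (==-refl (iter t k h₀)))
      ... | le , q = le , ==⇒ (not-f (λ r → t≢f (cong not r) q))

    iter-bounded : ∀ x → ∃ λ k → k < n × iter t k h₀ ≡ x
    iter-bounded x = O.Orb-bounded (conn⇒Orb sub (tree-noCycle tree) (tree-conn tree h₀ x))

    iter-pos : ∀ x → iter t (P x) h₀ ≡ x
    iter-pos x = let k , lt , e = iter-bounded x in proj₂ (pos-spec x k lt e)

    pos<n : ∀ x → P x < n
    pos<n x = let k , lt , e = iter-bounded x in ℕₚ.≤-<-trans (proj₁ (pos-spec x k lt e)) lt

    pos-inj : ∀ {x y} → P x ≡ P y → x ≡ y
    pos-inj {x} {y} e = trans (sym (iter-pos x)) (trans (cong (λ k → iter t k h₀) e) (iter-pos y))

    pos-iter : ∀ k → k < n → P (iter t k h₀) ≡ k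
    pos-iter k lt with pos-spec (iter t k h₀) k lt refl
    ... | le , e with ℕₚ.m≤n⇒m<n∨m≡n le
    ... | inj₂ q = q
    -- Meeting the same half-edge at positions `j` and `k` would give a period of length `k - j`,
    -- which is less than `n`.
    ... | inj₁ j<k = ⊥-elim (ℕₚ.<-irrefl refl (ℕₚ.<-≤-trans lt (ℕₚ.≤-trans (period-≥n d (O.iter-inj j _ _ loop)) d≤)))
      where
      j d : ℕ
      j = P (iter t k h₀)
      d = k ∸ suc j
      k≡ : k ≡ j + suc d
      k≡ = sym (trans (ℕₚ.+-suc j d) (ℕₚ.m+[n∸m]≡n j<k))
      d≤ : suc d ≤ k
      d≤ = subst (suc d ≤_) (sym k≡) (ℕₚ.m≤n+m (suc d) j)
      loop : iter t j (iter t (suc d) h₀) ≡ iter t j h₀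
      loop = trans (sym (iter-+ t j (suc d) h₀)) (trans (cong (λ z → iter t z h₀) (sym k≡)) (sym e))

    pos-h₀ : P h₀ ≡ 0
    pos-h₀ = pos-iter 0 (ℕₚ.≤-<-trans z≤n (pos<n h₀))

    pos-t : ∀ x → suc (P x) < n → P (t x) ≡ suc (P x)
    pos-t x lt = trans (cong (λ z → P (t z)) (sym (iter-pos x))) (pos-iter (suc (P x)) lt)

    pos-pred : ∀ x k → P x ≡ suc k → ∃ λ w → P w ≡ k × t w ≡ x
    pos-pred x k e = iter t k h₀ , pos-iter k (ℕₚ.<-trans (ℕₚ.n<1+n k) (subst (_< n) e (pos<n x))) ,
      trans (cong (λ z → iter t z h₀) (sym e)) (iter-pos x)

    small-or : ∀ x → P x < P (α x) ⊎ P (α x) < P x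
    small-or x with ℕₚ.<-cmp (P x) (P (α x))
    ... | tri< a _ _ = inj₁ a
    ... | tri≈ _ b _ = ⊥-elim (α≢ (pos-inj b))
    ... | tri> _ _ c = inj₂ c

    small-α : ∀ {x} → P (α x) < P x → P (α x) < P (α (α x))
    small-α {x} = subst (λ z → P (α x) < P z) (sym (α-invol x))

    -- for a tree edge {b, αb} with b first, the component of T - {b, αb} avoiding the root
    opaque
      U : Fin n → Fin n → Bool
      U b x = (P b <ᵇ P x) ∧ (P x ≤ᵇ P (α b))

      U⁺ : ∀ {b x} → P b < P x → P x ≤ P (α b) → U b x ≡ true
      U⁺ p q = ∧-intro (<ᵇ-t p) (≤ᵇ-t q)

      U-lo : ∀ {b x} → U b x ≡ true → P b < P x
      U-lo {b} {x} p = <ᵇ-⇒ (∧-fst p)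

      U-hi : ∀ {b x} → U b x ≡ true → P x ≤ P (α b)
      U-hi {b} {x} p = ≤ᵇ-⇒ (∧-snd {P b <ᵇ P x} p)

    U-b : ∀ b → U b b ≡ false
    U-b b = not-t (λ p → ℕₚ.<-irrefl refl (U-lo p))

    U-αb : ∀ {b} → P b < P (α b) → U b (α b) ≡ true
    U-αb sm = U⁺ sm ℕₚ.≤-refl

    U-h₀ : ∀ b → U b h₀ ≡ false
    U-h₀ b = not-t (λ p → ℕₚ.n≮0 (subst (P b <_) pos-h₀ (U-lo p)))

    U-before : ∀ {b x} → P x ≤ P b → U b x ≡ false
    U-before le = not-t (λ p → ℕₚ.<-irrefl refl (ℕₚ.<-≤-trans (U-lo p) le))

    record Up (b : Fin n) : Set where
      constructor mkUp
      field
        up∈ : lookup T b ≡ true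
        up< : P b < P (α b)
    open Up public

    module _ {b : Fin n} (u : Up b) where
      private
        T' : Vec Bool n
        T' = del T b
        sub' : Sub T'
        sub' = del-sub b sub
        nc' : NoCycle T'
        nc' c pc q = tree-noCycle tree c (proj₁ (lookup-del⁻ {T} {b} pc)) (conn-mono {del T' c} {del T c} (λ z r →
          let r1 , r2 , r3 = lookup-del⁻ {T'} {c} r in lookup-del⁺ {T} {c} (proj₁ (lookup-del⁻ {T} {b} r1)) r2 r3) q)

        U-step : ∀ x → U b x ≡ true → U b (motion T' x) ≡ true
        U-step x ux with x Finₚ.≟ b | x Finₚ.≟ α b
        ... | yes refl | _ = ⊥-elim (t≢f ux (U-b x))
        -- At the end `α b` of the arc the motion without `b` applies σ to `α b`, which is where the
        -- tour goes after `b`: it jumps back to the start of the arc.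
        ... | no _ | yes refl = subst (λ z → U b z ≡ true) (sym eq)
                (U⁺ (ℕₚ.≤-reflexive (sym pe)) (subst (_≤ P (α b)) (sym pe) (up< u)))
          where
          eq : motion T' (α b) ≡ t b
          eq = trans (motion-out {T'} (not-t (λ p → proj₂ (proj₂ (lookup-del⁻ {T} {b} p)) refl)))
              (sym (motion-in {T} (up∈ u)))
          pe : P (t b) ≡ suc (P b)
          pe = pos-t b (ℕₚ.≤-<-trans (up< u) (pos<n (α b)))
        ... | no p | no q = subst (λ z → U b z ≡ true) (sym (motion-cong {T'} {T} (lookup-del-same {T} p q)))
                (U⁺ (subst (P b <_) (sym pe) (ℕₚ.m<n⇒m<1+n (U-lo ux))) (subst (_≤ P (α b)) (sym pe) lt))
          where
          lt : P x < P (α b)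
          lt = ℕₚ.≤∧≢⇒< (U-hi ux) (λ e → q (pos-inj e))
          pe : P (t x) ≡ suc (P x)
          pe = pos-t x (ℕₚ.≤-<-trans lt (pos<n (α b)))

        U-iter : ∀ k x → U b x ≡ true → U b (iter (motion T') k x) ≡ true
        U-iter zero x ux = ux
        U-iter (suc k) x ux = U-step _ (U-iter k x ux)

      -- The arc is closed under the motion of `T` without `b`, and by `conn⇒Orb` the components of
      -- that forest are the orbits of its motion.
      U-conn : ∀ {x y} → conn T' x y ≡ true → U b x ≡ true → U b y ≡ true
      U-conn {x} c ux = let k , e = conn⇒Orb sub' nc' c in subst (λ z → U b z ≡ true) e (U-iter k x ux)

      U-conn≡ : ∀ {x y} → conn T' x y ≡ true → U b x ≡ U b y
      U-conn≡ c = bool-ext (U-conn c) (U-conn (conn-sym T' sub' c))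

      U-≈ : ∀ {x y} → x ≈ y → U b x ≡ U b y
      U-≈ {x} v = U-conn≡ (conn-≈ T' (conn-refl T' x) v)

      U-tree : ∀ {f} → lookup T f ≡ true → f ≢ b → f ≢ α b → U b f ≡ U b (α f)
      U-tree {f} p q r = U-conn≡ (conn-α T' (conn-refl T' f) (lookup-del⁺ {T} {b} p q r))

    -- The tree path from p to q crosses the boundary of any X containing just one of them.
    Sep : (Fin n → Bool) → Fin n → Fin n → Fin n → Set
    Sep X p q f = Up f × ((U f p ≡ true × U f q ≡ false × X (α f) ≡ X p × X f ≡ X q)
                        ⊎ (U f p ≡ false × U f q ≡ true × X f ≡ X p × X (α f) ≡ X q))

    Sep-swap : ∀ {X p q f} → Sep X p q f → Sep X q p f
    Sep-swap (u , inj₁ (a , b , c , d)) = u , inj₂ (b , a , d , c)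
    Sep-swap (u , inj₂ (a , b , c , d)) = u , inj₁ (b , a , d , c)

    -- The later of the two half-edges is moved back along the tour, so the sum of the positions
    -- decreases. If the preceding half-edge `w` is external, or ends a tree edge, the move stays at
    -- the same vertex. If `w` starts a tree edge, the path crosses that edge: either `X` changes
    -- across it, and `w` is the answer, or the search goes on from `w`.
    walk : ∀ (X : Fin n → Bool) → (∀ {x y} → x ≈ y → X x ≡ X y) → ∀ p q → X p ≡ not (X q) → ∃ (Sep X p q)
    walk X cl p q = go (P p + P q) p q ℕₚ.≤-refl
      where
      flip : ∀ {a b} → a ≡ not b → b ≡ not a
      flip {true} {false} _ = refl
      flip {false} {true} _ = refl
      neq : ∀ {a b c} → a ≡ not b → c ≢ a → c ≡ b
      neq {true} {false} {false} _ _ = refl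
      neq {true} {false} {true} _ h = ⊥-elim (h refl)
      neq {false} {true} {true} _ _ = refl
      neq {false} {true} {false} _ h = ⊥-elim (h refl)
      move : ∀ {p p' q f} → X p ≡ X p' → U f p ≡ U f p' → Sep X p q f → Sep X p' q f
      move e e' (u , inj₁ (a , b , c , d)) = u , inj₁ (trans (sym e') a , b , trans c e , d)
      move e e' (u , inj₂ (a , b , c , d)) = u , inj₂ (trans (sym e') a , b , trans c e , d)
      go : ∀ m p q → P p + P q ≤ m → X p ≡ not (X q) → ∃ (Sep X p q)
      down : ∀ m p q k → P p ≡ suc k → P q < P p → P p + P q ≤ suc m → X p ≡ not (X q) → ∃ (Sep X p q)
      go m p q le e with ℕₚ.<-cmp (P p) (P q)
      ... | tri≈ _ r _ = ⊥-elim (≡not-irrefl (subst (λ z → X z ≡ not (X q)) (pos-inj r) e))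
      go zero p q le e | tri< r _ _ = ⊥-elim (ℕₚ.n≮0 (ℕₚ.<-≤-trans r (ℕₚ.≤-trans (ℕₚ.m≤n+m (P q) (P p)) le)))
      go zero p q le e | tri> _ _ r = ⊥-elim (ℕₚ.n≮0 (ℕₚ.<-≤-trans r (ℕₚ.≤-trans (ℕₚ.m≤m+n (P p) (P q)) le)))
      go (suc m) p q le e | tri> _ _ r = let k , eq = <⇒suc r in down m p q k eq r le e
      go (suc m) p q le e | tri< r _ _ = let k , eq = <⇒suc r
                                             f , s = down m q p k eq r
                                                 (subst (_≤ suc m) (ℕₚ.+-comm (P p) (P q)) le) (flip e)
                                         in f , Sep-swap {X} s
      down m p q k eq lt le e with pos-pred p k eq
      ... | w , pw , tw with lookup T w in inT
      ... | false = let f , s = go m w q le' (trans (cl w≈p) e) in f , move {w} {p} (cl w≈p) (U-≈ (proj₁ s) w≈p) s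
        where
        w≈p : w ≈ p
        w≈p = subst (w ≈_) tw (≈σ w)
        le' : P w + P q ≤ m
        le' = ℕₚ.≤-pred (subst (λ z → z + P q ≤ suc m) (trans eq (cong suc (sym pw))) le)
      ... | true with small-or w
      ... | inj₂ αw< = let f , s = go m (α w) q le' (trans (cl w≈p) e) in f , move {α w} {p} (cl w≈p) (U-≈ (proj₁ s) w≈p) s
        where
        w≈p : α w ≈ p
        w≈p = subst (α w ≈_) tw (≈σ (α w))
        le' : P (α w) + P q ≤ m
        le' = ℕₚ.≤-pred (ℕₚ.≤-trans (ℕₚ.+-monoˡ-< (P q) (subst (P (α w) <_) pw αw<))
                (ℕₚ.≤-trans (ℕₚ.n≤1+n _) (subst (λ z → z + P q ≤ suc m) eq le)))
      ... | inj₁ w< with X w 𝔹ₚ.≟ X p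
      ... | no ne = w , mkUp inT w< , inj₁ (trans (sym (U-≈ (mkUp inT w<) w≈p)) (U-αb w<) , U-before q≤w , cl w≈p
          , neq e ne)
        where
        w≈p : α w ≈ p
        w≈p = subst (α w ≈_) tw (≈σ (α w))
        q≤w : P q ≤ P w
        q≤w = subst (P q ≤_) (sym pw) (ℕₚ.≤-pred (subst (P q <_) eq lt))
      ... | yes Xw with go m w q le' (trans Xw e)
        where
        le' : P w + P q ≤ m
        le' = ℕₚ.≤-pred (subst (λ z → z + P q ≤ suc m) (trans eq (cong suc (sym pw))) le)
      ... | f , s = f , move {w} {p} Xw (trans (U-tree (proj₁ s) inT w≢f w≢αf) (U-≈ (proj₁ s) w≈p)) s
        where
        w≈p : α w ≈ p
        w≈p = subst (α w ≈_) tw (≈σ (α w))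
        q≤w : P q ≤ P w
        q≤w = subst (P q ≤_) (sym pw) (ℕₚ.≤-pred (subst (P q <_) eq lt))
        sep : (U f w ≡ false → U f q ≡ false → ⊥)
        sep a b with proj₂ s
        ... | inj₁ (c , _) = t≢f c a
        ... | inj₂ (_ , c , _) = t≢f c b
        w≢f : w ≢ f
        w≢f refl = sep (U-b w) (U-before q≤w)
        w≢αf : w ≢ α f
        w≢αf refl = ℕₚ.<-asym (up< (proj₁ s)) (subst (λ z → P (α f) < P z) (α-invol f) w<)

  -- Fundamental cycles and cocycles, and activity.

  lookup-removeAdd : ∀ T e e' x → lookup (removeAdd T e e') x ≡ (lookup T x ∧ not (sameEdge x e)) ∨ sameEdge x e'
  lookup-removeAdd T e e' x = lookup∘tabulate _ x

  lookup-addRemove : ∀ T e e' x → lookup (addRemove T e e') x ≡ (lookup T x ∨ sameEdge x e) ∧ not (sameEdge x e')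
  lookup-addRemove T e e' x = lookup∘tabulate _ x

  removeAdd-α : ∀ T e e' → removeAdd T (α e) e' ≡ removeAdd T e e'
  removeAdd-α T e e' = tabulate-cong (λ x → cong (λ z → (lookup T x ∧ not z) ∨ sameEdge x e') (sameEdge-inv₂ x e))

  removeAdd-α₂ : ∀ T e e' → removeAdd T e (α e') ≡ removeAdd T e e'
  removeAdd-α₂ T e e' = tabulate-cong (λ x → cong ((lookup T x ∧ not (sameEdge x e)) ∨_) (sameEdge-inv₂ x e'))

  addRemove-α : ∀ T e e' → addRemove T (α e) e' ≡ addRemove T e e'
  addRemove-α T e e' = tabulate-cong (λ x → cong (λ z → (lookup T x ∨ z) ∧ not (sameEdge x e')) (sameEdge-inv₂ x e))

  addRemove-α₂ : ∀ T e e' → addRemove T e (α e') ≡ addRemove T e e'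
  addRemove-α₂ T e e' = tabulate-cong (λ x → cong (λ z → (lookup T x ∨ sameEdge x e) ∧ not z) (sameEdge-inv₂ x e'))

  edgeRank-α : ∀ T e → edgeRank T (α e) ≡ edgeRank T e
  edgeRank-α T e rewrite α-invol e = ℕₚ.⊓-comm (pos T (α e)) (pos T e)

  fundα : ∀ {T} → Sub T → ∀ e e' → fund T (α e) e' ≡ fund T e e'
  fundα {T} sub e e' rewrite sym (inv sub e) with lookup T e
  ... | true = cong isSpanningTree (removeAdd-α T e e')
  ... | false = cong isSpanningTree (addRemove-α T e e')

  fundα₂ : ∀ T e e' → fund T e (α e') ≡ fund T e e'
  fundα₂ T e e' with lookup T e
  ... | true = cong isSpanningTree (removeAdd-α₂ T e e')
  ... | false = cong isSpanningTree (addRemove-α₂ T e e')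

  all-cong : ∀ {A : Set} {p q : A → Bool} xs → (∀ x → p x ≡ q x) → all p xs ≡ all q xs
  all-cong [] h = refl
  all-cong (x ∷ xs) h = cong₂ _∧_ (h x) (all-cong xs h)

  active-α : ∀ {T} → Sub T → ∀ e → active T (α e) ≡ active T e
  active-α {T} sub e = all-cong H (λ e' → cong₂ (λ a b → not a ∨ (b ≤ᵇ edgeRank T e')) (fundα sub e e')
      (edgeRank-α T e))

  module Activity (T : Vec Bool n) (tree : Tree T) where
    open Tour T tree public

    opaque
      unfolding P

      coc cyc Fund : Fin n → Fin n → Bool
      coc = inFundCocycle T
      cyc = inFundCycle T
      Fund = fund T

      coc⇒ : ∀ {b g} → coc b g ≡ true → Tree (removeAdd T b g)
      coc⇒ p = tree⇒ _ p

      ⇒coc : ∀ {b g} → Tree (removeAdd T b g) → coc b g ≡ true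
      ⇒coc p = ⇒tree p

      cyc⇒ : ∀ {b g} → cyc b g ≡ true → Tree (addRemove T b g)
      cyc⇒ p = tree⇒ _ p

      ⇒cyc : ∀ {b g} → Tree (addRemove T b g) → cyc b g ≡ true
      ⇒cyc p = ⇒tree p

      coc-α : ∀ b g → coc (α b) g ≡ coc b g
      coc-α b g = cong isSpanningTree (removeAdd-α T b g)

      fund-in : ∀ {b g} → lookup T b ≡ true → Fund b g ≡ coc b g
      fund-in {b} {g} p = cong (λ z → if z then inFundCocycle T b g else inFundCycle T b g) p

      fund-out : ∀ {b g} → lookup T b ≡ false → Fund b g ≡ cyc b g
      fund-out {b} {g} p = cong (λ z → if z then inFundCocycle T b g else inFundCycle T b g) p

      fund-α : ∀ e e' → Fund (α e) e' ≡ Fund e e'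
      fund-α = fundα sub

      fund-α₂ : ∀ e e' → Fund e (α e') ≡ Fund e e'
      fund-α₂ = fundα₂ T

      rank : Fin n → ℕ
      rank = edgeRank T

      rank-α : ∀ e → rank (α e) ≡ rank e
      rank-α = edgeRank-α T

      rank-small : ∀ {b} → P b < P (α b) → rank b ≡ P b
      rank-small lt = ℕₚ.m≤n⇒m⊓n≡m (ℕₚ.<⇒≤ lt)

      rank≡ : ∀ e → rank e ≡ edgeRank T e
      rank≡ e = refl

      Act : Fin n → Bool
      Act = active T

      Act≡ : ∀ e → Act e ≡ active T e
      Act≡ e = refl

      Act-α : ∀ e → Act (α e) ≡ Act e
      Act-α = active-α sub

      active⇒ : ∀ {e e'} → Act e ≡ true → Fund e e' ≡ true → rank e ≤ rank e'
      active⇒ {e} {e'} a p with ∨-elim {not (Fund e e')} (allF (λ e' → not (Fund e e') ∨ (rank e ≤ᵇ rank e')) a e')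
      ... | inj₁ q = ⊥-elim (t≢f p (not-≡f q))
      ... | inj₂ q = ≤ᵇ-⇒ q

      inactive⇒ : ∀ {e} → Act e ≡ false → ∃ λ e' → Fund e e' ≡ true × rank e' < rank e
      inactive⇒ {e} a with all-false (λ e' → not (Fund e e') ∨ (rank e ≤ᵇ rank e')) H a
      ... | e' , _ , q with tf-dec (Fund e e')
      ... | inj₁ fe = e' , fe , ℕₚ.≰⇒> (λ le → t≢f (∨-inr {not (Fund e e')} (≤ᵇ-t le)) q)
      ... | inj₂ fe = ⊥-elim (t≢f (∨-inl (not-≡t fe)) q)

    -- If both half-edges of `g` were on the same side of the cut, the exchanged tree would have no
    -- edge across it and could not join `b` to `α b`.
    cocycle⇒ : ∀ {b g} → Up b → coc b g ≡ true → U b g ≡ not (U b (α g))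
    cocycle⇒ {b} {g} u p = ≢⇒≡not λ same → t≢f (U-αb (up< u))
      (conn-ind T' (λ y → U b y ≡ false) (U-b b) (λ x y q v → trans (sym (U-≈ u v)) q) (s2 same)
          (tree-conn (coc⇒ p) b (α b)))
      where
      T' : Vec Bool n
      T' = removeAdd T b g
      s2 : U b g ≡ U b (α g) → ∀ y → U b y ≡ false → lookup T' y ≡ true → U b (α y) ≡ false
      s2 same y q r with ∨-elim {lookup T y ∧ not (sameEdge y b)} (trans (sym (lookup-removeAdd T b g y)) r)
      ... | inj₁ z = trans (sym (U-tree u (∧-fst z) (λ e → t≢f (sE e) (not-≡f (∧-snd {lookup T y} z)))
                                                    (λ e → t≢f (sE' e) (not-≡f (∧-snd {lookup T y} z))))) q
        where
        sE : y ≡ b → sameEdge y b ≡ true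
        sE refl = sameEdge-refl y
        sE' : y ≡ α b → sameEdge y b ≡ true
        sE' refl = sameEdge-α b
      ... | inj₂ z with sameEdge⇒ {y} {g} z
      ... | inj₁ refl = trans (sym same) q
      ... | inj₂ refl = trans (cong (U b) (α-invol g)) (trans same q)

    -- Without `b` the tree falls into the two sides of the cut. An edge `g` across it joins them
    -- again, and the number of edges is that of `T`.
    cocycle⇐ : ∀ {b g} → Up b → U b g ≡ not (U b (α g)) → coc b g ≡ true
    cocycle⇐ {b} {g} u cr with sameEdge g b in gb
    -- Here `g` is the edge of `b` itself, and the exchange returns `T`.
    ... | true = ⇒coc (subst Tree (vec-ext {v = T} {removeAdd T b g} same) tree)
      where
      sE≡ : ∀ x → sameEdge x g ≡ sameEdge x b
      sE≡ x with sameEdge⇒ {g} {b} gb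
      ... | inj₁ refl = refl
      ... | inj₂ refl = sameEdge-inv₂ x b
      same : ∀ x → lookup T x ≡ lookup (removeAdd T b g) x
      same x rewrite lookup-removeAdd T b g x | sE≡ x with sameEdge x b in xb
      ... | false = sym (trans (𝔹ₚ.∨-identityʳ _) (𝔹ₚ.∧-identityʳ _))
      ... | true rewrite 𝔹ₚ.∨-zeroʳ (lookup T x ∧ false) with sameEdge⇒ {x} {b} xb
      ... | inj₁ refl = up∈ u
      ... | inj₂ refl = trans (sym (inv sub b)) (up∈ u)
    ... | false = ⇒coc (mkTree sub' (λ x → conn-trans T' (conn-sym T' sub' (fromB h₀)) (fromB x)) size)
      where
      T' T₁ : Vec Bool n
      T' = removeAdd T b g
      T₁ = del T b
      sub₁ : Sub T₁
      sub₁ = del-sub b sub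
      sub' : Sub T'
      sub' .inv x rewrite lookup-removeAdd T b g x | lookup-removeAdd T b g (α x)
        | inv sub x | sameEdge-inv x b | sameEdge-inv x g = refl
      inc : ∀ z → lookup T₁ z ≡ true → lookup T' z ≡ true
      inc z p = trans (lookup-removeAdd T b g z) (∨-inl (trans (sym (lookup∘tabulate _ z)) p))
      g∈ : lookup T' g ≡ true
      g∈ = trans (lookup-removeAdd T b g g) (∨-inr {lookup T g ∧ not (sameEdge g b)} (sameEdge-refl g))
      αg∈ : lookup T' (α g) ≡ true
      αg∈ = trans (sym (inv sub' g)) g∈
      module E = OneEdge T T₁ b (split-del T b)
      ends : ∀ y → E.ToEnd y
      ends y with E.conn-split sub₁ (tree-conn tree b y)
      ... | inj₁ p = inj₁ p
      ... | inj₂ (_ , p) = p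
      in⇒ : ∀ y → U b y ≡ true → conn T₁ (α b) y ≡ true
      in⇒ y p with ends y
      ... | inj₁ c = ⊥-elim (t≢f p (trans (sym (U-conn≡ u c)) (U-b b)))
      ... | inj₂ c = c
      out⇒ : ∀ y → U b y ≡ false → conn T₁ b y ≡ true
      out⇒ y p with ends y
      ... | inj₁ c = c
      ... | inj₂ c = ⊥-elim (t≢f (trans (sym (U-conn≡ u c)) (U-αb (up< u))) p)
      bridge : conn T' b (α b) ≡ true
      bridge with ≡not-cases cr
      ... | inj₁ (p , q) = conn-trans T' (subst (λ z → conn T' b z ≡ true) (α-invol g)
              (conn-α T' (conn-mono {T₁} {T'} inc (out⇒ (α g) q)) αg∈))
              (conn-sym T' sub' (conn-mono {T₁} {T'} inc (in⇒ g p)))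
      ... | inj₂ (p , q) = conn-trans T' (conn-α T' (conn-mono {T₁} {T'} inc (out⇒ g p)) g∈)
              (conn-sym T' sub' (conn-mono {T₁} {T'} inc (in⇒ (α g) q)))
      fromB : ∀ y → conn T' b y ≡ true
      fromB y with ends y
      ... | inj₁ c = conn-mono {T₁} {T'} inc c
      ... | inj₂ c = conn-trans T' bridge (conn-mono {T₁} {T'} inc c)
      g∉ : lookup T g ≡ false
      g∉ = not-t (λ p → ≡not-irrefl (trans (sym (U-tree u p (λ e → t≢f (sEb e) gb) (λ e → t≢f (sEαb e) gb))) cr))
        where
        sEb : g ≡ b → sameEdge g b ≡ true
        sEb refl = sameEdge-refl g
        sEαb : g ≡ α b → sameEdge g b ≡ true
        sEαb refl = sameEdge-α b
      numE' : numE T' ≡ suc (numE T₁)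
      numE' = numE-diff {T'} {T₁} g h1 h2
        where
        h1 : ∀ x → sameEdge x g ≡ true → lookup T' x ≡ true × lookup T₁ x ≡ false
        h1 x p = trans (lookup-removeAdd T b g x) (∨-inr {lookup T x ∧ not (sameEdge x b)} p)
               , not-t (λ q → t≢f (proj₁ (lookup-del⁻ {T} {b} q)) (T∌ (sameEdge⇒ {x} {g} p)))
          where
          T∌ : x ≡ g ⊎ x ≡ α g → lookup T x ≡ false
          T∌ (inj₁ refl) = g∉
          T∌ (inj₂ refl) = trans (sym (inv sub g)) g∉
        h2 : ∀ x → sameEdge x g ≡ false → lookup T' x ≡ lookup T₁ x
        h2 x p rewrite lookup-removeAdd T b g x | p = trans (𝔹ₚ.∨-identityʳ _) (sym (lookup∘tabulate _ x))
      size : numE T' + 1 ≡ numV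
      size = trans (cong (_+ 1) (trans numE' (sym (numE-del b sub (up∈ u))))) (tree-size tree)

    -- The same exchange belongs to the cycle of `e` and to the cocycle of `f`. Membership in cycles
    -- is thereby reduced to cocycles, and so to the sets `U f`.
    addRemove≡removeAdd : ∀ {e f} → sameEdge f e ≡ false → addRemove T e f ≡ removeAdd T f e
    addRemove≡removeAdd {e} {f} ne = vec-ext go
      where
      go : ∀ x → lookup (addRemove T e f) x ≡ lookup (removeAdd T f e) x
      go x rewrite lookup-addRemove T e f x | lookup-removeAdd T f e x with sameEdge x e in xe | sameEdge x f in xf
      ... | false | _ = trans (cong (_∧ _) (𝔹ₚ.∨-identityʳ (lookup T x))) (sym (𝔹ₚ.∨-identityʳ _))
      ... | true | false rewrite 𝔹ₚ.∨-zeroʳ (lookup T x) = sym (𝔹ₚ.∨-zeroʳ _)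
      ... | true | true = ⊥-elim (t≢f (meet (sameEdge⇒ {x} {f} xf)) ne)
        where
        meet : x ≡ f ⊎ x ≡ α f → sameEdge f e ≡ true
        meet (inj₁ refl) = xe
        meet (inj₂ refl) = trans (sameEdge-inv f e) xe

    cycle⇒ : ∀ {e f} → lookup T e ≡ false → cyc e f ≡ true →
             (f ≡ e ⊎ f ≡ α e) ⊎ (lookup T f ≡ true × coc f e ≡ true)
    cycle⇒ {e} {f} e∉ p with sameEdge f e in fe
    ... | true = inj₁ (sameEdge⇒ {f} {e} fe)
    ... | false with lookup T f in f∈
    ... | true = inj₂ (refl , ⇒coc (subst Tree (addRemove≡removeAdd fe) (cyc⇒ p)))
    -- Two distinct external edges: removing `f` has no effect, so the result has one edge more than
    -- a spanning tree.
    ... | false = ⊥-elim (ℕₚ.1+n≢n (trans (sym numE') (ℕₚ.+-cancelʳ-≡ 1 _ _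
        (trans (tree-size (cyc⇒ p)) (sym (tree-size tree))))))
      where
      T' : Vec Bool n
      T' = addRemove T e f
      numE' : numE T' ≡ suc (numE T)
      numE' = numE-diff {T'} {T} e h1 h2
        where
        h1 : ∀ x → sameEdge x e ≡ true → lookup T' x ≡ true × lookup T x ≡ false
        h1 x xe with sameEdge⇒ {x} {e} xe
        ... | inj₁ refl = trans (lookup-addRemove T e f x) (∧-intro (∨-inr {lookup T x} xe)
            (not-≡t (not-t (λ q → t≢f (swap (sameEdge⇒ {x} {f} q)) fe)))) , e∉
          where
          swap : x ≡ f ⊎ x ≡ α f → sameEdge f e ≡ true
          swap (inj₁ refl) = xe
          swap (inj₂ q) = trans (sameEdge-inv f e) (trans (cong (λ z → sameEdge z e) (sym q)) xe)
        ... | inj₂ refl = trans (lookup-addRemove T e f x) (∧-intro (∨-inr {lookup T x} xe)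
            (not-≡t (not-t (λ q → t≢f (swap (sameEdge⇒ {x} {f} q)) fe)))) , trans (sym (inv sub e)) e∉
          where
          swap : x ≡ f ⊎ x ≡ α f → sameEdge f e ≡ true
          swap (inj₁ q) = trans (cong (λ z → sameEdge z e) (sym q)) xe
          swap (inj₂ q) = trans (sameEdge-inv f e) (trans (cong (λ z → sameEdge z e) (sym q)) xe)
        h2 : ∀ x → sameEdge x e ≡ false → lookup T' x ≡ lookup T x
        h2 x xe rewrite lookup-addRemove T e f x | xe | 𝔹ₚ.∨-identityʳ (lookup T x) with sameEdge x f in xf
        ... | false = 𝔹ₚ.∧-identityʳ _
        ... | true with sameEdge⇒ {x} {f} xf
        ... | inj₁ refl rewrite f∈ = refl
        ... | inj₂ refl rewrite trans (sym (inv sub f)) f∈ = refl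

    cycle⇐ : ∀ {e f} → lookup T e ≡ false → lookup T f ≡ true → coc f e ≡ true → cyc e f ≡ true
    cycle⇐ {e} {f} e∉ f∈ p = ⇒cyc (subst Tree (sym (addRemove≡removeAdd
      (sameEdge-no {f} {e} (λ { refl → t≢f f∈ e∉ }) (λ { refl → t≢f f∈ (trans (sym (inv sub e)) e∉) })))) (coc⇒ p))

    fund-self : ∀ e → Fund e e ≡ true
    fund-self e with tf-dec (lookup T e)
    ... | inj₂ p = trans (fund-out p) (⇒cyc (subst Tree (vec-ext {v = T} {addRemove T e e} same) tree))
      where
      same : ∀ x → lookup T x ≡ lookup (addRemove T e e) x
      same x rewrite lookup-addRemove T e e x with sameEdge x e in xe
      ... | false = sym (trans (𝔹ₚ.∧-identityʳ _) (𝔹ₚ.∨-identityʳ _))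
      ... | true rewrite 𝔹ₚ.∧-zeroʳ (lookup T x ∨ true) with sameEdge⇒ {x} {e} xe
      ... | inj₁ refl = p
      ... | inj₂ refl = trans (sym (inv sub e)) p
    ... | inj₁ p with small-or e
    ... | inj₁ lt = trans (fund-in p) (cocycle⇐ (mkUp p lt) (trans (U-b e) (cong not (sym (U-αb lt)))))
    ... | inj₂ gt = trans (sym (trans (fund-α₂ (α e) e) (fund-α e e)))
                          (trans (fund-in (up∈ up)) (cocycle⇐ up
                              (trans (U-b (α e)) (cong not (sym (U-αb (up< up)))))))
      where
      up : Up (α e)
      up = mkUp (trans (sym (inv sub e)) p) (small-α gt)

    record Ext (g : Fin n) : Set where
      constructor mkExt
      field
        ext∉ : lookup T g ≡ false
        ext< : P g < P (α g)
    open Ext public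

    Half : Fin n → Set
    Half x = (Up x ⊎ Up (α x)) ⊎ (Ext x ⊎ Ext (α x))

    half : ∀ x → Half x
    half x with lookup T x in e | small-or x
    ... | true | inj₁ p = inj₁ (inj₁ (mkUp e p))
    ... | true | inj₂ p = inj₁ (inj₂ (mkUp (trans (sym (inv sub x)) e) (small-α p)))
    ... | false | inj₁ p = inj₂ (inj₁ (mkExt e p))
    ... | false | inj₂ p = inj₂ (inj₂ (mkExt (trans (sym (inv sub x)) e) (small-α p)))

    -- Crossing pairs of a tree edge and an external edge, by which of the two comes first
    _≺ᵗ_ _≻ᵗ_ : Fin n → Fin n → Set
    f ≺ᵗ g = U f g ≡ true × U f (α g) ≡ false
    f ≻ᵗ g = U f g ≡ false × U f (α g) ≡ true

    crossing : ∀ {f g} → U f g ≡ not (U f (α g)) → f ≺ᵗ g ⊎ f ≻ᵗ g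
    crossing = ≡not-cases

    ≺⇒cross : ∀ {f g} → f ≺ᵗ g → U f g ≡ not (U f (α g))
    ≺⇒cross (p , q) = trans p (cong not (sym q))

    ≻⇒cross : ∀ {f g} → f ≻ᵗ g → U f g ≡ not (U f (α g))
    ≻⇒cross (p , q) = trans p (cong not (sym q))

    ≻⇒< : ∀ {f g} → Up f → Ext g → f ≻ᵗ g → P g < P f
    ≻⇒< {f} {g} u x (p , q) = ℕₚ.≤∧≢⇒< (ℕₚ.≮⇒≥ (λ lt → t≢f (U⁺ lt (ℕₚ.≤-trans (ℕₚ.<⇒≤ (ext< x)) (U-hi q))) p))
      (λ e → t≢f (up∈ u) (trans (cong (lookup T) (sym (pos-inj e))) (ext∉ x)))

    -- The relation `f ≻ᵗ g` places `g` in the cocycle of `f` and before `f` in the tour, against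
    -- the minimality of `f`.
    int-active : ∀ {f g} → Up f → Ext g → Act f ≡ true → f ≻ᵗ g → ⊥
    int-active {f} {g} u x a c = ℕₚ.<-irrefl refl (ℕₚ.<-≤-trans (≻⇒< u x c)
      (subst (_≤ P g) (rank-small (up< u)) (subst (rank f ≤_) (rank-small (ext< x))
        (active⇒ a (trans (fund-in {f} {g} (up∈ u)) (cocycle⇐ u (≻⇒cross c)))))))

    ext-active : ∀ {f g} → Up f → Ext g → Act g ≡ true → f ≺ᵗ g → ⊥
    ext-active {f} {g} u x a c = ℕₚ.<-irrefl refl (ℕₚ.<-≤-trans (U-lo (proj₁ c))
      (subst (_≤ P f) (rank-small (ext< x)) (subst (rank g ≤_) (rank-small (up< u))
        (active⇒ a (trans (fund-out {g} {f} (ext∉ x)) (cycle⇐ (ext∉ x) (up∈ u) (cocycle⇐ u (≺⇒cross c))))))))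

    -- Inactivity provides a smaller edge of the cocycle. It is external, since `f` is the only tree
    -- edge across its own cut, and being smaller it crosses in the order `≻ᵗ`.
    int-inactive : ∀ {f} → Up f → Act f ≡ false → ∃ λ g → Ext g × f ≻ᵗ g
    int-inactive {f} u a with inactive⇒ a
    ... | e , fe , lt with half e
    ... | inj₂ (inj₁ x) = e , x , fin (crossing (cocycle⇒ u (trans (sym (fund-in {f} {e} (up∈ u))) fe)))
      where
      fin : f ≺ᵗ e ⊎ f ≻ᵗ e → f ≻ᵗ e
      fin (inj₂ c) = c
      fin (inj₁ c) = ⊥-elim (ℕₚ.<-asym (U-lo (proj₁ c)) (subst (_< P f) (rank-small (ext< x))
          (subst (rank e <_) (rank-small (up< u)) lt)))
    ... | inj₂ (inj₂ x) = α e , x , fin (crossing (cocycle⇒ u (trans (sym (fund-in {f} {α e} (up∈ u))) fe')))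
      where
      fe' : Fund f (α e) ≡ true
      fe' = trans (fund-α₂ f e) fe
      fin : f ≺ᵗ α e ⊎ f ≻ᵗ α e → f ≻ᵗ α e
      fin (inj₂ c) = c
      fin (inj₁ c) = ⊥-elim (ℕₚ.<-asym (U-lo (proj₁ c)) (subst (_< P f) (rank-small (ext< x))
          (subst (rank (α e) <_) (rank-small (up< u)) (subst (_< rank f) (sym (rank-α e)) lt))))
    ... | inj₁ w = ⊥-elim (ℕₚ.<-irrefl (sym (rk (e≡ w))) lt)
      where
      inT : Up e ⊎ Up (α e) → lookup T e ≡ true
      inT (inj₁ v) = up∈ v
      inT (inj₂ v) = trans (inv sub e) (up∈ v)
      cr : U f e ≡ not (U f (α e))
      cr = cocycle⇒ u (trans (sym (fund-in {f} {e} (up∈ u))) fe)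
      e≡ : Up e ⊎ Up (α e) → e ≡ f ⊎ e ≡ α f
      e≡ v with e Finₚ.≟ f | e Finₚ.≟ α f
      ... | yes p | _ = inj₁ p
      ... | no _ | yes p = inj₂ p
      ... | no p | no q = ⊥-elim (≡not-irrefl (trans (sym (U-tree u (inT v) p q)) cr))
      rk : e ≡ f ⊎ e ≡ α f → rank f ≡ rank e
      rk (inj₁ refl) = refl
      rk (inj₂ refl) = sym (rank-α f)

    ext-inactive : ∀ {g} → Ext g → Act g ≡ false → ∃ λ f → Up f × f ≺ᵗ g
    ext-inactive {g} x a with inactive⇒ a
    ... | e , fe , lt with cycle⇒ (ext∉ x) (trans (sym (fund-out {g} {e} (ext∉ x))) fe)
    ... | inj₁ (inj₁ refl) = ⊥-elim (ℕₚ.<-irrefl refl lt)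
    ... | inj₁ (inj₂ refl) = ⊥-elim (ℕₚ.<-irrefl (rank-α g) lt)
    ... | inj₂ (e∈ , c) with half e
    ... | inj₂ (inj₁ y) = ⊥-elim (t≢f e∈ (ext∉ y))
    ... | inj₂ (inj₂ y) = ⊥-elim (t≢f (trans (sym (inv sub e)) e∈) (ext∉ y))
    ... | inj₁ (inj₁ u) = e , u , fin (crossing (cocycle⇒ u c))
      where
      fin : e ≺ᵗ g ⊎ e ≻ᵗ g → e ≺ᵗ g
      fin (inj₁ c) = c
      fin (inj₂ c) = ⊥-elim (ℕₚ.<-asym (≻⇒< u x c) (subst (_< P g) (rank-small (up< u))
          (subst (rank e <_) (rank-small (ext< x)) lt)))
    ... | inj₁ (inj₂ u) = α e , u , fin (crossing (cocycle⇒ u (trans (coc-α e g) c)))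
      where
      fin : α e ≺ᵗ g ⊎ α e ≻ᵗ g → α e ≺ᵗ g
      fin (inj₁ c) = c
      fin (inj₂ c) = ⊥-elim (ℕₚ.<-asym (≻⇒< u x c) (subst (_< P g) (rank-small (up< u))
          (subst (rank (α e) <_) (rank-small (ext< x)) (subst (_< rank g) (sym (rank-α e)) lt))))

  -- Directed reachability.

  opaque
    dreach : Vec Bool n → Fin n → Fin n → Bool
    dreach = reachD

    dreach≡ : ∀ O x y → dreach O x y ≡ reachD O x y
    dreach≡ O x y = refl

  dr : Vec Bool n → Fin n → Fin n → Set
  dr O x y = dreach O x y ≡ true

  module _ (O : Vec Bool n) where

    opaque
      unfolding dreach

      dr-refl : ∀ x → dr O x x
      dr-refl = reach-refl (dstep O)

      dr-trans : ∀ {x y z} → dr O x y → dr O y z → dr O x z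
      dr-trans = reach-trans (dstep O)

      dr-≈ : ∀ {x y z} → dr O x y → y ≈ z → dr O x z
      dr-≈ p q = reach-snoc (dstep O) p (∨-inl (un≈ q))

      dr-α : ∀ {x y} → dr O x y → lookup O y ≡ true → dr O x (α y)
      dr-α {x} {y} p q = reach-snoc (dstep O) p (∨-inr {sameV y (α y)} (∧-intro q (==-refl (α y))))

      dr-ind : ∀ {h} (X : Fin n → Set) → X h → (∀ x y → X x → x ≈ y → X y) →
               (∀ x → X x → lookup O x ≡ true → X (α x)) → ∀ {x} → dr O h x → X x
      dr-ind X xh s1 s2 = reach-ind (dstep O) X xh stp
        where
        stp : ∀ m x → X m → dstep O m x ≡ true → X x
        stp m x xm e with ∨-elim {sameV m x} e
        ... | inj₁ q = s1 m x xm (mk≈ q)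
        ... | inj₂ q = subst X (==⇒ (∧-snd {lookup O m} q)) (s2 m xm (∧-fst q))

    dr-α⁻ : ∀ {x y} → dr O x (α y) → lookup O (α y) ≡ true → dr O x y
    dr-α⁻ {x} {y} p q = subst (dr O x) (α-invol y) (dr-α p q)

    reach≈ : ∀ z {x y} → x ≈ y → dreach O z x ≡ dreach O z y
    reach≈ z v = bool-ext (λ p → dr-≈ p v) (λ p → dr-≈ p (≈-sym v))

    -- No edge of `O` enters such a set: its boundary is a directed cut, and it is reached only from
    -- its own elements.
    record PredClosed (X : Fin n → Bool) : Set where
      field
        pc-≈ : ∀ {x y} → x ≈ y → X x ≡ X y
        pc-α : ∀ h → lookup O h ≡ true → X (α h) ≡ true → X h ≡ true

      pc-reach : ∀ {x y} → dr O x y → X y ≡ true → X x ≡ true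
      pc-reach {x} r p = not-f (λ q → t≢f p (dr-ind (λ y → X y ≡ false) q (λ y z e v → trans (sym (pc-≈ v)) e)
        (λ y e o → not-t (λ q' → t≢f (pc-α y o q') e)) r))
    open PredClosed public

  any-cong : ∀ {A : Set} {p q : A → Bool} xs → (∀ x → p x ≡ q x) → any p xs ≡ any q xs
  any-cong [] h = refl
  any-cong (x ∷ xs) h = cong₂ _∨_ (h x) (any-cong xs h)

  -- Intervals and the orientation of a pair `(T, S)`.

  record Interval (T S : Vec Bool n) : Set where
    field
      itree : Tree T
      isub : Sub S
      iact : ∀ h → lookup S h xor lookup T h ≡ true → active T h ≡ true
  open Interval public

  interval⇒ : ∀ {T S} → inInterval T S ≡ true → Interval T S
  interval⇒ {T} {S} iv .itree = tree⇒ T (∧-fst iv)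
  interval⇒ {T} {S} iv .isub = sub⇒ S (∧-fst (∧-snd {isSpanningTree T} iv))
  interval⇒ {T} {S} iv .iact h p with ∨-elim {not (lookup S h xor lookup T h)}
    (allF (λ h → not (lookup S h xor lookup T h) ∨ active T h) (∧-snd {isSubgraph S} (∧-snd {isSpanningTree T} iv)) h)
  ... | inj₁ q = ⊥-elim (t≢f p (not-≡f q))
  ... | inj₂ q = q

  ⇒interval : ∀ {T S} → Interval T S → inInterval T S ≡ true
  ⇒interval {T} {S} iv = ∧-intro (⇒tree (itree iv)) (∧-intro (⇒sub (isub iv)) (allF⁺ _ go))
    where
    go : ∀ h → not (lookup S h xor lookup T h) ∨ active T h ≡ true
    go h with tf-dec (lookup S h xor lookup T h)
    ... | inj₁ q = ∨-inr {not (lookup S h xor lookup T h)} (iact iv h q)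
    ... | inj₂ q = ∨-inl (not-≡t q)

  record IsΦ (T S O : Vec Bool n) : Set where
    constructor mkΦ
    field unΦ : Φ T S ≡ O
  open IsΦ public

  module Pair (T S O : Vec Bool n) (iv : Interval T S) (ΦO : IsΦ T S O) where
    open Activity T (itree iv) public

    subS : Sub S
    subS = isub iv

    A : Fin n → Bool
    A h = lookup S h xor lookup T h

    A-inv : ∀ h → A h ≡ A (α h)
    A-inv h = cong₂ _xor_ (inv subS h) (inv sub h)

    A-act : ∀ {h} → A h ≡ true → Act h ≡ true
    A-act {h} p = trans (Act≡ h) (iact iv h p)

    opaque
      unfolding P Fund

      -- True exactly on the edges that `Φ` reverses against the reference orientation.
      meets : Fin n → Bool
      meets h = any (λ h' → Fund h h' ∧ A h') H

      meets-α : ∀ h → meets (α h) ≡ meets h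
      meets-α h = any-cong H (λ h' → cong (_∧ A h') (fund-α h h'))

      O-def : ∀ h → lookup O h ≡ not ((P h <ᵇ P (α h)) xor (if lookup T h then not (meets h) else meets h))
      O-def h = trans (cong (λ v → lookup v h) (sym (unΦ ΦO))) (lookup∘tabulate _ h)

      meets⁺ : ∀ {h h'} → Fund h h' ≡ true → A h' ≡ true → meets h ≡ true
      meets⁺ {h} {h'} p q = anyF⁺ (λ h' → Fund h h' ∧ A h') h' (∧-intro p q)

      meets⁻ : ∀ {h} → meets h ≡ true → ∃ λ h' → Fund h h' ≡ true × A h' ≡ true
      meets⁻ {h} m = let h' , q = anyF (λ h' → Fund h h' ∧ A h') m in h' , ∧-fst q , ∧-snd {Fund h h'} q

    O-def-α : ∀ h → lookup O (α h) ≡ not ((P (α h) <ᵇ P h) xor (if lookup T h then not (meets h) else meets h))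
    O-def-α h = trans (O-def (α h)) (cong₂ (λ a b → not (a xor b)) (cong (λ z → P (α h) <ᵇ P z) (α-invol h))
      (cong₂ (λ a b → if a then not b else b) (sym (inv sub h)) (meets-α h)))

    O-up : ∀ {b} → Up b → lookup O b ≡ not (meets b)
    O-up {b} u rewrite O-def b | up∈ u | <ᵇ-t (up< u) = 𝔹ₚ.not-involutive _

    O-up-α : ∀ {b} → Up b → lookup O (α b) ≡ meets b
    O-up-α {b} u rewrite O-def-α b | up∈ u | <ᵇ-f (ℕₚ.<⇒≤ (up< u)) = 𝔹ₚ.not-involutive _

    O-ext : ∀ {e} → Ext e → lookup O e ≡ meets e
    O-ext {b} u rewrite O-def b | ext∉ u | <ᵇ-t (ext< u) = 𝔹ₚ.not-involutive _

    O-ext-α : ∀ {e} → Ext e → lookup O (α e) ≡ not (meets e)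
    O-ext-α {b} u rewrite O-def-α b | ext∉ u | <ᵇ-f (ℕₚ.<⇒≤ (ext< u)) = refl

    O-flip : ∀ h → lookup O h ≡ not (lookup O (α h))
    O-flip h with half h
    ... | inj₁ (inj₁ u) = trans (O-up u) (cong not (sym (O-up-α u)))
    ... | inj₁ (inj₂ u) = trans (trans (cong (lookup O) (sym (α-invol h))) (O-up-α u))
        (sym (trans (cong not (O-up u)) (𝔹ₚ.not-involutive _)))
    ... | inj₂ (inj₁ u) = trans (O-ext u) (sym (trans (cong not (O-ext-α u)) (𝔹ₚ.not-involutive _)))
    ... | inj₂ (inj₂ u) = trans (trans (cong (lookup O) (sym (α-invol h))) (O-ext-α u)) (cong not (sym (O-ext u)))

    O-not-both : ∀ {h} → lookup O h ≡ true → lookup O (α h) ≡ true → ⊥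
    O-not-both {h} p q = t≢f p (trans (O-flip h) (cong not q))

    up-unique : ∀ {f g} → Up f → Up g → U g f ≡ not (U g (α f)) → f ≡ g
    up-unique {f} {g} u v cr with f Finₚ.≟ g | f Finₚ.≟ α g
    ... | yes p | _ = p
    ... | no _ | yes refl = ⊥-elim (ℕₚ.<-asym (up< v) (subst (λ z → P (α g) < P z) (α-invol g) (up< u)))
    ... | no p | no q = ⊥-elim (≡not-irrefl (trans (sym (U-tree v (up∈ u) p q)) cr))

    meets-self : ∀ {h} → A h ≡ true → meets h ≡ true
    meets-self {h} = meets⁺ (fund-self h)

    meets-up : ∀ {b a} → Up b → A a ≡ true → U b a ≡ not (U b (α a)) → meets b ≡ true
    meets-up {b} {a} u p c = meets⁺ {b} {a} (trans (fund-in {b} {a} (up∈ u)) (cocycle⇐ u c)) p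

    meets-ext : ∀ {e b} → Ext e → Up b → A b ≡ true → U b e ≡ not (U b (α e)) → meets e ≡ true
    meets-ext {e} {b} x u p c = meets⁺ {e} {b} (trans (fund-out {e} {b} (ext∉ x))
        (cycle⇐ (ext∉ x) (up∈ u) (cocycle⇐ u c))) p

    -- The cocycle of `b` contains no tree edge but `b`, and a toggled external edge is active,
    -- which leaves only the order `≻ᵗ`.
    meets-up⇒ : ∀ {b} → Up b → meets b ≡ true → A b ≡ true ⊎ ∃ λ a → Ext a × A a ≡ true × b ≻ᵗ a
    meets-up⇒ {b} u m with meets⁻ m
    ... | h , q , Ah = go (half h) cr Ah
      where
      cr : U b h ≡ not (U b (α h))
      cr = cocycle⇒ u (trans (sym (fund-in {b} {h} (up∈ u))) q)
      flip : U b h ≡ not (U b (α h)) → U b (α h) ≡ not (U b (α (α h)))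
      flip c rewrite α-invol h with U b h | U b (α h)
      ... | true | false = refl
      ... | false | true = refl
      ext : ∀ {a} → Ext a → A a ≡ true → U b a ≡ not (U b (α a)) → b ≻ᵗ a
      ext x p c with crossing c
      ... | inj₂ d = d
      ... | inj₁ d = ⊥-elim (ext-active u x (A-act p) d)
      go : Half h → U b h ≡ not (U b (α h)) → A h ≡ true → A b ≡ true ⊎ ∃ λ a → Ext a × A a ≡ true × b ≻ᵗ a
      go (inj₁ (inj₁ v)) c p = inj₁ (subst (λ z → A z ≡ true) (up-unique v u c) p)
      go (inj₁ (inj₂ v)) c p = inj₁ (subst (λ z → A z ≡ true) (up-unique v u (flip c)) (trans (sym (A-inv h)) p))
      go (inj₂ (inj₁ x)) c p = inj₂ (h , x , p , ext x p c)
      go (inj₂ (inj₂ x)) c p = inj₂ (α h , x , trans (sym (A-inv h)) p , ext x (trans (sym (A-inv h)) p) (flip c))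

    meets-ext⇒ : ∀ {e} → Ext e → meets e ≡ true → A e ≡ true ⊎ ∃ λ b → Up b × A b ≡ true × b ≺ᵗ e
    meets-ext⇒ {e} x m with meets⁻ m
    ... | h , q , Ah with cycle⇒ (ext∉ x) (trans (sym (fund-out {e} {h} (ext∉ x))) q)
    ... | inj₁ (inj₁ refl) = inj₁ Ah
    ... | inj₁ (inj₂ refl) = inj₁ (trans (A-inv e) Ah)
    ... | inj₂ (h∈ , c) = inj₂ (go (half h))
      where
      up : ∀ {b} → Up b → A b ≡ true → coc b e ≡ true → ∃ λ b → Up b × A b ≡ true × b ≺ᵗ e
      up {b} u p d with crossing (cocycle⇒ u d)
      ... | inj₁ z = b , u , p , z
      ... | inj₂ z = ⊥-elim (int-active u x (A-act p) z)
      go : Half h → ∃ λ b → Up b × A b ≡ true × b ≺ᵗ e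
      go (inj₁ (inj₁ u)) = up u Ah c
      go (inj₁ (inj₂ u)) = up u (trans (sym (A-inv h)) Ah) (trans (coc-α h e) c)
      go (inj₂ (inj₁ y)) = ⊥-elim (t≢f h∈ (ext∉ y))
      go (inj₂ (inj₂ y)) = ⊥-elim (t≢f (trans (sym (inv sub h)) h∈) (ext∉ y))

    -- A tree edge is reversed either because it is toggled, and then its cut is directed, or
    -- because it lies on the fundamental cycle of a toggled external edge, and then that cycle is
    -- directed. Both arguments about cuts and about cycles start from this distinction.
    data UpCase (b : Fin n) : Set where
      toggled  : A b ≡ true → lookup O (α b) ≡ true → UpCase b
      plain    : A b ≡ false → lookup O b ≡ true → UpCase b
      onCycle  : ∀ a → A b ≡ false → lookup O (α b) ≡ true → Ext a → A a ≡ true → b ≻ᵗ a → UpCase b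

    upCase : ∀ {b} → Up b → UpCase b
    upCase {b} u with tf-dec (meets b) | tf-dec (A b)
    ... | inj₂ m | inj₁ p = ⊥-elim (t≢f (meets-self p) m)
    ... | inj₂ m | inj₂ p = plain p (trans (O-up u) (cong not m))
    ... | inj₁ m | inj₁ p = toggled p (trans (O-up-α u) m)
    ... | inj₁ m | inj₂ p with meets-up⇒ u m
    ... | inj₁ q = ⊥-elim (t≢f q p)
    ... | inj₂ (a , x , q , c) = onCycle a p (trans (O-up-α u) m) x q c

    data ExtCase (e : Fin n) : Set where
      toggled   : A e ≡ true → lookup O e ≡ true → ExtCase e
      plain     : A e ≡ false → lookup O (α e) ≡ true → meets e ≡ false → ExtCase e
      onCocycle : ∀ b → A e ≡ false → lookup O e ≡ true → Up b → A b ≡ true → b ≺ᵗ e → ExtCase e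

    extCase : ∀ {e} → Ext e → ExtCase e
    extCase {e} x with tf-dec (meets e) | tf-dec (A e)
    ... | inj₂ m | inj₁ p = ⊥-elim (t≢f (meets-self p) m)
    ... | inj₂ m | inj₂ p = plain p (trans (O-ext-α x) (cong not m)) m
    ... | inj₁ m | inj₁ p = toggled p (trans (O-ext x) m)
    ... | inj₁ m | inj₂ p with meets-ext⇒ x m
    ... | inj₁ q = ⊥-elim (t≢f q p)
    ... | inj₂ (b , u , q , c) = onCocycle b p (trans (O-ext x) m) u q c

    -- The cocycle of a toggled `b` is reversed as a whole. Since `b` is active, every external edge
    -- across the cut has its first half-edge inside `U b`, so after reversal it leaves `U b`, as
    -- `b` does.
    U-predClosed : ∀ {b} → Up b → A b ≡ true → PredClosed O (U b)
    U-predClosed {b} u Ab = record { pc-≈ = U-≈ u ; pc-α = λ h o p → not-f (λ q → go h o p q (half h)) }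
      where
      tr : ∀ h → lookup T h ≡ true → lookup O h ≡ true → U b (α h) ≡ true → U b h ≡ false → ⊥
      tr h h∈ o p q with h Finₚ.≟ b | h Finₚ.≟ α b
      ... | yes refl | _ = t≢f o (trans (O-up u) (cong not (meets-self Ab)))
      ... | no _ | yes refl = t≢f (U-αb (up< u)) q
      ... | no x | no y = t≢f p (trans (sym (U-tree u h∈ x y)) q)
      go : ∀ h → lookup O h ≡ true → U b (α h) ≡ true → U b h ≡ false → Half h → ⊥
      go h o p q (inj₁ (inj₁ v)) = tr h (up∈ v) o p q
      go h o p q (inj₁ (inj₂ v)) = tr h (trans (inv sub h) (up∈ v)) o p q
      go h o p q (inj₂ (inj₁ x)) = int-active u x (A-act Ab) (q , p)
      go h o p q (inj₂ (inj₂ x)) = O-not-both o (trans (O-ext x) (meets-ext x u Ab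
        (≺⇒cross {b} {α h} (p , subst (λ z → U b z ≡ false) (sym (α-invol h)) q))))

    U-blocks : ∀ {b x y} → Up b → A b ≡ true → dr O x y → U b x ≡ false → U b y ≡ true → ⊥
    U-blocks u Ab r p q = t≢f (pc-reach (U-predClosed u Ab) r q) p

    module _ {a : Fin n} (x : Ext a) (Aa : A a ≡ true) where

      cycle-dir : ∀ {f} → Up f → U f a ≡ not (U f (α a)) → f ≻ᵗ a × lookup O (α f) ≡ true
      cycle-dir u c with crossing c
      ... | inj₁ d = ⊥-elim (ext-active u x (A-act Aa) d)
      ... | inj₂ d = d , trans (O-up-α u) (meets-up u Aa c)

      -- The tree path from `α a` to `a` is directed by `cycle-dir`, so a set that contains its
      -- start and not its end is left along one of its edges, with tail `α f`.
      cycle-exit : ∀ (X : Fin n → Bool) → (∀ {y z} → y ≈ z → X y ≡ X z) → X (α a) ≡ true → X a ≡ false →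
                   ∃ λ f → Up f × f ≻ᵗ a × X (α f) ≡ true × X f ≡ false × lookup O (α f) ≡ true
      cycle-exit X cl p q with walk X cl (α a) a (trans p (cong not (sym q)))
      ... | f , u , inj₁ (c , d , e , g) = let c' , o = cycle-dir u (≻⇒cross {f} {a} (d , c)) in f , u , c' , trans e p , trans g q , o
      ... | f , u , inj₂ (c , d , _) = ⊥-elim (ext-active u x (A-act Aa) (d , c))

      ext-tail : lookup O a ≡ true
      ext-tail = trans (O-ext x) (meets-self Aa)

      ext-back : dr O (α a) a
      ext-back = not-f λ q → let f , _ , _ , p , r , o = cycle-exit (dreach O (α a)) (reach≈ O (α a)) (dr-refl O (α a)) q
                             in t≢f (dr-α⁻ O p o) r

      ext-forth : dr O a (α a)
      ext-forth = dr-α O (dr-refl O a) ext-tail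

      module _ {g : Fin n} (v : Up g) (c : g ≻ᵗ a) where

        private
          to-a : dr O g a
          to-a = not-f bad
            where
            -- The directed cycle must leave this set on its way to `a`. It cannot leave from a
            -- half-edge reached from `g`, and the only tree edge out of `U g` is `g`, which belongs
            -- to the set.
            X : Fin n → Bool
            X z = dreach O g z ∨ U g z
            bad : dreach O g a ≡ false → ⊥
            bad r with cycle-exit X (λ e → cong₂ _∨_ (reach≈ O g e) (U-≈ v e))
                (∨-inr {dreach O g (α a)} (proj₂ c)) (cong₂ _∨_ r (proj₁ c))
            ... | f , u , _ , p , q , o with ∨-elim {dreach O g (α f)} p
            ... | inj₁ s = t≢f (dr-α⁻ O s o) (𝔹ₚ.∨-conicalˡ (dreach O g f) _ q)
            ... | inj₂ s with up-unique u v (trans (𝔹ₚ.∨-conicalʳ (dreach O g f) _ q) (cong not (sym s)))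
            ... | refl = t≢f (dr-refl O f) (𝔹ₚ.∨-conicalˡ (dreach O g f) _ q)
          from-αa : dr O (α a) (α g)
          -- What lies beyond the exit edge is still reachable, so it is `U g` that is left there;
          -- hence the exit edge is `g`, and `α g` has been reached.
          from-αa with cycle-exit (λ z → dreach O (α a) z ∧ U g z) (λ e → cong₂ _∧_ (reach≈ O (α a) e) (U-≈ v e))
                         (∧-intro (dr-refl O (α a)) (proj₂ c))
                             (trans (cong (dreach O (α a) a ∧_) (proj₁ c)) (𝔹ₚ.∧-zeroʳ _))
          ... | f , u , _ , p , q , o with up-unique u v (trans
              (not-t (λ s → t≢f (∧-intro (dr-α⁻ O (∧-fst p) o) s) q))
              (cong not (sym (∧-snd {dreach O (α a) (α f)} p))))
          ... | refl = ∧-fst p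

        -- The edge `g` itself is reversed, but the rest of the directed cycle leads from `g` to
        -- `a`, across `a`, and on to `α g`.
        cycle-forth : dr O g (α g)
        cycle-forth = dr-trans O to-a (dr-trans O ext-forth from-αa)

    -- The tree path from the root down to `y` enters `X` through some `f`. An untoggled `f` reaches
    -- `α f`, directly or around the cycle of a toggled external edge, and then `f` would belong to
    -- `X` as well.
    root-entry : ∀ {X y} → PredClosed O X → X y ≡ true → X h₀ ≡ false →
                 ∃ λ f → Up f × A f ≡ true × U f y ≡ true × X f ≡ false × X (α f) ≡ true
    root-entry {X} {y} pc p q with walk X (pc-≈ pc) y h₀ (trans p (cong not (sym q)))
    ... | f , u , inj₂ (_ , d , _) = ⊥-elim (t≢f d (U-h₀ f))
    ... | f , u , inj₁ (c , _ , e , g) with upCase u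
    ... | toggled Af _ = f , u , Af , c , trans g q , trans e p
    ... | plain _ o = ⊥-elim (t≢f (pc-α pc f o (trans e p)) (trans g q))
    ... | onCycle a _ _ x Aa d = ⊥-elim (t≢f (pc-reach pc (cycle-forth x Aa u d) (trans e p)) (trans g q))

    descend : ∀ {b} → Up b → A b ≡ false → dr O b (α b)
    descend {b} u n with upCase u
    ... | toggled p _ = ⊥-elim (t≢f p n)
    ... | plain _ o = dr-α O (dr-refl O b) o
    ... | onCycle a _ _ x Aa d = cycle-forth x Aa u d

  -- Injectivity of the map from pairs to orientations.

  module Two (T S T' S' O : Vec Bool n) (iv : Interval T S) (φ : IsΦ T S O) (iv' : Interval T' S')
      (φ' : IsΦ T' S' O) where
    module X = Pair T S O iv φ
    module Y = Pair T' S' O iv' φ'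

    -- For the first pair `e` is reversed and lies on a directed cut. If it were untoggled for the
    -- second pair, it would keep its direction or lie on a directed cycle, which no edge of a
    -- directed cut does.
    toggled-up : ∀ {e} → X.Up e → Y.Up e → X.A e ≡ true → Y.A e ≡ true
    toggled-up {e} u v p with Y.upCase v
    ... | Y.toggled q _ = q
    ... | Y.plain _ o = ⊥-elim (t≢f o (trans (X.O-up u) (cong not (X.meets-self p))))
    ... | Y.onCycle a _ _ x q c = ⊥-elim (X.U-blocks u p (Y.cycle-forth x q v c) (X.U-b e) (X.U-αb (X.up< u)))

    toggled-ext : ∀ {e} → X.Ext e → Y.Ext e → X.A e ≡ true → Y.A e ≡ true
    toggled-ext {e} u v p with Y.extCase v
    ... | Y.toggled q _ = q
    ... | Y.plain _ o _ = ⊥-elim (X.O-not-both (X.ext-tail u p) o)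
    ... | Y.onCocycle b _ _ w q (c , d) = ⊥-elim (Y.U-blocks w q (X.ext-back u p) d c)

  -- b is where the tours of T and T' first disagree: it is internal for T, external for T'.
  module Disagree (T S T' S' O : Vec Bool n) (iv : Interval T S) (φ : IsΦ T S O) (iv' : Interval T' S')
      (φ' : IsΦ T' S' O) where
    open Two T S T' S' O iv φ iv' φ'
    module Sw = Two T' S' T S O iv' φ' iv φ

    module _ {b : Fin n} (b∈ : lookup T b ≡ true) (b∉ : lookup T' b ≡ false) (P≡ : X.P b ≡ Y.P b)
      (X⇒ : ∀ x → X.P x < X.P b → Y.P x ≡ X.P x × lookup T x ≡ lookup T' x)
      (Y⇒ : ∀ x → Y.P x < Y.P b → X.P x ≡ Y.P x × lookup T x ≡ lookup T' x) where

      afterX : ∀ {x} → X.P b < X.P x → Y.P b < Y.P x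
      afterX {x} lt with ℕₚ.<-cmp (Y.P b) (Y.P x)
      ... | tri< a _ _ = a
      ... | tri≈ _ e _ = ⊥-elim (ℕₚ.<-irrefl (cong X.P (Y.pos-inj e)) lt)
      ... | tri> _ _ c = ⊥-elim (ℕₚ.<-asym c (subst (Y.P b <_) (proj₁ (Y⇒ x c)) (subst (_< X.P x) P≡ lt)))

      afterY : ∀ {x} → Y.P b < Y.P x → X.P b < X.P x
      afterY {x} lt with ℕₚ.<-cmp (X.P b) (X.P x)
      ... | tri< a _ _ = a
      ... | tri≈ _ e _ = ⊥-elim (ℕₚ.<-irrefl (cong Y.P (X.pos-inj e)) lt)
      ... | tri> _ _ c = ⊥-elim (ℕₚ.<-asym c (subst (X.P b <_) (proj₁ (X⇒ x c)) (subst (_< Y.P x) (sym P≡) lt)))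

      after-neq : ∀ {x} → lookup T x ≢ lookup T' x → x ≢ b → X.P b < X.P x
      after-neq {x} ne nb with ℕₚ.<-cmp (X.P b) (X.P x)
      ... | tri< a _ _ = a
      ... | tri≈ _ e _ = ⊥-elim (nb (sym (X.pos-inj e)))
      ... | tri> _ _ c = ⊥-elim (ne (proj₂ (X⇒ x c)))

      αb∈ : lookup T (α b) ≡ true
      αb∈ = trans (sym (inv X.sub b)) b∈

      αb∉ : lookup T' (α b) ≡ false
      αb∉ = trans (sym (inv Y.sub b)) b∉

      ub : X.Up b
      ub = X.mkUp b∈ (after-neq (λ e → t≢f (trans (sym e) αb∈) αb∉) (λ e → α≢ (sym e)))

      xb : Y.Ext b
      xb = Y.mkExt b∉ (afterX (X.up< ub))

      ≢b : ∀ {f} → lookup T' f ≡ true → f ≢ b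
      ≢b p refl = t≢f p b∉

      ≢αb : ∀ {f} → lookup T' f ≡ true → f ≢ α b
      ≢αb p refl = t≢f p αb∉

      crosses⇒∉ : ∀ {f} → lookup T' f ≡ true → X.U b f ≡ false → X.U b (α f) ≡ true → lookup T f ≡ false
      crosses⇒∉ p q r = not-t (λ s → t≢f r (trans (sym (X.U-tree ub s (≢b p) (≢αb p))) q))

      -- Being after `b` and outside the arc, `f` comes after the whole arc, so `α f` is the first
      -- half-edge. It cannot be toggled, because `b` precedes it on its cycle; unreversed it would
      -- point the other way; and on a toggled cocycle it would be in a directed cut, although `f`
      -- reaches `α f`.
      no-late-exit : ∀ {f} → lookup T f ≡ false → X.P b < X.P f → X.U b f ≡ false → X.U b (α f) ≡ true →
                     lookup O (α f) ≡ true → dr O f (α f) → ⊥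
      no-late-exit {f} f∉ lt p q o d with X.small-or f
      ... | inj₁ sm = t≢f (X.U⁺ lt (ℕₚ.≤-trans (ℕₚ.<⇒≤ sm) (X.U-hi q))) p
      ... | inj₂ sm = go (X.extCase x)
        where
        x : X.Ext (α f)
        x = X.mkExt (trans (sym (inv X.sub f)) f∉) (X.small-α sm)
        go : X.ExtCase (α f) → ⊥
        go (X.toggled Af _) = X.ext-active ub x (X.A-act Af) (q , subst (λ z → X.U b z ≡ false) (sym (α-invol f)) p)
        go (X.plain _ o' _) = X.O-not-both o o'
        go (X.onCocycle c _ _ u Ac (r , s)) = X.U-blocks u Ac d (subst (λ z → X.U c z ≡ false) (α-invol f) s) r

      -- For `T` the arc of `b` is bounded by a directed cut, and `root-entry` finds a toggled edge
      -- `f` of `T'` entering it. As `b` is unreversed for `T'`, it is not in the cocycle of `f`, so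
      -- `b` is also below `f`. Then `f` precedes `b` and belongs to both trees, but `T` has no
      -- other edge across that cut.
      case-tt : X.A b ≡ true → Y.meets b ≡ false → ⊥
      case-tt Ab m with Y.root-entry (X.U-predClosed ub Ab) (X.U-αb (X.up< ub)) (X.U-h₀ b)
      ... | f , v , Af , p , q , r = t≢f (trans (proj₂ (Y⇒ f (Y.U-lo inU))) (Y.up∈ v)) (crosses⇒∉ (Y.up∈ v) q r)
        where
        inU : Y.U f b ≡ true
        inU = not-f (λ s → t≢f (Y.meets-ext xb v Af (Y.≻⇒cross {f} {b} (s , p))) m)

      -- The edge `a` precedes `b`, so it is external and toggled for both pairs. Its cycle for `T'`
      -- must leave the arc of `b` too, by an edge which `no-late-exit` forbids.
      case-cycle : ∀ {a} → X.Ext a → X.A a ≡ true → b X.≻ᵗ a → ⊥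
      case-cycle {a} x Aa c = go (Y.cycle-exit y Aa' (X.U b) (X.U-≈ ub) (proj₂ c) (proj₁ c))
        where
        lt : X.P a < X.P b
        lt = X.≻⇒< ub x c
        y : Y.Ext a
        y = Y.mkExt (trans (sym (proj₂ (X⇒ a lt))) (X.ext∉ x))
              (ℕₚ.<-trans (subst (_< Y.P b) (sym (proj₁ (X⇒ a lt))) (subst (X.P a <_) P≡ lt))
                  (afterX (X.U-lo (proj₂ c))))
        Aa' : Y.A a ≡ true
        Aa' = toggled-ext x y Aa
        go : (∃ λ f → Y.Up f × f Y.≻ᵗ a × X.U b (α f) ≡ true × X.U b f ≡ false × lookup O (α f) ≡ true) → ⊥
        go (f , v , d , p , q , o) = no-late-exit f∉ (after-neq (λ e → t≢f (trans e (Y.up∈ v)) f∉) (≢b (Y.up∈ v)))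
            q p o (Y.cycle-forth y Aa' v d)
          where
          f∉ : lookup T f ≡ false
          f∉ = crosses⇒∉ (Y.up∈ v) q p

      -- The fundamental cycle of `b` for `T'` leads from `α b` to `b` and leaves the arc of `b`
      -- after `b`, as `no-late-exit` forbids.
      case-self : Y.A b ≡ true → ⊥
      case-self Ab with Y.cycle-exit xb Ab (X.U b) (X.U-≈ ub) (X.U-αb (X.up< ub)) (X.U-b b)
      ... | f , v , d , p , q , o = no-late-exit (crosses⇒∉ (Y.up∈ v) q p) (afterY (Y.≻⇒< v xb d)) q p o
          (Y.cycle-forth xb Ab v d)

      -- The edge `c` precedes `b`, so it is toggled for both pairs, and for `T` its arc contains
      -- `α b`. A toggled edge `f` of `T'` enters that arc above `α b`; since `b` points to `α b`,
      -- also `b` is below `f`, so `f` precedes `b` and lies in `T`. Only `c` crosses the cut in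
      -- `T`, while for `T'` the arc of `c` does not contain `α b`.
      case-cocycle : ∀ {c} → lookup O b ≡ true → Y.Up c → Y.A c ≡ true → c Y.≺ᵗ b → ⊥
      case-cocycle {c} o v Ac (p , q) = go (Y.root-entry (X.U-predClosed u Ac') αb∈U (X.U-h₀ c))
        where
        agree : X.P c ≡ Y.P c × lookup T c ≡ lookup T' c
        agree = Y⇒ c (Y.U-lo p)
        αc≢b : α c ≢ b
        αc≢b e = t≢f (trans (sym (inv Y.sub c)) (Y.up∈ v)) (trans (cong (lookup T') e) b∉)
        lt : X.P b < X.P (α c)
        lt = afterY (ℕₚ.≤∧≢⇒< (Y.U-hi p) (λ e → αc≢b (sym (Y.pos-inj e))))
        lt' : X.P c < X.P b
        lt' = subst (_< X.P b) (sym (proj₁ agree)) (subst (Y.P c <_) (sym P≡) (Y.U-lo p))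
        u : X.Up c
        u = X.mkUp (trans (proj₂ agree) (Y.up∈ v)) (ℕₚ.<-trans lt' lt)
        Ac' : X.A c ≡ true
        Ac' = Sw.toggled-up v u Ac
        αb∈U : X.U c (α b) ≡ true
        αb∈U = trans (sym (X.U-tree u b∈ (λ e → ≢b (Y.up∈ v) (sym e)) (λ e → αc≢b (sym e)))) (X.U⁺ lt' (ℕₚ.<⇒≤ lt))
        go : (∃ λ f → Y.Up f × Y.A f ≡ true × Y.U f (α b) ≡ true × X.U c f ≡ false × X.U c (α f) ≡ true) → ⊥
        go (f , w , Af , r , s , z) = t≢f z (trans (sym (X.U-tree u f∈ f≢c f≢αc)) s)
          where
          f∈ : lookup T f ≡ true
          f∈ = trans (proj₂ (Y⇒ f (Y.U-lo (pc-α (Y.U-predClosed w Af) b o r)))) (Y.up∈ w)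
          f≢c : f ≢ c
          f≢c refl = t≢f r q
          f≢αc : f ≢ α c
          f≢αc refl = ℕₚ.<-asym (Y.up< v) (subst (λ z → Y.P (α c) < Y.P z) (α-invol c) (Y.up< w))

      -- Five of the nine pairs of cases give `b` opposite directions; the other four are those
      -- treated above.
      contradiction : ⊥
      contradiction with X.upCase ub | Y.extCase xb
      ... | X.toggled _ o | Y.toggled _ o' = X.O-not-both o' o
      ... | X.toggled Ab _ | Y.plain _ _ m = case-tt Ab m
      ... | X.toggled _ o | Y.onCocycle _ _ o' _ _ _ = X.O-not-both o' o
      ... | X.plain _ _ | Y.toggled Ab _ = case-self Ab
      ... | X.plain _ o | Y.plain _ o' _ = X.O-not-both o o'
      ... | X.plain _ _ | Y.onCocycle c _ o v Ac d = case-cocycle o v Ac d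
      ... | X.onCycle _ _ o _ _ _ | Y.toggled _ o' = X.O-not-both o' o
      ... | X.onCycle a _ _ x Aa c | Y.plain _ _ _ = case-cycle x Aa c
      ... | X.onCycle _ _ o _ _ _ | Y.onCocycle _ _ o' _ _ _ = X.O-not-both o' o

  -- Both tours start at `h₀` and stay together as long as the trees agree on the half-edges
  -- visited, so the first disagreement occurs at the same half-edge and position of both.
  tree-unique : ∀ {T S T' S' O} → Interval T S → IsΦ T S O → Interval T' S' → IsΦ T' S' O → T ≡ T'
  tree-unique {T} {S} {T'} {S'} {O} iv φ iv' φ' with least-failure dec n
    where
    t t' : Fin n → Fin n
    t = motion T
    t' = motion T'
    dec : ∀ k → lookup T (iter t k h₀) ≡ lookup T' (iter t k h₀) ⊎
        (lookup T (iter t k h₀) ≡ lookup T' (iter t k h₀) → ⊥)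
    dec k with lookup T (iter t k h₀) 𝔹ₚ.≟ lookup T' (iter t k h₀)
    ... | yes p = inj₁ p
    ... | no p = inj₂ p
  ... | inj₁ same = vec-ext (λ x → subst (λ z → lookup T z ≡ lookup T' z) (X.iter-pos x) (same (X.P x) (X.pos<n x)))
    where open Two T S T' S' O iv φ iv' φ'
  ... | inj₂ (k , k<n , differ , before) = ⊥-elim (absurd (tf-dec (lookup T b)) (tf-dec (lookup T' b)))
    where
    open Two T S T' S' O iv φ iv' φ'
    b : Fin n
    b = iter (motion T) k h₀
    iters : ∀ j → j ≤ k → iter (motion T) j h₀ ≡ iter (motion T') j h₀
    iters zero _ = refl
    iters (suc j) le = trans (motion-cong {T} {T'} (before j le)) (cong (motion T') (iters j (ℕₚ.<⇒≤ le)))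
    Xb : X.P b ≡ k
    Xb = X.pos-iter k k<n
    Yb : Y.P b ≡ k
    Yb = trans (cong Y.P (iters k ℕₚ.≤-refl)) (Y.pos-iter k k<n)
    Tx : ∀ x j → j < k → iter (motion T) j h₀ ≡ x → lookup T x ≡ lookup T' x
    Tx x j lt refl = before j lt
    X⇒ : ∀ x → X.P x < X.P b → Y.P x ≡ X.P x × lookup T x ≡ lookup T' x
    X⇒ x lt = trans (cong Y.P (trans (sym (X.iter-pos x)) (iters (X.P x) (ℕₚ.<⇒≤ lt'))))
        (Y.pos-iter (X.P x) (X.pos<n x))
            , Tx x (X.P x) lt' (X.iter-pos x)
      where
      lt' : X.P x < k
      lt' = subst (X.P x <_) Xb lt
    Y⇒ : ∀ x → Y.P x < Y.P b → X.P x ≡ Y.P x × lookup T x ≡ lookup T' x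
    Y⇒ x lt = trans (cong X.P (trans (sym (Y.iter-pos x)) (sym (iters (Y.P x) (ℕₚ.<⇒≤ lt')))))
        (X.pos-iter (Y.P x) (Y.pos<n x))
            , Tx x (Y.P x) lt' (trans (iters (Y.P x) (ℕₚ.<⇒≤ lt')) (Y.iter-pos x))
      where
      lt' : Y.P x < k
      lt' = subst (Y.P x <_) Yb lt
    absurd : lookup T b ≡ true ⊎ lookup T b ≡ false → lookup T' b ≡ true ⊎ lookup T' b ≡ false → ⊥
    absurd (inj₁ p) (inj₁ q) = differ (trans p (sym q))
    absurd (inj₂ p) (inj₂ q) = differ (trans p (sym q))
    absurd (inj₁ p) (inj₂ q) = Disagree.contradiction T S T' S' O iv φ iv' φ' p q (trans Xb (sym Yb)) X⇒ Y⇒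
    -- Here `b` is external for `T`, and the two pairs exchange their roles.
    absurd (inj₂ p) (inj₁ q) = Disagree.contradiction T' S' T S O iv' φ' iv φ q p (trans Yb (sym Xb))
      (λ x lt → let a , c = Y⇒ x lt in a , sym c) (λ x lt → let a , c = X⇒ x lt in a , sym c)

  Φ-injective : ∀ {T S T' S' O} → Interval T S → IsΦ T S O → Interval T' S' → IsΦ T' S' O → T ≡ T' × S ≡ S'
  Φ-injective {T} {S} {T'} {S'} {O} iv φ iv' φ' with tree-unique iv φ iv' φ'
  ... | refl = refl , vec-ext same
    where
    module B = Two T S T S' O iv φ iv' φ'
    module B' = Two T S' T S O iv' φ' iv φ
    half≡ : ∀ x → (B.X.Up x → B.Y.Up x) × (B.X.Ext x → B.Y.Ext x)
    half≡ x = (λ u → B.Y.mkUp (B.X.up∈ u) (conv (B.X.up< u))) , (λ u → B.Y.mkExt (B.X.ext∉ u) (conv (B.X.ext< u)))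
      where
      conv : B.X.P x < B.X.P (α x) → B.Y.P x < B.Y.P (α x)
      conv lt = subst₂ _<_ (trans (B.X.P≡pos x) (sym (B.Y.P≡pos x)))
          (trans (B.X.P≡pos (α x)) (sym (B.Y.P≡pos (α x)))) lt
    Aeq : ∀ x → B.X.A x ≡ B.Y.A x
    Aeq x with B.X.half x
    ... | inj₁ (inj₁ u) = bool-ext (B.toggled-up u (proj₁ (half≡ x) u)) (B'.toggled-up (proj₁ (half≡ x) u) u)
    ... | inj₁ (inj₂ u) = trans (B.X.A-inv x) (trans (bool-ext (B.toggled-up u (proj₁ (half≡ (α x)) u))
        (B'.toggled-up (proj₁ (half≡ (α x)) u) u)) (sym (B.Y.A-inv x)))
    ... | inj₂ (inj₁ u) = bool-ext (B.toggled-ext u (proj₂ (half≡ x) u)) (B'.toggled-ext (proj₂ (half≡ x) u) u)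
    ... | inj₂ (inj₂ u) = trans (B.X.A-inv x) (trans (bool-ext (B.toggled-ext u (proj₂ (half≡ (α x)) u))
        (B'.toggled-ext (proj₂ (half≡ (α x)) u) u)) (sym (B.Y.A-inv x)))
    same : ∀ x → lookup S x ≡ lookup S' x
    same x = xor-cancelʳ (lookup T x) (Aeq x)

  -- Every subgraph lies in an interval.

  -- If T and T' agree on all edges having a half-edge of T-position greater than k, then their
  -- tours, traced backwards from h₀, agree on all positions greater than k.
  module Agree (T T' : Vec Bool n) (tree : Tree T) (tree' : Tree T') (k : ℕ) where
    module X = Activity T tree
    module Y = Activity T' tree'

    module _ (agree : ∀ x → k < X.P x → lookup T x ≡ lookup T' x) where

      iters : ∀ d j → d + j ≡ n → k < j → iter X.t j h₀ ≡ iter Y.t j h₀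
      iters zero j e lt rewrite e = trans X.iter-n (sym Y.iter-n)
      iters (suc d) j e lt = motion-inj Y.sub _ _
        (trans (sym (motion-cong {T} {T'} (agree _ (subst (k <_) (sym (X.pos-iter j j<n)) lt))))
               (iters d (suc j) (trans (ℕₚ.+-suc d j) e) (ℕₚ.m<n⇒m<1+n lt)))
        where
        j<n : j < n
        j<n = subst (j <_) e (s≤s (ℕₚ.m≤n+m j d))

      iters′ : ∀ j → j ≤ n → k < j → iter X.t j h₀ ≡ iter Y.t j h₀
      iters′ j le lt = iters (n ∸ j) j (ℕₚ.m∸n+n≡m le) lt

      X⇒Y : ∀ {x} → k < X.P x → Y.P x ≡ X.P x
      X⇒Y {x} lt = trans (cong Y.P (trans (sym (X.iter-pos x)) (iters′ (X.P x) (ℕₚ.<⇒≤ (X.pos<n x)) lt)))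
          (Y.pos-iter (X.P x) (X.pos<n x))

      Y⇒X : ∀ {x} → k < Y.P x → X.P x ≡ Y.P x
      Y⇒X {x} lt = trans (cong X.P (trans (sym (Y.iter-pos x)) (sym (iters′ (Y.P x) (ℕₚ.<⇒≤ (Y.pos<n x)) lt))))
          (X.pos-iter (Y.P x) (Y.pos<n x))

      low : ∀ {x} → lookup T x ≢ lookup T' x → X.P x ≤ k
      low {x} ne = ℕₚ.≮⇒≥ (λ lt → ne (agree x lt))

      agree-α : ∀ x → k < X.P (α x) → lookup T x ≡ lookup T' x
      agree-α x lt = trans (inv X.sub x) (trans (agree (α x) lt) (sym (inv Y.sub x)))

      private
        Y-small : ∀ {s} → k < X.P (α s) → X.P s < X.P (α s) → Y.P s < Y.P (α s)
        Y-small {s} lt sm with ℕₚ.<-≤-connex k (Y.P s)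
        ... | inj₁ l = subst₂ _<_ (Y⇒X l) (sym (X⇒Y lt)) sm
        ... | inj₂ l = ℕₚ.≤-<-trans l (subst (k <_) (sym (X⇒Y lt)) lt)

      module _ {s : Fin n} (u : X.Up s) (lt : k < X.P (α s)) (act : X.Act s ≡ true) where

        private
          v : Y.Up s
          v = Y.mkUp (trans (sym (agree-α s lt)) (X.up∈ u)) (Y-small lt (X.up< u))

          -- A new tree edge has both half-edges at positions at most `k`, before the end `α s` of
          -- the arc. To cross the cut it would have to come before `s`, which the activity of `s`
          -- excludes. Hence `s` determines the same cut in both trees.
          closed : ∀ {f} → lookup T' f ≡ true → f ≢ s → f ≢ α s → X.U s f ≡ X.U s (α f)
          closed {f} f∈ p q with tf-dec (lookup T f)
          ... | inj₁ f∈T = X.U-tree u f∈T p q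
          ... | inj₂ f∉T with X.U s f 𝔹ₚ.≟ X.U s (α f)
          ... | yes e = e
          ... | no ne = ⊥-elim (bad (X.half f))
            where
            f≤ : X.P f ≤ k
            f≤ = low (λ e → t≢f f∈ (trans (sym e) f∉T))
            αf≤ : X.P (α f) ≤ k
            αf≤ = low (λ e → t≢f (trans (sym (inv Y.sub f)) f∈) (trans (sym e) (trans (sym (inv X.sub f)) f∉T)))
            bad-ext : ∀ {h} → X.Ext h → X.P (α h) ≤ k → X.U s h ≡ not (X.U s (α h)) → ⊥
            bad-ext x le c with X.crossing c
            ... | inj₂ d = X.int-active u x act d
            ... | inj₁ (d , e) = t≢f (X.U⁺ (ℕₚ.<-trans (X.U-lo d) (X.ext< x)) (ℕₚ.≤-trans le (ℕₚ.<⇒≤ lt))) e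
            bad : X.Half f → ⊥
            bad (inj₁ (inj₁ w)) = t≢f (X.up∈ w) f∉T
            bad (inj₁ (inj₂ w)) = t≢f (trans (inv X.sub f) (X.up∈ w)) f∉T
            bad (inj₂ (inj₁ x)) = bad-ext x αf≤ (≢⇒≡not ne)
            bad (inj₂ (inj₂ x)) = bad-ext x (subst (λ z → X.P z ≤ k) (sym (α-invol f)) f≤)
              (≢⇒≡not (λ e → ne (sym (trans e (cong (X.U s) (α-invol f))))))

          crossing-is-s : ∀ {f} → Y.Up f → X.U s f ≢ X.U s (α f) → f ≡ s
          crossing-is-s {f} w ne with f Finₚ.≟ s | f Finₚ.≟ α s
          ... | yes p | _ = p
          ... | no _ | yes refl = ⊥-elim (ℕₚ.<-asym (Y.up< v) (subst (λ z → Y.P (α s) < Y.P z) (α-invol s) (Y.up< w)))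
          ... | no p | no q = ⊥-elim (ne (closed (Y.up∈ w) p q))

          sep : ∀ p q → X.U s p ≡ not (X.U s q) → Y.U s p ≡ not (Y.U s q)
          sep p q e with Y.walk (X.U s) (X.U-≈ u) p q e
          ... | f , w , c with crossing-is-s w (boundary c)
            where
            boundary : _ → X.U s f ≡ X.U s (α f) → ⊥
            boundary (inj₁ (_ , _ , a , b)) z = ≡not-irrefl (trans (sym (trans (sym a) (trans (sym z) b))) e)
            boundary (inj₂ (_ , _ , a , b)) z = ≡not-irrefl (trans (sym (trans (sym a) (trans z b))) e)
          ... | refl with c
          ... | inj₁ (a , b , _) = trans a (cong not (sym b))
          ... | inj₂ (a , b , _) = trans a (cong not (sym b))

          same-cut : ∀ z → Y.U s z ≡ X.U s z
          same-cut z with tf-dec (X.U s z)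
          ... | inj₁ p = trans (trans (sep z s (trans p (cong not (sym (X.U-b s))))) (cong not (Y.U-b s))) (sym p)
          ... | inj₂ p = trans (trans (sep z (α s) (trans p (cong not (sym (X.U-αb (X.up< u))))))
              (cong not (Y.U-αb (Y.up< v)))) (sym p)

        -- An edge witnessing inactivity in `T'` crosses the same cut in `T`. Either it already
        -- contradicts the activity of `s` in `T`, or its half-edges are met in opposite orders in
        -- the two tours; but then both positions exceed `k`, where the tours agree.
        up-stays-active : Y.Act s ≡ true
        up-stays-active = not-f bad
          where
          bad : Y.Act s ≡ false → ⊥
          bad i with Y.int-inactive v i
          ... | g , x , c₁ , c₂ = go (X.half g)
            where
            p : X.U s g ≡ false
            p = trans (sym (same-cut g)) c₁
            q : X.U s (α g) ≡ true
            q = trans (sym (same-cut (α g))) c₂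
            inT : lookup T g ≡ true → ⊥
            inT g∈ = t≢f q (trans (sym (X.U-tree u g∈ (λ { refl → t≢f (Y.up∈ v) (Y.ext∉ x) })
                             (λ { refl → t≢f (trans (sym (inv Y.sub s)) (Y.up∈ v)) (Y.ext∉ x) }))) p)
            go : X.Half g → ⊥
            go (inj₁ (inj₁ w)) = inT (X.up∈ w)
            go (inj₁ (inj₂ w)) = inT (trans (inv X.sub g) (X.up∈ w))
            go (inj₂ (inj₁ y)) = X.int-active u y act (p , q)
            go (inj₂ (inj₂ y)) = ℕₚ.<-asym αg<g (subst₂ _<_ (X⇒Y k<g)
                (sym (Y⇒X (ℕₚ.<-trans (subst (k <_) (sym (X⇒Y k<g)) k<g) (Y.ext< x)))) (Y.ext< x))
              where
              αg<g : X.P (α g) < X.P g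
              αg<g = subst (λ z → X.P (α g) < X.P z) (α-invol g) (X.ext< y)
              k<g : k < X.P g
              k<g = ℕₚ.<-trans lt (ℕₚ.≰⇒> (λ le → t≢f (X.U⁺ (ℕₚ.<-trans (X.U-lo q) αg<g) le) p))

      module _ {s : Fin n} (x : X.Ext s) (lt : k < X.P (α s)) (act : X.Act s ≡ true) where

        private
          y : Y.Ext s
          y = Y.mkExt (trans (sym (agree-α s lt)) (X.ext∉ x)) (Y-small lt (X.ext< x))

        -- Let `f` witness inactivity in `T'`. The path of `T` between the ends of `s` crosses the
        -- cut of `f` at some `h`, and activity of `s` in `T` makes `α h` come after position `k`.
        -- So `h` is also an edge of `T'` and must be the edge of `f`, whose arc ends before `α s`.
        ext-stays-active : Y.Act s ≡ true
        ext-stays-active = not-f bad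
          where
          bad : Y.Act s ≡ false → ⊥
          bad i with Y.ext-inactive y i
          ... | f , v , c₁ , c₂ with X.walk (Y.U f) (Y.U-≈ v) s (α s) (Y.≺⇒cross {f} {s} (c₁ , c₂))
          ... | h , w , inj₁ (d₁ , d₂ , _) = X.ext-active w x act (d₁ , d₂)
          ... | h , w , inj₂ (d₁ , d₂ , e₁ , e₂) = go (h Finₚ.≟ f) (h Finₚ.≟ α f)
            where
            s<αf : Y.P (α f) < Y.P (α s)
            s<αf = ℕₚ.≰⇒> (λ le → t≢f (Y.U⁺ (ℕₚ.<-trans (Y.U-lo c₁) (Y.ext< y)) le) c₂)
            k<αh : k < X.P (α h)
            k<αh = ℕₚ.<-≤-trans lt (X.U-hi d₂)
            Yh : Y.P (α s) ≤ Y.P (α h)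
            Yh = subst₂ _≤_ (sym (X⇒Y lt)) (sym (X⇒Y k<αh)) (X.U-hi d₂)
            go : Dec (h ≡ f) → Dec (h ≡ α f) → ⊥
            go (yes refl) _ = ℕₚ.<-irrefl refl (ℕₚ.<-≤-trans s<αf Yh)
            go (no _) (yes refl) = ℕₚ.<-irrefl refl (ℕₚ.<-≤-trans (ℕₚ.<-trans (Y.U-lo c₁) (Y.ext< y))
                (subst (λ z → Y.P (α s) ≤ Y.P z) (α-invol f) Yh))
            go (no p) (no q) = t≢f (trans (trans e₁ c₁) refl)
                (trans (Y.U-tree v (trans (sym (agree-α h k<αh)) (X.up∈ w)) p q) (trans e₂ c₂))

      stays-active : ∀ x → k < X.P x → X.Act x ≡ true → Y.Act x ≡ true
      stays-active x lt a with X.half x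
      ... | inj₁ (inj₁ u) = up-stays-active u (ℕₚ.<-trans lt (X.up< u)) a
      ... | inj₂ (inj₁ u) = ext-stays-active u (ℕₚ.<-trans lt (X.ext< u)) a
      ... | inj₁ (inj₂ u) = trans (sym (Y.Act-α x)) (up-stays-active u
          (subst (λ z → k < X.P z) (sym (α-invol x)) lt) (trans (X.Act-α x) a))
      ... | inj₂ (inj₂ u) = trans (sym (Y.Act-α x)) (ext-stays-active u
          (subst (λ z → k < X.P z) (sym (α-invol x)) lt) (trans (X.Act-α x) a))

      module _ {u : Fin n} (Pu : X.P u ≡ k) (flip : lookup T' u ≡ not (lookup T u)) where

        -- Exactly one of the trees contains the edge of `u`, so `T` sends `u` where `T'` sends
        -- `α u`. The tours coincide at position `k + 1`, hence the new one has `α u` at position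
        -- `k`.
        at-k : ∀ {x} → Y.P x ≡ k → x ≡ α u
        at-k {x} e = motion-inj Y.sub x (α u) (trans (cong Y.t
            (trans (sym (Y.iter-pos x)) (cong (λ j → iter Y.t j h₀) e)))
          (trans (sym (iters′ (suc k) k<n (ℕₚ.n<1+n k))) (trans
              (cong X.t (trans (cong (λ j → iter X.t j h₀) (sym Pu)) (X.iter-pos u))) swap)))
          where
          k<n : k < n
          k<n = subst (_< n) Pu (X.pos<n u)
          swap : X.t u ≡ Y.t (α u)
          swap with tf-dec (lookup T u)
          ... | inj₁ p = trans (motion-in {T} p) (sym (motion-out {T'}
              (trans (sym (inv Y.sub u)) (trans flip (cong not p)))))
          ... | inj₂ p = trans (motion-out {T} p) (sym (trans
              (motion-in {T'} (trans (sym (inv Y.sub u)) (trans flip (cong not p)))) (cong σf (α-invol u))))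

  module _ (S : Vec Bool n) (subS : Sub S) where

    -- The invariant of the backward reading: it is vacuous at `k = n`, and at `k = 0` it says that
    -- `S` lies in the interval of `T`.
    Good : (T : Vec Bool n) → Tree T → ℕ → Set
    Good T tree k = ∀ x → lookup S x xor lookup T x ≡ true → k ≤ Activity.P T tree x → Activity.Act T tree x ≡ true

    -- Beyond position `k` activities persist, and at position `k` the new tour has `α u`, on whose
    -- edge the new tree agrees with `S`.
    exchange : ∀ {T} (tree : Tree T) {T'} (tree' : Tree T') k u → Activity.P T tree u ≡ k →
      lookup T' u ≡ not (lookup T u) → lookup S u xor lookup T u ≡ true →
          (∀ x → k < Activity.P T tree x → lookup T x ≡ lookup T' x) →
      Good T tree (suc k) → Good T' tree' k
    exchange {T} tree {T'} tree' k u Pu flip diff agree good x Ax le with ℕₚ.m≤n⇒m<n∨m≡n le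
    ... | inj₁ lt = G.stays-active agree x k<x (good x (trans (cong (lookup S x xor_) (agree x k<x)) Ax) k<x)
      where
      module G = Agree T T' tree tree' k
      k<x : k < Activity.P T tree x
      k<x = subst (k <_) (sym (G.Y⇒X agree lt)) lt
    ... | inj₂ e = ⊥-elim (t≢f (subst (λ z → lookup S z xor lookup T' z ≡ true) (G.at-k agree Pu flip (sym e)) Ax)
                     (trans (cong₂ _xor_ (sym (inv subS u)) (trans (sym (inv (tree-sub tree') u)) flip))
                         (fix {lookup S u} {lookup T u} diff)))
      where
      module G = Agree T T' tree tree' k
      fix : ∀ {a b} → a xor b ≡ true → a xor not b ≡ false
      fix {true} {false} _ = refl
      fix {false} {true} _ = refl

    improve : ∀ {T} (tree : Tree T) k → k < n → Good T tree (suc k) → ∃ λ T' → Σ (Tree T') λ tree' → Good T' tree' k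
    improve {T} tree k k<n good = go (tf-dec (A u)) (tf-dec (X.Act u))
      where
      module X = Activity T tree
      A : Fin n → Bool
      A x = lookup S x xor lookup T x
      u : Fin n
      u = iter X.t k h₀
      Pu : X.P u ≡ k
      Pu = X.pos-iter k k<n
      keep : (A u ≡ true → X.Act u ≡ true) → Good T tree k
      keep h x Ax le with ℕₚ.m≤n⇒m<n∨m≡n le
      ... | inj₁ lt = good x Ax lt
      ... | inj₂ e with X.pos-inj (trans Pu e)
      ... | refl = h Ax
      go : A u ≡ true ⊎ A u ≡ false → X.Act u ≡ true ⊎ X.Act u ≡ false → ∃ λ T' → Σ (Tree T') λ tree' → Good T'
          tree' k
      go (inj₂ p) _ = T , tree , keep (λ q → ⊥-elim (t≢f q p))
      go (inj₁ _) (inj₁ q) = T , tree , keep (λ _ → q)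
      go (inj₁ p) (inj₂ q) with ℕₚ.<-cmp (X.P (α u)) k
      ... | tri≈ _ e _ = ⊥-elim (α≢ (X.pos-inj (trans Pu (sym e))))
      -- If `α u` came after `u`, the invariant would already have made this edge active.
      ... | tri> _ _ c = ⊥-elim (t≢f (trans (sym (X.Act-α u))
          (good (α u) (trans (sym (cong₂ _xor_ (inv subS u) (inv X.sub u))) p) c)) q)
      ... | tri< lt _ _ = swap (tf-dec (lookup T u))
        where
        sm : X.P (α u) < X.P (α (α u))
        sm = subst₂ _<_ refl (trans (sym Pu) (cong X.P (sym (α-invol u)))) lt
        inact : X.Act (α u) ≡ false
        inact = trans (X.Act-α u) q
        notEdge : ∀ {x e} → k < X.P x → X.P e ≤ k → X.P (α e) ≤ k → sameEdge x e ≡ false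
        notEdge {x} {e} l p q = sameEdge-no {x} {e} (λ { refl → ℕₚ.<-irrefl refl (ℕₚ.<-≤-trans l p) })
            (λ { refl → ℕₚ.<-irrefl refl (ℕₚ.<-≤-trans l q) })
        u-edge : ∀ {x} → k < X.P x → sameEdge x (α u) ≡ false
        u-edge l = notEdge l (ℕₚ.<⇒≤ lt) (ℕₚ.≤-reflexive (trans (cong X.P (α-invol u)) Pu))
        u∈edge : sameEdge u (α u) ≡ true
        u∈edge = trans (sameEdge-inv₂ u u) (sameEdge-refl u)
        swap : lookup T u ≡ true ⊎ lookup T u ≡ false → ∃ λ T' → Σ (Tree T') λ tree' → Good T' tree' k
        swap (inj₁ u∈) with X.int-inactive (X.mkUp (trans (sym (inv X.sub u)) u∈) sm) inact
        ... | g , x , c = T' , tree' , exchange tree tree' k u Pu flip p agree good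
          where
          up : X.Up (α u)
          up = X.mkUp (trans (sym (inv X.sub u)) u∈) sm
          T' : Vec Bool n
          T' = removeAdd T (α u) g
          tree' : Tree T'
          tree' = X.coc⇒ (X.cocycle⇐ up (X.≻⇒cross {α u} {g} c))
          -- `α g` lies in the arc that starts after `α u` and ends at `u`, so the exchange changes
          -- nothing beyond position `k`.
          αg≤ : X.P (α g) ≤ k
          αg≤ = subst (X.P (α g) ≤_) (trans (cong X.P (α-invol u)) Pu) (X.U-hi (proj₂ c))
          g≤ : X.P g ≤ k
          g≤ = ℕₚ.≤-trans (ℕₚ.<⇒≤ (X.ext< x)) αg≤
          u∉g : sameEdge u g ≡ false
          u∉g = sameEdge-no (λ { e → t≢f u∈ (trans (cong (lookup T) e) (X.ext∉ x)) })
                            (λ { e → t≢f u∈ (trans (cong (lookup T) e) (trans (sym (inv X.sub g)) (X.ext∉ x))) })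
          flip : lookup T' u ≡ not (lookup T u)
          flip rewrite lookup-removeAdd T (α u) g u | u∈edge | u∉g | u∈ = refl
          agree : ∀ x → k < X.P x → lookup T x ≡ lookup T' x
          agree x l rewrite lookup-removeAdd T (α u) g x | u-edge {x} l | notEdge {x} {g} l g≤ αg≤ =
            sym (trans (𝔹ₚ.∨-identityʳ _) (𝔹ₚ.∧-identityʳ _))
        swap (inj₂ u∉) with X.ext-inactive (X.mkExt (trans (sym (inv X.sub u)) u∉) sm) inact
        ... | f , v , c₁ , c₂ = T' , tree' , exchange tree tree' k u Pu flip p agree good
          where
          ex : X.Ext (α u)
          ex = X.mkExt (trans (sym (inv X.sub u)) u∉) sm
          T' : Vec Bool n
          T' = addRemove T (α u) f
          tree' : Tree T'
          tree' = X.cyc⇒ (X.cycle⇐ (X.ext∉ ex) (X.up∈ v) (X.cocycle⇐ v (X.≺⇒cross {f} {α u} (c₁ , c₂))))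
          -- The arc of `f` contains `α u` but not the later `u`, so it ends before `u`.
          αf≤ : X.P (α f) ≤ k
          αf≤ = ℕₚ.<⇒≤ (ℕₚ.≰⇒> (λ le → t≢f (X.U⁺ (ℕₚ.<-trans (X.U-lo c₁) sm)
              (subst (_≤ X.P (α f)) (trans (sym Pu) (cong X.P (sym (α-invol u)))) le)) c₂))
          f≤ : X.P f ≤ k
          f≤ = ℕₚ.≤-trans (ℕₚ.<⇒≤ (X.up< v)) αf≤
          u∉f : sameEdge u f ≡ false
          u∉f = sameEdge-no (λ { e → t≢f (X.up∈ v) (trans (cong (lookup T) (sym e)) u∉) })
                            (λ { e → t≢f (trans (sym (inv X.sub f)) (X.up∈ v)) (trans (cong (lookup T) (sym e)) u∉) })
          flip : lookup T' u ≡ not (lookup T u)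
          flip rewrite lookup-addRemove T (α u) f u | u∈edge | u∉f | u∉ = refl
          agree : ∀ x → k < X.P x → lookup T x ≡ lookup T' x
          agree x l rewrite lookup-addRemove T (α u) f x | u-edge {x} l | notEdge {x} {f} l f≤ αf≤ =
            sym (trans (𝔹ₚ.∧-identityʳ _) (𝔹ₚ.∨-identityʳ _))

    good-tree : ∀ d k → d + k ≡ n → ∃ λ T → Σ (Tree T) λ tree → Good T tree k
    good-tree zero k refl = let T , tree = spanning-tree in
      T , tree , (λ x _ le → ⊥-elim (ℕₚ.<-irrefl refl (ℕₚ.<-≤-trans (Activity.pos<n T tree x) le)))
    good-tree (suc d) k e with good-tree d (suc k) (trans (ℕₚ.+-suc d k) e)
    ... | T , tree , good = improve tree k (subst (k <_) e (s≤s (ℕₚ.m≤n+m k d))) good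

    in-some-interval : ∃ λ T → Interval T S
    in-some-interval with good-tree n 0 (ℕₚ.+-identityʳ n)
    ... | T , tree , good = T , record { itree = tree ; isub = subS ; iact = λ h p → trans
        (sym (Activity.Act≡ T tree h)) (good h p z≤n) }

  -- Components and nullity of a subgraph in an interval.

  -- the number of edges satisfying an α-invariant predicate
  ecount : (Fin n → Bool) → ℕ
  ecount p = count (λ h → p h ∧ canon h) H

  ecount-0⁻ : ∀ p → (∀ h → p h ≡ p (α h)) → ecount p ≡ 0 → ∀ h → p h ≡ false
  ecount-0⁻ p pα e h with canon-or h
  ... | inj₁ c = not-t (λ q → t≢f (∧-intro q c) (count-0 _ e (∈-allFin h)))
  ... | inj₂ c = not-t (λ q → t≢f (∧-intro (trans (sym (pα h)) q) c) (count-0 _ e (∈-allFin (α h))))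

  ecount-0⁺ : ∀ p → (∀ h → p h ≡ false) → ecount p ≡ 0
  ecount-0⁺ p none = count-none _ H (λ x _ → cong (_∧ canon x) (none x))

  private
    -- Any rule selecting one half-edge per edge gives the same count: the map sends the half-edge
    -- selected by `ρ₁` to the one selected by `ρ₂`.
    half-≤ : ∀ (p : Fin n → Bool) (ρ₁ ρ₂ : Fin n → ℕ) → (∀ h → p h ≡ p (α h)) →
        (∀ h → ρ₂ h < ρ₂ (α h) ⊎ ρ₂ (α h) < ρ₂ h) →
             count (λ h → p h ∧ (ρ₁ h <ᵇ ρ₁ (α h))) H ≤ count (λ h → p h ∧ (ρ₂ h <ᵇ ρ₂ (α h))) H
    half-≤ p ρ₁ ρ₂ pα tot = count-injection f _ _ uniqueF maps (λ x _ → ∈-allFin (f x)) inj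
      where
      f : Fin n → Fin n
      f h = if ρ₂ h <ᵇ ρ₂ (α h) then h else α h
      f-cases : ∀ h → (f h ≡ h × ρ₂ h < ρ₂ (α h)) ⊎ (f h ≡ α h × ρ₂ (α h) < ρ₂ h)
      f-cases h with tot h
      ... | inj₁ lt = inj₁ (cong (λ b → if b then h else α h) (<ᵇ-t lt) , lt)
      ... | inj₂ gt = inj₂ (cong (λ b → if b then h else α h) (<ᵇ-f (ℕₚ.<⇒≤ gt)) , gt)
      maps : ∀ h → p h ∧ (ρ₁ h <ᵇ ρ₁ (α h)) ≡ true → p (f h) ∧ (ρ₂ (f h) <ᵇ ρ₂ (α (f h))) ≡ true
      maps h q with f-cases h
      ... | inj₁ (e , lt) rewrite e = ∧-intro (∧-fst q) (<ᵇ-t lt)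
      ... | inj₂ (e , gt) rewrite e | α-invol h = ∧-intro (trans (sym (pα h)) (∧-fst q)) (<ᵇ-t gt)
      clash : ∀ {x y} → p x ∧ (ρ₁ x <ᵇ ρ₁ (α x)) ≡ true → p y ∧ (ρ₁ y <ᵇ ρ₁ (α y)) ≡ true → x ≡ α y → ⊥
      clash {x} {y} q r refl = ℕₚ.<-asym (<ᵇ-⇒ (∧-snd {p y} r))
          (subst (λ z → ρ₁ (α y) < ρ₁ z) (α-invol y) (<ᵇ-⇒ (∧-snd {p (α y)} q)))
      inj : ∀ x y → p x ∧ (ρ₁ x <ᵇ ρ₁ (α x)) ≡ true → p y ∧ (ρ₁ y <ᵇ ρ₁ (α y)) ≡ true → f x ≡ f y → x ≡ y
      inj x y q r e with f-cases x | f-cases y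
      ... | inj₁ (a , _) | inj₁ (b , _) = trans (sym a) (trans e b)
      ... | inj₁ (a , _) | inj₂ (b , _) = ⊥-elim (clash q r (trans (sym a) (trans e b)))
      ... | inj₂ (a , _) | inj₁ (b , _) = ⊥-elim (clash r q (trans (sym b) (trans (sym e) a)))
      ... | inj₂ (a , _) | inj₂ (b , _) = α-inj (trans (sym a) (trans e b))

  ecount-via : ∀ (p : Fin n → Bool) (ρ : Fin n → ℕ) → (∀ h → p h ≡ p (α h)) → (∀ h → ρ h < ρ (α h) ⊎ ρ (α h) < ρ h) →
               ecount p ≡ count (λ h → p h ∧ (ρ h <ᵇ ρ (α h))) H
  ecount-via p ρ pα tot = ℕₚ.≤-antisym (half-≤ p toℕ ρ pα tot) (half-≤ p ρ toℕ pα totℕ)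
    where
    totℕ : ∀ h → toℕ h < toℕ (α h) ⊎ toℕ (α h) < toℕ h
    totℕ h with ℕₚ.<-cmp (toℕ h) (toℕ (α h))
    ... | tri< a _ _ = inj₁ a
    ... | tri≈ _ b _ = ⊥-elim (α≢ (Finₚ.toℕ-injective b))
    ... | tri> _ _ c = inj₂ c

  toggledInt toggledExt : Vec Bool n → Vec Bool n → Fin n → Bool
  toggledInt T S h = lookup T h ∧ (lookup S h xor lookup T h)
  toggledExt T S h = not (lookup T h) ∧ (lookup S h xor lookup T h)

  activeInt activeExt : Vec Bool n → Fin n → Bool
  activeInt T h = lookup T h ∧ active T h
  activeExt T h = not (lookup T h) ∧ active T h

  module PairComponents (T S O : Vec Bool n) (iv : Interval T S) (ΦO : IsΦ T S O) where
    open Pair T S O iv ΦO public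

    toggledInt-inv : ∀ h → toggledInt T S h ≡ toggledInt T S (α h)
    toggledInt-inv h = cong₂ _∧_ (inv sub h) (A-inv h)

    toggledExt-inv : ∀ h → toggledExt T S h ≡ toggledExt T S (α h)
    toggledExt-inv h = cong₂ (λ a b → not a ∧ b) (inv sub h) (A-inv h)

    activeInt-inv : ∀ h → activeInt T h ≡ activeInt T (α h)
    activeInt-inv h = cong₂ _∧_ (inv sub h) (sym (active-α sub h))

    activeExt-inv : ∀ h → activeExt T h ≡ activeExt T (α h)
    activeExt-inv h = cong₂ (λ a b → not a ∧ b) (inv sub h) (sym (active-α sub h))

    NoInt : Set
    NoInt = ∀ {b} → Up b → A b ≡ false

    NoExt : Set
    NoExt = ∀ {e} → Ext e → A e ≡ false

    noInt⇒ : ecount (toggledInt T S) ≡ 0 → NoInt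
    noInt⇒ e {b} u = not-t (λ p → t≢f (∧-intro (up∈ u) p) (ecount-0⁻ _ toggledInt-inv e b))

    noInt⇐ : NoInt → ecount (toggledInt T S) ≡ 0
    noInt⇐ none = ecount-0⁺ _ (λ h → not-t (λ p → bad h p (half h)))
      where
      bad : ∀ h → toggledInt T S h ≡ true → Half h → ⊥
      bad h p (inj₁ (inj₁ u)) = t≢f (∧-snd {lookup T h} p) (none u)
      bad h p (inj₁ (inj₂ u)) = t≢f (trans (sym (A-inv h)) (∧-snd {lookup T h} p)) (none u)
      bad h p (inj₂ (inj₁ x)) = t≢f (∧-fst p) (ext∉ x)
      bad h p (inj₂ (inj₂ x)) = t≢f (trans (sym (inv sub h)) (∧-fst p)) (ext∉ x)

    noExt⇒ : ecount (toggledExt T S) ≡ 0 → NoExt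
    noExt⇒ e {b} x = not-t (λ p → t≢f (∧-intro (not-≡t (ext∉ x)) p) (ecount-0⁻ _ toggledExt-inv e b))

    noExt⇐ : NoExt → ecount (toggledExt T S) ≡ 0
    noExt⇐ none = ecount-0⁺ _ (λ h → not-t (λ p → bad h p (half h)))
      where
      bad : ∀ h → toggledExt T S h ≡ true → Half h → ⊥
      bad h p (inj₂ (inj₁ u)) = t≢f (∧-snd {not (lookup T h)} p) (none u)
      bad h p (inj₂ (inj₂ u)) = t≢f (trans (sym (A-inv h)) (∧-snd {not (lookup T h)} p)) (none u)
      bad h p (inj₁ (inj₁ x)) = t≢f (up∈ x) (not-≡f (∧-fst p))
      bad h p (inj₁ (inj₂ x)) = t≢f (up∈ x) (trans (sym (inv sub h)) (not-≡f (∧-fst p)))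

    noActExt⇒ : ecount (activeExt T) ≡ 0 → ∀ {e} → Ext e → Act e ≡ false
    noActExt⇒ e {b} x = not-t (λ p → t≢f (∧-intro (not-≡t (ext∉ x)) (trans (sym (Act≡ b)) p))
        (ecount-0⁻ _ activeExt-inv e b))

    noActExt⇐ : (∀ {e} → Ext e → Act e ≡ false) → ecount (activeExt T) ≡ 0
    noActExt⇐ none = ecount-0⁺ _ (λ h → not-t (λ p → bad h p (half h)))
      where
      bad : ∀ h → activeExt T h ≡ true → Half h → ⊥
      bad h p (inj₂ (inj₁ u)) = t≢f (trans (Act≡ h) (∧-snd {not (lookup T h)} p)) (none u)
      bad h p (inj₂ (inj₂ u)) = t≢f (trans (Act-α h) (trans (Act≡ h) (∧-snd {not (lookup T h)} p))) (none u)
      bad h p (inj₁ (inj₁ x)) = t≢f (up∈ x) (not-≡f (∧-fst p))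
      bad h p (inj₁ (inj₂ x)) = t≢f (up∈ x) (trans (sym (inv sub h)) (not-≡f (∧-fst p)))

    -- Every half-edge is reached, by a relation that follows untoggled tree edges downwards,
    -- from the root or from the lower end of the last toggled tree edge above it.
    module Tops (R : Fin n → Fin n → Set) (R-refl : ∀ x → R x x) (R-≈ : ∀ {u x y} → R u x → x ≈ y → R u y)
      (R-down : ∀ {u b} → R u b → Up b → A b ≡ false → R u (α b)) where

      Top : Fin n → Set
      Top x = R h₀ x ⊎ ∃ λ b → Up b × A b ≡ true × U b x ≡ true × R (α b) x

      top-≈ : ∀ {x y} → Top x → x ≈ y → Top y
      top-≈ (inj₁ r) v = inj₁ (R-≈ r v)
      top-≈ (inj₂ (b , u , p , q , r)) v = inj₂ (b , u , p , trans (sym (U-≈ u v)) q , R-≈ r v)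

      top : ∀ x → Top x
      top x = go (P x) x ℕₚ.≤-refl
        where
        go : ∀ m x → P x ≤ m → Top x
        go zero x le = inj₁ (subst (R h₀) (pos-inj (trans pos-h₀ (sym (ℕₚ.n≤0⇒n≡0 le)))) (R-refl h₀))
        go (suc m) x le with ℕₚ.m≤n⇒m<n∨m≡n le
        ... | inj₁ lt = go m x (ℕₚ.≤-pred lt)
        ... | inj₂ e with pos-pred x m e
        ... | w , pw , tw with lookup T w in w∈
        ... | false = top-≈ (go m w (ℕₚ.≤-reflexive pw)) (subst (w ≈_) tw (≈σ w))
        ... | true with small-or w
        ... | inj₂ gt = top-≈ (go m (α w) (ℕₚ.≤-trans (ℕₚ.<⇒≤ gt) (ℕₚ.≤-reflexive pw))) (subst (α w ≈_) tw (≈σ (α w)))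
        ... | inj₁ lt with tf-dec (A w)
        ... | inj₁ Aw = top-≈ (inj₂ (w , mkUp w∈ lt , Aw , U-αb lt , R-refl (α w))) (subst (α w ≈_) tw (≈σ (α w)))
        ... | inj₂ Aw = top-≈ (down (go m w (ℕₚ.≤-reflexive pw))) (subst (α w ≈_) tw (≈σ (α w)))
          where
          uw : Up w
          uw = mkUp w∈ lt
          down : Top w → Top (α w)
          down (inj₁ r) = inj₁ (R-down r uw Aw)
          down (inj₂ (b , u , p , q , r)) = inj₂ (b , u , p , trans (sym (U-tree u w∈ (λ { refl → t≢f p Aw })
            (λ { refl → t≢f p (trans (A-inv b) Aw) }))) q , R-down r uw Aw)

    αtop-out : ∀ {b c} → Up b → Up c → P b < P c → U c (α b) ≡ false
    αtop-out {b} {c} u v lt = trans (sym (U-tree v (up∈ u) (λ { refl → ℕₚ.<-irrefl refl lt })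
      (λ { refl → ℕₚ.<-asym lt (up< v) }))) (U-before (ℕₚ.<⇒≤ lt))

    S-tree : ∀ {b} → Up b → A b ≡ false → lookup S b ≡ true
    S-tree {b} u p with lookup S b | lookup T b | up∈ u
    ... | true | true | _ = refl

    -- The tree edge `b` across the cut has been removed. An external edge of `S` is toggled and
    -- hence active, so neither order of crossing the active `b` is possible.
    S-closed : ∀ {b} → Up b → A b ≡ true → ∀ y → lookup S y ≡ true → U b y ≡ U b (α y)
    S-closed {b} u Ab y y∈ with U b y 𝔹ₚ.≟ U b (α y)
    ... | yes e = e
    ... | no ne = ⊥-elim (bad (half y))
      where
      Sb : lookup S b ≡ false
      Sb with lookup S b | lookup T b | up∈ u
      ... | false | true | _ = refl
      tr : lookup T y ≡ true → ⊥
      tr p = ne (U-tree u p (λ { refl → t≢f y∈ Sb }) (λ { refl → t≢f (trans (inv subS b) y∈) Sb }))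
      ext : ∀ {e} → Ext e → lookup S e ≡ true → U b e ≡ not (U b (α e)) → ⊥
      ext {e} x p c with crossing c
      ... | inj₁ d = ext-active u x (A-act (cong₂ _xor_ p (ext∉ x))) d
      ... | inj₂ d = int-active u x (A-act Ab) d
      bad : Half y → ⊥
      bad (inj₁ (inj₁ v)) = tr (up∈ v)
      bad (inj₁ (inj₂ v)) = tr (trans (inv sub y) (up∈ v))
      bad (inj₂ (inj₁ x)) = ext x y∈ (≢⇒≡not ne)
      bad (inj₂ (inj₂ x)) = ext x (trans (sym (inv subS y)) y∈)
          (≢⇒≡not (λ e → ne (sym (trans e (cong (U b) (α-invol y))))))

    S-blocks : ∀ {b} → Up b → A b ≡ true → ∀ {x y} → conn S x y ≡ true → U b x ≡ U b y
    S-blocks {b} u Ab {x} = conn-ind S (λ y → U b x ≡ U b y) refl (λ y z e v → trans e (U-≈ u v))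
        (λ y e p → trans e (S-closed u Ab y p))

    cutMark : Fin n → Bool
    cutMark h = toggledInt T S h ∧ (P h <ᵇ P (α h))

    cutMark⇒ : ∀ {h} → cutMark h ≡ true → Up h × A h ≡ true
    cutMark⇒ {h} p = mkUp (∧-fst (∧-fst p)) (<ᵇ-⇒ (∧-snd {toggledInt T S h} p)) , ∧-snd {lookup T h} (∧-fst p)

    ⇒cutMark : ∀ {h} → Up h → A h ≡ true → cutMark h ≡ true
    ⇒cutMark u p = ∧-intro (∧-intro (up∈ u) p) (<ᵇ-t (up< u))

    count-cutMark : ecount (toggledInt T S) ≡ count cutMark H
    count-cutMark = ecount-via (toggledInt T S) P toggledInt-inv small-or

    -- The root and the lower ends of the toggled tree edges represent the components. They cover by
    -- `Tops`, and of two of them the one later in the tour is cut off from the other by its own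
    -- arc.
    numComp-S : numComp S ≡ suc (ecount (toggledInt T S))
    numComp-S = trans (ℕₚ.≤-antisym (CC.classes-≤ S subS L cover) (CC.classes-≥ S subS L indep))
      (cong suc (trans (Listₚ.length-map α marks) (sym count-cutMark)))
      where
      marks L : List (Fin n)
      marks = filterᵇ cutMark H
      L = h₀ ∷ map α marks
      module C = Tops (λ u x → conn S u x ≡ true) (conn-refl S) (conn-≈ S) (λ r u p → conn-α S r (S-tree u p))
      cover : ∀ x → ∃ λ m → m ∈ L × conn S m x ≡ true
      cover x with C.top x
      ... | inj₁ r = h₀ , here refl , r
      ... | inj₂ (b , u , p , _ , r) = α b , there (∈-map⁺ α (∈-filterᵇ⁺ cutMark (∈-allFin b) (⇒cutMark u p))) , r
      sep : ∀ {b c} → Up b → Up c → A c ≡ true → P b < P c → conn S (α b) (α c) ≡ true → ⊥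
      sep u v p lt r = t≢f (trans (S-blocks v p r) (U-αb (up< v))) (αtop-out u v lt)
      indep : AllPairs (λ x y → conn S x y ≡ true → ⊥) L
      indep = Allₚ.map⁺ (All.tabulate (λ {b} i r → let u , p = cutMark⇒ (proj₂ (∈-filterᵇ⁻ cutMark {H} i)) in
                t≢f (trans (S-blocks u p r) (U-αb (up< u))) (U-h₀ b)))
            ∷ AllPairsₚ.map⁺ (∈⇒AllPairs (unique-filterᵇ cutMark uniqueF) (λ b c i j ne r →
                pair b c (cutMark⇒ (proj₂ (∈-filterᵇ⁻ cutMark {H} i)))
                    (cutMark⇒ (proj₂ (∈-filterᵇ⁻ cutMark {H} j))) ne r))
        where
        pair : ∀ b c → Up b × A b ≡ true → Up c × A c ≡ true → b ≢ c → conn S (α b) (α c) ≡ true → ⊥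
        pair b c (u , p) (v , q) ne r with ℕₚ.<-cmp (P b) (P c)
        ... | tri< lt _ _ = sep u v q lt r
        ... | tri≈ _ e _ = ne (pos-inj e)
        ... | tri> _ _ gt = sep v u p gt (conn-sym S subS r)

    numE-S : numE S + ecount (toggledInt T S) ≡ numE T + ecount (toggledExt T S)
    numE-S = count-balance _ _ _ _ H (λ x _ → pt (lookup S x) (lookup T x) (canon x))
      where
      pt : ∀ s t c → 𝟙 (s ∧ c) + 𝟙 ((t ∧ (s xor t)) ∧ c) ≡ 𝟙 (t ∧ c) + 𝟙 ((not t ∧ (s xor t)) ∧ c)
      pt true true true = refl
      pt true true false = refl
      pt true false true = refl
      pt true false false = refl
      pt false true true = refl
      pt false true false = refl
      pt false false true = refl
      pt false false false = refl

    nullity-S : numE S + numComp S ∸ numV ≡ ecount (toggledExt T S)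
    nullity-S = begin
      numE S + numComp S ∸ numV                            ≡⟨ cong₂ (λ a b → numE S + a ∸ b) numComp-S
          (sym (tree-size (itree iv))) ⟩
      numE S + suc i ∸ (numE T + 1)                        ≡⟨ cong (_∸ (numE T + 1)) (ℕₚ.+-suc (numE S) i) ⟩
      suc (numE S + i) ∸ (numE T + 1)                      ≡⟨ cong (λ a → suc a ∸ (numE T + 1)) numE-S ⟩
      suc (numE T + e) ∸ (numE T + 1)                      ≡⟨ cong (suc (numE T + e) ∸_) (ℕₚ.+-comm (numE T) 1) ⟩
      numE T + e ∸ numE T                                  ≡⟨ ℕₚ.m+n∸m≡n (numE T) e ⟩
      e                                                    ∎
      where
      open ≡-Reasoning
      i e : ℕ
      i = ecount (toggledInt T S)
      e = ecount (toggledExt T S)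

    module D = Tops (dr O) (dr-refl O) (dr-≈ O) (λ r u p → dr-trans O r (descend u p))

    v0Connected⇒ : v0Connected O ≡ true → NoInt
    v0Connected⇒ c {b} u = not-t (λ p → U-blocks u p (trans (dreach≡ O h₀ (α b)) (allF _ c (α b))) (U-h₀ b)
        (U-αb (up< u)))

    v0Connected⇐ : NoInt → v0Connected O ≡ true
    v0Connected⇐ none = allF⁺ _ (λ x → trans (sym (dreach≡ O h₀ x)) (go (D.top x)))
      where
      go : ∀ {x} → D.Top x → dr O h₀ x
      go (inj₁ r) = r
      go (inj₂ (b , u , p , _)) = ⊥-elim (t≢f p (none u))

  -- The growth procedure behind root-components and root-strong-components.

  firstCrossing-spec : ∀ W hs → (firstCrossing W hs ≡ [] × (∀ h → h ∈ hs → W h ≡ true → W (α h) ≡ true))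
                     ⊎ (∃ λ h → firstCrossing W hs ≡ h ∷ [] × W h ≡ true × W (α h) ≡ false)
  firstCrossing-spec W [] = inj₁ (refl , λ h ())
  firstCrossing-spec W (h ∷ hs) with W h in p | W (α h) in q
  ... | true | false = inj₂ (h , refl , p , q)
  ... | true | true with firstCrossing-spec W hs
  ... | inj₂ r = inj₂ r
  ... | inj₁ (e , c) = inj₁ (e , λ { x (here refl) _ → q ; x (there i) → c x i })
  firstCrossing-spec W (h ∷ hs) | false | _ with firstCrossing-spec W hs
  ... | inj₂ r = inj₂ r
  ... | inj₁ (e , c) = inj₁ (e , λ { x (here refl) r → ⊥-elim (t≢f r p) ; x (there i) → c x i })

  minCrossing-spec : ∀ T W hs best → W best ≡ true → W (α best) ≡ false → let m = minCrossing T W hs best in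
    W m ≡ true × W (α m) ≡ false × edgeRank T m ≤ edgeRank T best ×
    (∀ h → h ∈ hs → W h ≡ true → W (α h) ≡ false → edgeRank T m ≤ edgeRank T h)
  minCrossing-spec T W [] best p q = p , q , ℕₚ.≤-refl , λ h ()
  minCrossing-spec T W (h ∷ hs) best p q with (W h ∧ not (W (α h))) ∧ (edgeRank T h <ᵇ edgeRank T best) in e
  ... | true with minCrossing-spec T W hs h (∧-fst (∧-fst e)) (not-≡f (∧-snd {W h} (∧-fst e)))
  ... | a , b , c , d = a , b , ℕₚ.≤-trans c (ℕₚ.<⇒≤ (<ᵇ-⇒ (∧-snd {W h ∧ not (W (α h))} e))) , λ
      { x (here refl) _ _ → c ; x (there i) → d x i }
  minCrossing-spec T W (h ∷ hs) best p q | false with minCrossing-spec T W hs best p q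
  ... | a , b , c , d = a , b , c , λ { x (here refl) r s → ℕₚ.≤-trans c
      (<ᵇ-f⇒ (not-t (λ z → t≢f (∧-intro (∧-intro r (not-≡t s)) z) e))) ; x (there i) → d x i }

  module _ (T : Vec Bool n) (grow : (Fin n → Bool) → Fin n → Fin n → Bool) where

    countParts-done : ∀ f W → firstCrossing W H ≡ [] → countParts T grow (suc f) W ≡ 1
    countParts-done f W e with firstCrossing W H | e
    ... | [] | _ = refl

    countParts-step : ∀ f W h → firstCrossing W H ≡ h ∷ [] →
      countParts T grow (suc f) W ≡ suc (countParts T grow f (λ x → grow W (α (minCrossing T W H h)) x))
    countParts-step f W h e with firstCrossing W H | e
    ... | .h ∷ [] | refl = refl

  -- W grows from the R-successors of h₀ by the R-successors of the lower ends of the marked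
  -- tree edges, taken in the order of the tour.
  module Growth (T : Vec Bool n) (tree : Tree T) (R : Fin n → Fin n → Bool) (mark : Fin n → Bool) where
    open Activity T tree

    growR : (Fin n → Bool) → Fin n → Fin n → Bool
    growR W v x = W x ∨ (R v x ∧ not (W x))

    opaque
      -- The set reached once all marked edges at positions before `p` have been used.
      Wset : ℕ → Fin n → Bool
      Wset p x = R h₀ x ∨ any (λ b → (mark b ∧ (P b <ᵇ p)) ∧ R (α b) x) H

      Wset-root : ∀ {p x} → R h₀ x ≡ true → Wset p x ≡ true
      Wset-root = ∨-inl

      Wset-mark : ∀ {p x b} → mark b ≡ true → P b < p → R (α b) x ≡ true → Wset p x ≡ true
      Wset-mark {p} {x} {b} m lt r = ∨-inr {R h₀ x} (anyF⁺ _ b (∧-intro (∧-intro m (<ᵇ-t lt)) r))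

      Wset⇒ : ∀ {p x} → Wset p x ≡ true → R h₀ x ≡ true ⊎ ∃ λ b → mark b ≡ true × P b < p × R (α b) x ≡ true
      Wset⇒ {p} {x} e with ∨-elim {R h₀ x} e
      ... | inj₁ r = inj₁ r
      ... | inj₂ a with anyF (λ b → (mark b ∧ (P b <ᵇ p)) ∧ R (α b) x) a
      ... | b , q = inj₂ (b , ∧-fst (∧-fst q) , <ᵇ-⇒ (∧-snd {mark b} (∧-fst q)) , ∧-snd {mark b ∧ (P b <ᵇ p)} q)

    cnt : ℕ → ℕ
    cnt p = count (λ h → mark h ∧ (p ≤ᵇ P h)) H

    module Proof
      (R-≈ : ∀ {u x y} → x ≈ y → R u x ≡ true → R u y ≡ true)
      (mark-up : ∀ {b} → mark b ≡ true → Up b)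
      (new : ∀ {b} → mark b ≡ true → Wset (P b) (α b) ≡ false)
      (visited : ∀ x → Wset (P x) x ≡ true)
      (external : ∀ {b y} → mark b ≡ true → Ext y → P y < P b → Wset (P b) (α y) ≡ true) where

      Wset-≈ : ∀ {p x y} → x ≈ y → Wset p x ≡ true → Wset p y ≡ true
      Wset-≈ v e with Wset⇒ e
      ... | inj₁ r = Wset-root (R-≈ v r)
      ... | inj₂ (b , m , lt , r) = Wset-mark m lt (R-≈ v r)

      Wset-mono : ∀ {p q x} → (∀ {b} → mark b ≡ true → P b < p → P b < q) → Wset p x ≡ true → Wset q x ≡ true
      Wset-mono h e with Wset⇒ e
      ... | inj₁ r = Wset-root r
      ... | inj₂ (b , m , lt , r) = Wset-mark m (h m lt) r

      next : ∀ p → (∀ b → mark b ≡ true → P b < p) ⊎ ∃ λ b → mark b ≡ true × p ≤ P b ×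
          (∀ c → mark c ≡ true → p ≤ P c → P b ≤ P c)
      next p with least-failure {λ k → mark (iter t k h₀) ≡ true → k < p} dec n
        where
        dec : ∀ k → (mark (iter t k h₀) ≡ true → k < p) ⊎ ((mark (iter t k h₀) ≡ true → k < p) → ⊥)
        dec k with tf-dec (mark (iter t k h₀)) | ℕₚ.<-≤-connex k p
        ... | inj₂ m | _ = inj₁ (λ q → ⊥-elim (t≢f q m))
        ... | inj₁ _ | inj₁ lt = inj₁ (λ _ → lt)
        ... | inj₁ m | inj₂ ge = inj₂ (λ h → ℕₚ.<-irrefl refl (ℕₚ.<-≤-trans (h m) ge))
      ... | inj₁ all = inj₁ (λ b m → all (P b) (pos<n b) (subst (λ z → mark z ≡ true) (sym (iter-pos b)) m))
      ... | inj₂ (k , k<n , fails , before) = inj₂ (b , mb , pb , least)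
        where
        b : Fin n
        b = iter t k h₀
        Pb : P b ≡ k
        Pb = pos-iter k k<n
        mb : mark b ≡ true
        mb = not-f (λ m → fails (λ q → ⊥-elim (t≢f q m)))
        pb : p ≤ P b
        pb = subst (p ≤_) (sym Pb) (ℕₚ.≮⇒≥ (λ lt → fails (λ _ → lt)))
        least : ∀ c → mark c ≡ true → p ≤ P c → P b ≤ P c
        least c m le = subst (_≤ P c) (sym Pb) (ℕₚ.≮⇒≥ (λ lt → ℕₚ.<-irrefl refl
          (ℕₚ.<-≤-trans (before (P c) lt (subst (λ z → mark z ≡ true) (sym (iter-pos c)) m)) le)))

      cnt-0 : ∀ {p} → (∀ b → mark b ≡ true → P b < p) → cnt p ≡ 0
      cnt-0 h = count-none _ H (λ x _ → not-t (λ q → ℕₚ.<-irrefl refl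
          (ℕₚ.<-≤-trans (h x (∧-fst q)) (≤ᵇ-⇒ (∧-snd {mark x} q)))))

      cnt-suc : ∀ {p b} → mark b ≡ true → p ≤ P b → (∀ c → mark c ≡ true → p ≤ P c → P b ≤ P c) → cnt p ≡ suc
          (cnt (suc (P b)))
      cnt-suc {p} {b} m le least = trans (sym (ℕₚ.+-identityʳ _))
          (trans (cong (λ k → cnt p + k) (sym (count-none (λ _ → false) H (λ _ _ → refl))))
        (trans (count-balance _ (λ _ → false) _ (_== b) H (λ x _ → pt x))
            (trans (cong (λ k → cnt (suc (P b)) + k) (count-single b (_== b) (==-refl b) (λ x → ==⇒)))
            (ℕₚ.+-comm _ 1))))
        where
        pt : ∀ x → 𝟙 (mark x ∧ (p ≤ᵇ P x)) + 0 ≡ 𝟙 (mark x ∧ (suc (P b) ≤ᵇ P x)) + 𝟙 (x == b)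
        pt x with x Finₚ.≟ b
        ... | yes refl = trans (cong (λ z → 𝟙 z + 0) (∧-intro m (≤ᵇ-t le)))
                (sym (cong (λ z → 𝟙 z + 1) (not-t (λ q → ℕₚ.<-irrefl refl (≤ᵇ-⇒ {suc (P x)} (∧-snd {mark x} q))))))
        ... | no ne = cong (λ z → 𝟙 z + 0) (bool-ext
                (λ q → ∧-intro (∧-fst q) (≤ᵇ-t (ℕₚ.≤∧≢⇒< (least x (∧-fst q) (≤ᵇ-⇒ (∧-snd {mark x} q)))
                    (λ e → ne (sym (pos-inj e))))))
                (λ q → ∧-intro (∧-fst q) (≤ᵇ-t (ℕₚ.≤-trans le (ℕₚ.<⇒≤ (≤ᵇ-⇒ {suc (P b)} (∧-snd {mark x} q)))))))

      -- Let `b` be the next marked edge. By `visited` everything up to `b` is in the current set,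
      -- and by `new` its lower end is not, so `b` is the minimal crossing edge and the procedure
      -- moves to the set after `b`. The bound on `f` guarantees enough fuel.
      parts : ∀ f p W → (∀ x → W x ≡ Wset p x) → cnt p ≤ f → countParts T growR f W ≡ suc (cnt p)
      -- When the fuel is spent no mark is left, so the default value 1 counts the current part
      -- only.
      parts zero p W W≡ le = cong suc (sym (ℕₚ.n≤0⇒n≡0 le))
      parts (suc f) p W W≡ le with next p | firstCrossing-spec W H
      ... | inj₁ none | inj₁ (e , _) = trans (countParts-done T growR f W e) (cong suc (sym (cnt-0 none)))
      ... | inj₁ none | inj₂ (h , _ , _ , q) =
            ⊥-elim (t≢f (Wset-mono {q = p} (λ {b} m _ → none b m) (visited (α h))) (trans (sym (W≡ (α h))) q))
      ... | inj₂ (b , m , pb , least) | c = go c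
        where
        toP : ∀ {x} → Wset (P b) x ≡ true → W x ≡ true
        toP {x} e = trans (W≡ x) (Wset-mono (λ {c} mc lt → ℕₚ.≰⇒>
            (λ ge → ℕₚ.<-irrefl refl (ℕₚ.<-≤-trans lt (least c mc ge)))) e)
        fromP : ∀ {x} → W x ≡ true → Wset (P b) x ≡ true
        fromP {x} e = Wset-mono (λ _ lt → ℕₚ.<-≤-trans lt pb) (trans (sym (W≡ x)) e)
        Wb : W b ≡ true
        Wb = toP (visited b)
        Wαb : W (α b) ≡ false
        Wαb = not-t (λ e → t≢f (fromP e) (new m))
        early : ∀ {x} → P x ≤ P b → W x ≡ true
        early {x} l = toP (Wset-mono (λ _ lt → ℕₚ.<-≤-trans lt l) (visited x))
        -- An earlier edge does not cross: the second half-edge of a tree edge shares its vertex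
        -- with the next, already visited, half-edge of the tour, and that of an external edge is
        -- supplied by `external`.
        is-b : ∀ x → W x ≡ true → W (α x) ≡ false → rank x ≤ rank b → x ≡ b
        is-b x p q l with small-or x
        ... | inj₂ gt = ⊥-elim (t≢f (early (subst₂ _≤_ (trans (sym (rank-α x)) (rank-small (small-α gt)))
            (rank-small (up< (mark-up m))) l)) q)
        ... | inj₁ lt with ℕₚ.m≤n⇒m<n∨m≡n (subst₂ _≤_ (rank-small lt) (rank-small (up< (mark-up m))) l)
        ... | inj₂ e = pos-inj e
        ... | inj₁ x<b with tf-dec (lookup T x)
        ... | inj₂ x∉ = ⊥-elim (t≢f (toP (external m (mkExt x∉ lt) x<b)) q)
        ... | inj₁ x∈ = ⊥-elim (t≢f (toP (Wset-≈ (≈-sym (subst (α x ≈_) (sym (motion-in {T} x∈)) (≈σ (α x))))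
            (fromP (early tx≤)))) q)
          where
          tx≤ : P (t x) ≤ P b
          tx≤ = subst (_≤ P b) (sym (pos-t x (ℕₚ.≤-<-trans x<b (pos<n b)))) x<b
        go : _ → countParts T growR (suc f) W ≡ suc (cnt p)
        go (inj₁ (_ , closed)) = ⊥-elim (t≢f (closed b (∈-allFin b) Wb) Wαb)
        go (inj₂ (h , e , ph , qh)) = trans (countParts-step T growR f W h e)
          (cong suc (trans (parts f (suc (P b)) _ W′≡ (ℕₚ.≤-pred (subst (_≤ suc f) (cnt-suc m pb least) le)))
              (sym (cnt-suc m pb least))))
          where
          min : Fin n
          min = minCrossing T W H h
          min≡b : min ≡ b
          min≡b with minCrossing-spec T W H h ph qh
          ... | a , c , _ , d = is-b min a c (subst₂ _≤_ (sym (rank≡ min)) (sym (rank≡ b)) (d b (∈-allFin b) Wb Wαb))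
          W′≡ : ∀ x → growR W (α min) x ≡ Wset (suc (P b)) x
          W′≡ x rewrite min≡b = bool-ext to from
            where
            to : growR W (α b) x ≡ true → Wset (suc (P b)) x ≡ true
            to q with ∨-elim {W x} q
            ... | inj₁ w = Wset-mono (λ _ → ℕₚ.m<n⇒m<1+n) (fromP w)
            ... | inj₂ r = Wset-mark m (ℕₚ.n<1+n (P b)) (∧-fst r)
            from : Wset (suc (P b)) x ≡ true → growR W (α b) x ≡ true
            from q with tf-dec (W x)
            ... | inj₁ w = ∨-inl w
            ... | inj₂ w with Wset⇒ q
            ... | inj₁ r = ⊥-elim (t≢f (toP (Wset-root r)) w)
            ... | inj₂ (c , mc , lt , r) with ℕₚ.m≤n⇒m<n∨m≡n (ℕₚ.≤-pred lt)
            ... | inj₁ c<b = ⊥-elim (t≢f (toP (Wset-mark mc c<b r)) w)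
            ... | inj₂ eq with pos-inj eq
            ... | refl = ∨-inr {W x} (∧-intro r (not-≡t w))

      parts-total : countParts T growR n (R h₀) ≡ suc (count mark H)
      parts-total = trans (parts n 0 (R h₀) (λ x → bool-ext Wset-root (from x))
          (subst (_≤ n) (sym cnt≡) (count-≤n mark))) (cong suc cnt≡)
        where
        cnt≡ : cnt 0 ≡ count mark H
        cnt≡ = count-cong _ _ H (λ x _ → 𝔹ₚ.∧-identityʳ (mark x))
        from : ∀ x → Wset 0 x ≡ true → R h₀ x ≡ true
        from x e with Wset⇒ e
        ... | inj₁ r = r
        ... | inj₂ (_ , _ , () , _)

  -- Root-components and root-strong-components of the orientation.

  module PairRoots (T S O : Vec Bool n) (iv : Interval T S) (ΦO : IsΦ T S O) where
    open PairComponents T S O iv ΦO public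

    private
      module G = Growth T (itree iv) (dreach O) cutMark

    numRootComps≡ : numRootComps T O ≡ suc (ecount (toggledInt T S))
    numRootComps≡ = trans unfolded (trans (G.Proof.parts-total (λ v r → dr-≈ O r v) (λ m → proj₁ (cutMark⇒ m)) new
        visited external)
                      (cong suc (sym count-cutMark)))
      where
      opaque
        unfolding dreach
        unfolded : numRootComps T O ≡ countParts T G.growR n (dreach O h₀)
        unfolded = refl
      new : ∀ {b} → cutMark b ≡ true → G.Wset (P b) (α b) ≡ false
      new {b} m = not-t bad
        where
        u : Up b
        u = proj₁ (cutMark⇒ m)
        bad : G.Wset (P b) (α b) ≡ true → ⊥
        bad e with G.Wset⇒ e
        ... | inj₁ r = U-blocks u (proj₂ (cutMark⇒ m)) r (U-h₀ b) (U-αb (up< u))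
        ... | inj₂ (c , mc , lt , r) = U-blocks u (proj₂ (cutMark⇒ m)) r (αtop-out (proj₁ (cutMark⇒ mc)) u lt)
            (U-αb (up< u))
      visited : ∀ x → G.Wset (P x) x ≡ true
      visited x with D.top x
      ... | inj₁ r = G.Wset-root r
      ... | inj₂ (b , u , p , q , r) = G.Wset-mark (⇒cutMark u p) (U-lo q) r
      external : ∀ {b y} → cutMark b ≡ true → Ext y → P y < P b → G.Wset (P b) (α y) ≡ true
      external {b} {y} m x lt with D.top (α y)
      ... | inj₁ r = G.Wset-root r
      ... | inj₂ (c , u , p , q , r) with ℕₚ.<-≤-connex (P c) (P b)
      ... | inj₁ c<b = G.Wset-mark (⇒cutMark u p) c<b r
      -- Otherwise `y` would be an edge of the cocycle of the toggled `c` that comes before `c`.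
      ... | inj₂ b≤c = ⊥-elim (int-active u x (A-act p) (U-before (ℕₚ.<⇒≤ (ℕₚ.<-≤-trans lt b≤c)) , q))

    actMark : Fin n → Bool
    actMark h = activeInt T h ∧ (P h <ᵇ P (α h))

    actMark⇒ : ∀ {h} → actMark h ≡ true → Up h × Act h ≡ true
    actMark⇒ {h} p = mkUp (∧-fst (∧-fst p)) (<ᵇ-⇒ (∧-snd {activeInt T h} p)) , trans (Act≡ h)
        (∧-snd {lookup T h} (∧-fst p))

    ⇒actMark : ∀ {h} → Up h → Act h ≡ true → actMark h ≡ true
    ⇒actMark {h} u p = ∧-intro (∧-intro (up∈ u) (trans (sym (Act≡ h)) p)) (<ᵇ-t (up< u))

    module Rooted (noInt : NoInt) where

      private
        module K = Growth T (itree iv) (λ u x → dreach O x u) actMark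

      -- With no tree edge toggled, the cocycle of an active `b` keeps its reference direction, into
      -- the arc: an external edge across it is inactive, and `b` is on the cycle of no toggled
      -- external edge.
      U-stays : ∀ {b} → Up b → Act b ≡ true → ∀ {x y} → dr O x y → U b x ≡ true → U b y ≡ true
      U-stays {b} u a {x} r p = dr-ind O (λ y → U b y ≡ true) p (λ y z e v → trans (sym (U-≈ u v)) e)
          (λ y e o → not-f (λ q → bad y e o q (half y))) r
        where
        tr : ∀ h → lookup T h ≡ true → U b h ≡ true → lookup O h ≡ true → U b (α h) ≡ false → ⊥
        tr h h∈ e o q with h Finₚ.≟ b | h Finₚ.≟ α b
        ... | yes refl | _ = t≢f e (U-b h)
        ... | no x | no y = t≢f e (trans (U-tree u h∈ x y) q)
        ... | no _ | yes refl with upCase u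
        ... | toggled z _ = t≢f z (noInt u)
        ... | plain _ o' = O-not-both o' o
        ... | onCycle c _ _ x _ d = int-active u x a d
        bad : ∀ h → U b h ≡ true → lookup O h ≡ true → U b (α h) ≡ false → Half h → ⊥
        bad h e o q (inj₁ (inj₁ v)) = tr h (up∈ v) e o q
        bad h e o q (inj₁ (inj₂ v)) = tr h (trans (inv sub h) (up∈ v)) e o q
        bad h e o q (inj₂ (inj₂ x)) = int-active u x a (q , trans (cong (U b) (α-invol h)) e)
        bad h e o q (inj₂ (inj₁ x)) with extCase x
        ... | toggled z _ = ext-active u x (A-act z) (e , q)
        ... | plain _ o' _ = O-not-both o o'
        ... | onCocycle c _ _ v z _ = t≢f z (noInt v)

      -- Every tree edge can be followed downwards, so the tree path from `α w` to `y` can only fail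
      -- by going up an edge; inside the arc of `w` it never does.
      below : ∀ {w y} → Up w → U w y ≡ true → dr O (α w) y
      below {w} {y} u p = not-f bad
        where
        bad : dreach O (α w) y ≡ false → ⊥
        bad q with walk (dreach O (α w)) (reach≈ O (α w)) (α w) y (trans (dr-refl O (α w)) (cong not (sym q)))
        ... | f , v , inj₂ (_ , _ , a , b) = t≢f (dr-trans O (trans a (dr-refl O (α w))) (descend v (noInt v)))
            (trans b q)
        ... | f , v , inj₁ (a , b , _) with w Finₚ.≟ f | w Finₚ.≟ α f
        ... | yes refl | _ = t≢f p b
        ... | no _ | yes refl = ℕₚ.<-asym (up< v) (subst (λ z → P (α f) < P z) (α-invol f) (up< u))
        -- An arc containing `α w` and not bounded by `w` contains `w` too, hence the whole arc of
        -- `w`.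
        ... | no x | no z = t≢f (U⁺ (ℕₚ.<-trans (U-lo (trans (U-tree v (up∈ u) x z) a)) (U-lo p))
            (ℕₚ.≤-trans (U-hi p) (U-hi a))) b

      ext-return : ∀ {e} → Ext e → dr O (α e) e
      ext-return {e} x with extCase x
      ... | toggled z _ = ext-back x z
      ... | plain _ o _ = dr-α⁻ O (dr-refl O (α e)) o
      ... | onCocycle c _ _ v z _ = ⊥-elim (t≢f z (noInt v))

      Home : Fin n → Set
      Home x = dr O x h₀ ⊎ ∃ λ b → Up b × Act b ≡ true × P b < P x × dr O x (α b)

      home-via : ∀ {x y} → P y ≤ P x → dr O x y → Home y → Home x
      home-via le r (inj₁ s) = inj₁ (dr-trans O r s)
      home-via le r (inj₂ (b , u , a , lt , s)) = inj₂ (b , u , a , ℕₚ.<-≤-trans lt le , dr-trans O r s)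

      -- Trace the tour backwards. At the lower end of an inactive tree edge `w` some earlier
      -- external edge `g` crosses the cut: descend from `α w` to `α g` and return along it to `g`,
      -- which comes before `w`. At an active tree edge the trace stops.
      home : ∀ x → Home x
      home x = go (P x) x ℕₚ.≤-refl
        where
        go : ∀ m x → P x ≤ m → Home x
        go zero x le = inj₁ (subst (λ z → dr O x z) (pos-inj (trans (ℕₚ.n≤0⇒n≡0 le) (sym pos-h₀))) (dr-refl O x))
        go (suc m) x le with ℕₚ.m≤n⇒m<n∨m≡n le
        ... | inj₁ lt = go m x (ℕₚ.≤-pred lt)
        ... | inj₂ e with pos-pred x m e
        ... | w , pw , tw = step (tf-dec (lookup T w)) (small-or w)
          where
          via : ∀ y → P y ≤ P w → dr O x y → Home x
          via y l r = home-via (ℕₚ.≤-trans l (ℕₚ.≤-trans (ℕₚ.≤-reflexive pw)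
              (ℕₚ.≤-trans (ℕₚ.n≤1+n m) (ℕₚ.≤-reflexive (sym e))))) r
                        (go m y (ℕₚ.≤-trans l (ℕₚ.≤-reflexive pw)))
          step : lookup T w ≡ true ⊎ lookup T w ≡ false → P w < P (α w) ⊎ P (α w) < P w → Home x
          step (inj₂ w∉) _ = via w ℕₚ.≤-refl (dr-≈ O (dr-refl O x)
              (≈-sym (subst (w ≈_) (trans (sym (motion-out {T} w∉)) tw) (≈σ w))))
          step (inj₁ w∈) lr = inner lr
            where
            x≈ : x ≈ α w
            x≈ = ≈-sym (subst (α w ≈_) (trans (sym (motion-in {T} w∈)) tw) (≈σ (α w)))
            inner : P w < P (α w) ⊎ P (α w) < P w → Home x
            inner (inj₂ gt) = via (α w) (ℕₚ.<⇒≤ gt) (dr-≈ O (dr-refl O x) x≈)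
            inner (inj₁ lt) with tf-dec (Act w)
            ... | inj₁ a = inj₂ (w , mkUp w∈ lt , a , subst₂ _<_ (sym pw) (sym e) (ℕₚ.n<1+n m) , dr-≈ O
                (dr-refl O x) x≈)
            ... | inj₂ a with int-inactive (mkUp w∈ lt) a
            ... | g , y , c = via g (ℕₚ.<⇒≤ (≻⇒< (mkUp w∈ lt) y c))
                    (dr-trans O (dr-≈ O (dr-refl O x) x≈) (dr-trans O (below (mkUp w∈ lt) (proj₂ c)) (ext-return y)))

      numRootStrongComps≡ : numRootStrongComps T O ≡ suc (ecount (activeInt T))
      numRootStrongComps≡ = trans unfolded (trans (K.Proof.parts-total
          (λ v r → dr-trans O (dr-≈ O (dr-refl O _) (≈-sym v)) r)
          (λ m → proj₁ (actMark⇒ m)) new visited external)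
          (cong suc (sym (ecount-via (activeInt T) P activeInt-inv small-or))))
        where
        opaque
          unfolding dreach
          unfolded : numRootStrongComps T O ≡ countParts T K.growR n (λ x → dreach O x h₀)
          unfolded = refl
        new : ∀ {b} → actMark b ≡ true → K.Wset (P b) (α b) ≡ false
        new {b} m = not-t bad
          where
          u : Up b
          u = proj₁ (actMark⇒ m)
          bad : K.Wset (P b) (α b) ≡ true → ⊥
          bad e with K.Wset⇒ e
          ... | inj₁ r = t≢f (U-stays u (proj₂ (actMark⇒ m)) r (U-αb (up< u))) (U-h₀ b)
          ... | inj₂ (c , mc , lt , r) = t≢f (U-stays u (proj₂ (actMark⇒ m)) r (U-αb (up< u)))
              (αtop-out (proj₁ (actMark⇒ mc)) u lt)
        visited : ∀ x → K.Wset (P x) x ≡ true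
        visited x with home x
        ... | inj₁ r = K.Wset-root r
        ... | inj₂ (b , u , a , lt , r) = K.Wset-mark (⇒actMark u a) lt r
        external : ∀ {b y} → actMark b ≡ true → Ext y → P y < P b → K.Wset (P b) (α y) ≡ true
        external {b} {y} m x lt with home y
        ... | inj₁ r = K.Wset-root (dr-trans O (ext-return x) r)
        ... | inj₂ (c , u , a , c<y , r) = K.Wset-mark (⇒actMark u a) (ℕₚ.<-trans c<y lt)
            (dr-trans O (ext-return x) r)

  -- Directed cycles, minimality and acyclicity.

  module _ (X : Fin n → Bool) (cl : ∀ {x y} → x ≈ y → X x ≡ true → X y ≡ true) where

    chain : ∀ x xs z → Linked (λ a b → sameV (α a) b ≡ true) ((x ∷ xs) ∷ʳ z) →
            (∀ g → g ∈ (x ∷ xs) → X g ≡ true → X (α g) ≡ true) → X x ≡ true → X z ≡ true ×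
                (∀ g → g ∈ (x ∷ xs) → X g ≡ true)
    chain x [] z (r ∷ _) good p = cl (mk≈ r) (good x (here refl) p) , λ { g (here refl) → p }
    chain x (y ∷ ys) z (r ∷ l) good p with chain y ys z l (λ g i → good g (there i))
        (cl (mk≈ r) (good x (here refl) p))
    ... | q , a = q , λ { g (here refl) → p ; g (there i) → a g i }

    chain-from : ∀ x xs z → Linked (λ a b → sameV (α a) b ≡ true) ((x ∷ xs) ∷ʳ z) →
                 (∀ g → g ∈ (x ∷ xs) → X g ≡ true → X (α g) ≡ true) → ∀ {a} → a ∈ (x ∷ xs) → X (α a) ≡ true → X z
                     ≡ true
    chain-from x [] z (r ∷ _) good (here refl) p = cl (mk≈ r) p
    chain-from x (y ∷ ys) z (r ∷ l) good (here refl) p = proj₁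
        (chain y ys z l (λ g i → good g (there i)) (cl (mk≈ r) p))
    chain-from x (y ∷ ys) z (r ∷ l) good (there i) p = chain-from y ys z l (λ g j → good g (there j)) i p

  record DirCycle (O : Vec Bool n) (h : Fin n) (rest : List (Fin n)) : Set where
    constructor mkDC
    field unDC : DirectedCycle O h rest
  open DirCycle

  module _ {O : Vec Bool n} {h : Fin n} {rest : List (Fin n)} (dc : DirCycle O h rest) where

    cycle-tail : ∀ {a} → a ∈ (h ∷ rest) → lookup O a ≡ true
    cycle-tail i = All.lookup (proj₁ (unDC dc)) i

    cycle-closed : ∀ (X : Fin n → Bool) → (∀ {x y} → x ≈ y → X x ≡ true → X y ≡ true) → ∀ {a} → a ∈ (h ∷ rest) → X
        (α a) ≡ true →
      (∀ g → g ∈ (h ∷ rest) → X g ≡ true → X (α g) ≡ true) → ∀ g → g ∈ (h ∷ rest) → X g ≡ true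
    cycle-closed X cl i p good = proj₂ (chain X cl h rest h link good (chain-from X cl h rest h link good i p))
      where
      link : Linked (λ a b → sameV (α a) b ≡ true) ((h ∷ rest) ∷ʳ h)
      link = proj₁ (proj₂ (unDC dc))

    cycle-leaves : ∀ (X : Fin n → Bool) → (∀ {x y} → x ≈ y → X x ≡ X y) → ∀ {a} → a ∈ (h ∷ rest) → X a ≡ false → X
        (α a) ≡ true →
      ∃ λ g → g ∈ (h ∷ rest) × X g ≡ true × X (α g) ≡ false
    cycle-leaves X cl {a} i p q with any (λ g → X g ∧ not (X (α g))) (h ∷ rest) in eq
    ... | true = let g , j , e = any-elim _ (h ∷ rest) eq in g , j , ∧-fst e , not-≡f (∧-snd {X g} e)
    ... | false = ⊥-elim (t≢f (cycle-closed X (λ v e → trans (sym (cl v)) e) i q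
                    (λ g j e → not-f (λ e' → t≢f (any-intro (λ g → X g ∧ not (X (α g))) j (∧-intro e (not-≡t e')))
                        eq)) a i) p)

    cycle-predClosed : ∀ {X} → PredClosed O X → ∀ {a} → a ∈ (h ∷ rest) → X a ≡ X (α a)
    cycle-predClosed {X} pc {a} i with tf-dec (X (α a))
    ... | inj₁ q = trans (pc-α pc a (cycle-tail i) q) (sym q)
    ... | inj₂ q = trans (not-≡f (cycle-closed (λ x → not (X x)) (λ v e → trans (cong not (sym (pc-≈ pc v))) e) i
        (not-≡t q)
                     (λ g j e → not-≡t (not-t (λ e' → t≢f (pc-α pc g (cycle-tail j) e') (not-≡f e)))) a i)) (sym q)

  -- Loop erasure turns a directed walk from αq to q into a directed cycle through q.
  module Erase (O : Vec Bool n) (q : Fin n) where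

    data Chain : Fin n → List (Fin n) → Set where
      end  : ∀ {v} → v ≈ q → Chain v []
      step : ∀ {v w ws} → v ≈ w → Chain (α w) ws → Chain v (w ∷ ws)

    record Simple (v : Fin n) : Set where
      field
        tails : List (Fin n)
        links : Chain v tails
        good : All (λ a → lookup O a ≡ true) tails
        distinct : AllPairs (λ a b → sameV a b ≡ false) tails
        avoids : All (λ a → sameV q a ≡ false) tails

    chain-≈ : ∀ {v w ws} → v ≈ w → Chain w ws → Chain v ws
    chain-≈ e (end f) = end (≈-trans e f)
    chain-≈ e (step f c) = step (≈-trans e f) c

    simple-≈ : ∀ {v w} → v ≈ w → Simple w → Simple v
    simple-≈ e s = record { Simple s ; links = chain-≈ e (Simple.links s) }

    -- The walk is extended at its front. If `y` is at the vertex of `q`, the rest is dropped; if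
    -- its vertex is that of a later tail, everything before that tail is dropped.
    prepend : ∀ {y} → lookup O y ≡ true → Simple (α y) → Simple y
    prepend {y} o s with tf-dec (sameV y q)
    ... | inj₁ e = record { tails = [] ; links = end (mk≈ e) ; good = [] ; distinct = [] ; avoids = [] }
    ... | inj₂ ne with tf-dec (any (sameV y) (Simple.tails s))
    ... | inj₂ none = record { tails = y ∷ Simple.tails s ; links = step ≈-refl (Simple.links s) ; good = o ∷
        Simple.good s
          ; distinct = All.tabulate (λ i → not-t (λ e → t≢f (any-intro (sameV y) i e) none)) ∷ Simple.distinct s
          ; avoids = not-t (λ e → t≢f (un≈ (≈-sym (mk≈ e))) ne) ∷ Simple.avoids s }
    ... | inj₁ some = cut (Simple.tails s) (Simple.links s) (Simple.good s) (Simple.distinct s) (Simple.avoids s) some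
      where
      cut : ∀ {v} ws → Chain v ws → All (λ a → lookup O a ≡ true) ws → AllPairs (λ a b → sameV a b ≡ false) ws →
            All (λ a → sameV q a ≡ false) ws → any (sameV y) ws ≡ true → Simple y
      cut (w ∷ ws) (step _ c) (g ∷ gs) (d ∷ ds) (a ∷ as) e with tf-dec (sameV y w)
      ... | inj₁ f = record { tails = w ∷ ws ; links = step (mk≈ f) c ; good = g ∷ gs ; distinct = d ∷ ds ; avoids
          = a ∷ as }
      ... | inj₂ f = cut ws c gs ds as (subst (λ z → z ∨ any (sameV y) ws ≡ true) f e)

    -- Reachability is built at its end and a simple walk at its front, so the induction carries a
    -- function that completes a walk from the current half-edge to one from `v`.
    simple-path : ∀ {v} → dr O v q → Simple v
    simple-path {v} r = dr-ind O (λ y → Simple y → Simple v) (λ s → s) (λ x y k e s → k (simple-≈ e s))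
      (λ x k o s → k (prepend o s)) r (record { tails = [] ; links = end ≈-refl ; good = [] ; distinct = [] ;
          avoids = [] })

    toLinked : ∀ {x ws} → Chain (α x) ws → Linked (λ a b → sameV (α a) b ≡ true) ((x ∷ ws) ∷ʳ q)
    toLinked (end e) = un≈ e ∷ [-]
    toLinked (step e c) = un≈ e ∷ toLinked c

    -- The walk may be taken in a part `O` of the orientation `O₁`, which controls the edges that
    -- the cycle uses besides `q`.
    cycle : ∀ O₁ → lookup O₁ q ≡ true → (∀ {a} → lookup O a ≡ true → lookup O₁ a ≡ true) →
            (s : Simple (α q)) → DirectedCycle O₁ q (Simple.tails s)
    cycle O₁ o inc s = o ∷ All.map inc (Simple.good s) , toLinked (Simple.links s) , Simple.avoids s ∷
        Simple.distinct s

  module PairCycles (T S O : Vec Bool n) (iv : Interval T S) (ΦO : IsΦ T S O) where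
    open PairRoots T S O iv ΦO public

    module _ (noExt : NoExt) {h : Fin n} {rest : List (Fin n)} (dc : DirCycle O h rest) where

      private
        no-toggled : ∀ {c g} → g ∈ (h ∷ rest) → Up c → A c ≡ true → U c g ≡ true → U c (α g) ≡ false → ⊥
        no-toggled i u p q r = t≢f (trans (sym (cycle-predClosed dc (U-predClosed u p) i)) q) r

        -- A cycle entering `U f` must leave it, by `α f` or by an external edge. An external edge
        -- left from its first half-edge would be toggled or in a toggled cocycle; left from its
        -- second half-edge, it precedes `f`.
        leaves-early : ∀ {f a} → Up f → a ∈ (h ∷ rest) → U f a ≡ false → U f (α a) ≡ true → ∃ λ g → g ∈ (h ∷ rest)
            × (g ≡ α f ⊎ rank g < P f)
        leaves-early {f} u i p q with cycle-leaves dc (U f) (U-≈ u) i p q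
        ... | g , j , r , s = g , j , go (half g)
          where
          tr : lookup T g ≡ true → g ≡ α f ⊎ rank g < P f
          tr g∈ with g Finₚ.≟ f | g Finₚ.≟ α f
          ... | yes refl | _ = ⊥-elim (t≢f r (U-b g))
          ... | no _ | yes e = inj₁ e
          ... | no x | no y = ⊥-elim (t≢f r (trans (U-tree u g∈ x y) s))
          go : Half g → g ≡ α f ⊎ rank g < P f
          go (inj₁ (inj₁ v)) = tr (up∈ v)
          go (inj₁ (inj₂ v)) = tr (trans (inv sub g) (up∈ v))
          go (inj₂ (inj₂ x)) = inj₂ (subst (_< P f) (trans (sym (rank-small (ext< x))) (rank-α g))
            (≻⇒< u x (s , trans (cong (U f) (α-invol g)) r)))
          go (inj₂ (inj₁ x)) with extCase x
          ... | toggled z _ = ⊥-elim (t≢f z (noExt x))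
          ... | plain _ o _ = ⊥-elim (O-not-both (cycle-tail dc j) o)
          ... | onCocycle c _ _ v z (d , e) = ⊥-elim (no-toggled j v z d e)

      module _ {m : Fin n} (i : m ∈ (h ∷ rest)) (least : ∀ g → g ∈ (h ∷ rest) → rank m ≤ rank g) where

        private
          not-up : Up m → ⊥
          not-up u = go (leaves-early u i (U-b m) (U-αb (up< u)))
            where
            go : (∃ λ g → g ∈ (h ∷ rest) × (g ≡ α m ⊎ rank g < P m)) → ⊥
            go (g , j , inj₁ e) = O-not-both (cycle-tail dc i) (subst (λ z → lookup O z ≡ true) e (cycle-tail dc j))
            go (g , j , inj₂ lt) = ℕₚ.<-irrefl refl (ℕₚ.<-≤-trans lt
                (subst (_≤ rank g) (rank-small (up< u)) (least g j)))

          not-down : Up (α m) → ⊥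
          not-down u = go (upCase u)
            where
            go : UpCase (α m) → ⊥
            go (toggled z _) = no-toggled i u z (trans (cong (U (α m)) (sym (α-invol m))) (U-αb (up< u))) (U-b (α m))
            go (plain _ o) = O-not-both (cycle-tail dc i) o
            go (onCycle a _ _ x z _) = t≢f z (noExt x)

          not-tail : Ext m → ⊥
          not-tail x = go (extCase x)
            where
            go : ExtCase m → ⊥
            go (toggled z _) = t≢f z (noExt x)
            go (plain _ o _) = O-not-both (cycle-tail dc i) o
            go (onCocycle c _ _ v z (d , e)) = no-toggled i v z d e

          head-active : Ext (α m) → Act (α m) ≡ false → ⊥
          head-active x a = go (ext-inactive x a)
            where
            rm : rank m ≡ P (α m)
            rm = trans (sym (rank-α m)) (rank-small (ext< x))
            go : (∃ λ f → Up f × f ≺ᵗ α m) → ⊥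
            go (f , u , c , d) = go′ (leaves-early u i (trans (cong (U f) (sym (α-invol m))) d) c)
              where
              go′ : (∃ λ g → g ∈ (h ∷ rest) × (g ≡ α f ⊎ rank g < P f)) → ⊥
              go′ (g , j , inj₂ lt) = ℕₚ.<-irrefl refl (ℕₚ.<-≤-trans (ℕₚ.<-trans lt (U-lo c))
                  (subst (_≤ rank g) rm (least g j)))
              go′ (g , j , inj₁ e) = ℕₚ.<-irrefl refl (ℕₚ.<-≤-trans (U-lo c)
                (subst₂ _≤_ rm (trans (cong rank e) (trans (rank-α f) (rank-small (up< u)))) (least g j)))

        -- If `m` went down a tree edge, or were an inactive external edge, `leaves-early` would
        -- give a smaller edge of the cycle or the opposite of `m`. The other cases contradict the
        -- direction of `m` or involve a toggled edge.
        min-edge : Ext (α m) × Act (α m) ≡ true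
        min-edge = go (half m)
          where
          go : Half m → Ext (α m) × Act (α m) ≡ true
          go (inj₁ (inj₁ u)) = ⊥-elim (not-up u)
          go (inj₁ (inj₂ u)) = ⊥-elim (not-down u)
          go (inj₂ (inj₁ x)) = ⊥-elim (not-tail x)
          go (inj₂ (inj₂ x)) = x , not-f (head-active x)

    minimal⇐ : NoExt → MinimalWrt T O
    minimal⇐ noExt h rest dc small = go small
      where
      go : SmallestIsTail T (h ∷ rest) → ⊥
      go s with findAny s
        where
        findAny : ∀ {C} {Q : Fin n → Set} → Any Q C → ∃ λ a → a ∈ C × Q a
        findAny (here q) = _ , here refl , q
        findAny (there s) = let a , i , q = findAny s in a , there i , q
      ... | m , i , le = ℕₚ.<-asym (P< i) (subst (λ z → P (α m) < P z) (α-invol m)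
          (ext< (proj₁ (min-edge noExt (mkDC dc) i least))))
        where
        P≤ : ∀ {g} → g ∈ (h ∷ rest) → P m ≤ P g
        P≤ {g} j = subst₂ _≤_ (sym (P≡pos m)) (sym (P≡pos g)) (proj₁ (All.lookup le j))
        P< : ∀ {g} → g ∈ (h ∷ rest) → P m < P (α g)
        P< {g} j = subst₂ _<_ (sym (P≡pos m)) (sym (P≡pos (α g))) (proj₂ (All.lookup le j))
        least : ∀ g → g ∈ (h ∷ rest) → rank m ≤ rank g
        least g j = subst (_≤ rank g) (sym (rank-small (P< i))) (rank-≥ (small-or g))
          where
          rank-≥ : P g < P (α g) ⊎ P (α g) < P g → P m ≤ rank g
          rank-≥ (inj₁ lt) = subst (P m ≤_) (sym (rank-small lt)) (P≤ j)
          rank-≥ (inj₂ gt) = subst (P m ≤_) (sym (trans (sym (rank-α g)) (rank-small (small-α gt)))) (ℕₚ.<⇒≤ (P< j))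

    acyclic⇐ : (∀ {e} → Ext e → Act e ≡ false) → Acyclic O
    acyclic⇐ none h rest dc with argmin rank h rest
    ... | m , i , least = let x , a = min-edge (λ x → not-t (λ p → t≢f (A-act p) (none x))) (mkDC dc) i least in t≢f a (none x)

    -- The fundamental cycle of `a` is directed, and the active `a` precedes all its other edges, so
    -- its smallest half-edge is the tail `a`. Loop erasure only yields some cycle; confining it to
    -- the tree path makes the positions of its edges known.
    toggled-cycle : ∀ {a} → Ext a → A a ≡ true → ∃ λ rest → DirectedCycle O a rest × All
        (λ b → P a < P b × P a < P (α b)) rest
    toggled-cycle {a} x Aa = E.tails , E′.cycle O (ext-tail x Aa) onO s , All.map onPath E.good
      where
      -- The second half-edges of the tree edges whose arc contains `α a` but not `a`.
      path : Fin n → Bool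
      path y = (lookup T y ∧ (P (α y) <ᵇ P y)) ∧ (not (U (α y) a) ∧ U (α y) (α a))
      on : Fin n → Bool
      on y = lookup O y ∧ path y
      O' : Vec Bool n
      O' = tabulate on
      module E′ = Erase O' a
      onO : ∀ {b} → lookup O' b ≡ true → lookup O b ≡ true
      onO {b} p = ∧-fst (trans (sym (lookup∘tabulate on b)) p)
      back : dr O' (α a) a
      back = not-f λ q → let f , u , c , p , r , o = cycle-exit x Aa (dreach O' (α a)) (reach≈ O' (α a)) (dr-refl O' (α a)) q
                         in t≢f (dr-α⁻ O' p (trans (lookup∘tabulate on (α f)) (∧-intro o (onp u c)))) r
        where
        onp : ∀ {f} → Up f → f ≻ᵗ a → path (α f) ≡ true
        onp {f} u (c , d) rewrite α-invol f = ∧-intro (∧-intro (trans (sym (inv sub f)) (up∈ u)) (<ᵇ-t (up< u)))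
            (∧-intro (not-≡t c) d)
      s : E′.Simple (α a)
      s = E′.simple-path back
      module E = E′.Simple s
      onPath : ∀ {b} → lookup O' b ≡ true → P a < P b × P a < P (α b)
      onPath {b} p = ℕₚ.<-trans lt sm , lt
        where
        q : path b ≡ true
        q = ∧-snd {lookup O b} (trans (sym (lookup∘tabulate on b)) p)
        sm : P (α b) < P b
        sm = <ᵇ-⇒ (∧-snd {lookup T b} (∧-fst q))
        up : Up (α b)
        up = mkUp (trans (sym (inv sub b)) (∧-fst (∧-fst q))) (small-α sm)
        q' : not (U (α b) a) ∧ U (α b) (α a) ≡ true
        q' = ∧-snd {lookup T b ∧ (P (α b) <ᵇ P b)} q
        lt : P a < P (α b)
        lt = ≻⇒< up x (not-≡f (∧-fst q') , ∧-snd {not (U (α b) a)} q')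

    minimal⇒ : MinimalWrt T O → NoExt
    minimal⇒ min {a} x = not-t λ p → let rest , dc , lt = toggled-cycle x p in
      min a rest dc (here ((ℕₚ.≤-refl , toPos (ext< x)) ∷ All.map (λ (c , d) → ℕₚ.<⇒≤ (toPos c) , toPos d) lt))
      where
      toPos : ∀ {y z} → P y < P z → pos T y < pos T z
      toPos {y} {z} = subst₂ _<_ (P≡pos y) (P≡pos z)

    -- An unreversed external edge points from `α e` to `e`. If it is active, the tree path from `e`
    -- back to `α e` only descends untoggled edges, which closes a directed cycle.
    acyclic⇒ : Acyclic O → ∀ {e} → Ext e → Act e ≡ false
    acyclic⇒ acyc {e} x = not-t bad
      where
      noExt : NoExt
      noExt y = not-t (λ p → let rest , dc , _ = toggled-cycle y p in acyc _ rest dc)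
      Oαe : lookup O (α e) ≡ true → Act e ≡ true → ⊥
      Oαe o a = acyc (α e) (Er.Simple.tails s) (Er.cycle O o (λ p → p) s)
        where
        module Er = Erase O (α e)
        forth : dr O e (α e)
        forth = not-f fails
          where
          fails : dreach O e (α e) ≡ false → ⊥
          fails q with walk (dreach O e) (reach≈ O e) e (α e) (trans (dr-refl O e) (cong not (sym q)))
          ... | f , u , inj₁ (c , d , _) = ext-active u x a (c , d)
          ... | f , u , inj₂ (c , d , p , r) with upCase u
          ... | toggled z _ = int-active u x (A-act z) (c , d)
          ... | plain _ o′ = t≢f (dr-α O (trans p (dr-refl O e)) o′) (trans r q)
          ... | onCycle _ _ _ y z _ = t≢f z (noExt y)
        s : Er.Simple (α (α e))
        s = subst Er.Simple (sym (α-invol e)) (Er.simple-path forth)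
      bad : Act e ≡ true → ⊥
      bad a with extCase x
      ... | toggled z _ = t≢f z (noExt x)
      ... | plain _ o _ = Oαe o a
      ... | onCocycle c _ _ u z d = ext-active u x a d

  -- Bijectivity between subgraphs and orientations.

  orientations : List (Vec Bool n)
  orientations = filterᵇ isOrientation (allVecs n)

  ∈-sub⁺ : ∀ {S} → Sub S → S ∈ allSubgraphs
  ∈-sub⁺ {S} s = ∈-filterᵇ⁺ isSubgraph (∈-allVecs S) (⇒sub s)

  ∈-sub⁻ : ∀ {S} → S ∈ allSubgraphs → Sub S
  ∈-sub⁻ {S} i = sub⇒ S (proj₂ (∈-filterᵇ⁻ isSubgraph {allVecs n} i))

  subgraphs-unique : Unique allSubgraphs
  subgraphs-unique = unique-filterᵇ isSubgraph (allVecs-unique n)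

  orientation⇒ : ∀ {O} → isOrientation O ≡ true → ∀ h → lookup O h ≡ not (lookup O (α h))
  orientation⇒ e h = xor-diff (allF _ e h)

  -- Comparison with the orientation `canon` by exclusive or turns an orientation into the set of
  -- edges on which the two relate in a fixed way, hence into a subgraph.
  orientations-≤ : length orientations ≤ length allSubgraphs
  orientations-≤ = rel-pigeon (λ O S → toS O ≡ S) orientations allSubgraphs
      (λ O i → toS O , ∈-sub⁺ (toS-sub O (proj₂ (∈-filterᵇ⁻ isOrientation {allVecs n} i))) , refl)
      (∈⇒AllPairs (unique-filterᵇ isOrientation (allVecs-unique n))
          (λ O O' _ _ ne S e e' → ne (toS-inj (trans e (sym e')))))
    where
    toS : Vec Bool n → Vec Bool n
    toS O = tabulate (λ h → lookup O h xor canon h)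
    canon-flip : ∀ h → canon h ≡ not (canon (α h))
    canon-flip h with canon-or h
    ... | inj₁ c = trans c (cong not (sym (canon-not h c)))
    ... | inj₂ c = trans (trans (cong canon (sym (α-invol h))) (canon-not (α h) c)) (cong not (sym c))
    toS-sub : ∀ O → isOrientation O ≡ true → Sub (toS O)
    toS-sub O o .inv h = trans (lookup∘tabulate _ h) (trans (trans
        (cong₂ _xor_ (orientation⇒ {O} o h) (canon-flip h)) (nots (lookup O (α h)) (canon (α h))))
        (sym (lookup∘tabulate _ (α h))))
      where
      nots : ∀ a b → not a xor not b ≡ a xor b
      nots true true = refl
      nots true false = refl
      nots false true = refl
      nots false false = refl
    toS-inj : ∀ {O O'} → toS O ≡ toS O' → O ≡ O'
    toS-inj {O} {O'} e = vec-ext (λ h → xor-cancelʳ (canon h)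
        (trans (sym (lookup∘tabulate _ h)) (trans (cong (λ v → lookup v h) e) (lookup∘tabulate _ h))))

  opaque
    -- the spanning tree whose interval contains S (arbitrary when S is not a subgraph)
    tr : Vec Bool n → Vec Bool n
    tr S with tf-dec (isSubgraph S)
    ... | inj₁ p = proj₁ (in-some-interval S (sub⇒ S p))
    ... | inj₂ _ = S

    tr-interval : ∀ {S} → Sub S → Interval (tr S) S
    tr-interval {S} s with tf-dec (isSubgraph S)
    ... | inj₁ p = proj₂ (in-some-interval S (sub⇒ S p))
    ... | inj₂ p = ⊥-elim (t≢f (⇒sub s) p)

    ψ : Vec Bool n → Vec Bool n
    ψ S = Φ (tr S) S

    ψ-isΦ : ∀ S → IsΦ (tr S) S (ψ S)
    ψ-isΦ S = mkΦ refl

  Φ-orientation : ∀ {T S O} → Interval T S → IsΦ T S O → isOrientation O ≡ true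
  Φ-orientation {T} {S} {O} iv φ = allF⁺ _ (λ h → go (Pair.O-flip T S O iv φ h))
    where
    go : ∀ {a b} → a ≡ not b → a xor b ≡ true
    go {true} {false} _ = refl
    go {false} {true} _ = refl

  ψ-injective : ∀ {S S'} → Sub S → Sub S' → ψ S ≡ ψ S' → S ≡ S'
  ψ-injective {S} {S'} s s' e = proj₂ (Φ-injective (tr-interval s) (ψ-isΦ S) (tr-interval s')
      (subst (IsΦ (tr S') S') (sym e) (ψ-isΦ S')))

  private
    maps : List (Vec Bool n)
    maps = map ψ allSubgraphs

    maps-unique : Unique maps
    maps-unique = map-unique ψ subgraphs-unique (λ S S' i j → ψ-injective (∈-sub⁻ i) (∈-sub⁻ j))

  -- An orientation outside the image would make the injective image of all subgraphs too large.
  ψ-surjective : ∀ {O} → isOrientation O ≡ true → ∃ λ S → Sub S × ψ S ≡ O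
  ψ-surjective {O} o with any? (λ V → ≡-dec 𝔹ₚ._≟_ O V) maps
  ... | yes i = let S , j , e = ∈-map⁻ ψ i in S , ∈-sub⁻ j , sym e
  ... | no out = ⊥-elim (ℕₚ.<-irrefl refl (ℕₚ.≤-trans (subst (_≤ length orientations)
      (cong suc (Listₚ.length-map ψ allSubgraphs)) bigger) orientations-≤))
    where
    bigger : length (O ∷ maps) ≤ length orientations
    bigger = rel-pigeon _≡_ (O ∷ maps) orientations inside
      (∈⇒AllPairs (All.tabulate (λ i e → out (subst (_∈ maps) (sym e) i)) ∷ maps-unique)
          (λ V W _ _ ne Z e e' → ne (trans e (sym e'))))
      where
      inside : ∀ V → V ∈ (O ∷ maps) → ∃ λ W → W ∈ orientations × V ≡ W
      inside V (here refl) = V , ∈-filterᵇ⁺ isOrientation (∈-allVecs V) o , refl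
      inside V (there i) with ∈-map⁻ ψ i
      ... | S , j , refl = ψ S , ∈-filterᵇ⁺ isOrientation (∈-allVecs (ψ S))
          (Φ-orientation (tr-interval (∈-sub⁻ j)) (ψ-isΦ S)) , refl

  -- The orientation of `(T, S)` is also that of some `(tr S', S')`, and injectivity on pairs
  -- identifies both components.
  interval-unique : ∀ {T S} → Interval T S → T ≡ tr S
  interval-unique {T} {S} iv with ψ-surjective (Φ-orientation iv (mkΦ {T} {S} refl))
  ... | S' , s' , e with Φ-injective iv (mkΦ refl) (tr-interval s') (subst (IsΦ (tr S') S') e (ψ-isΦ S'))
  ... | refl , refl = refl

  -- `RC`, `RSC` and `Minimal` assert only that some tree of the orientation has the property; this
  -- pins the tree down to `tr S`.
  treeOf-unique : ∀ {T S O} → Sub S → ψ S ≡ O → TreeOf O T → T ≡ tr S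
  treeOf-unique {T} {S} {O} s e (S' , iv , φ) = proj₁ (Φ-injective (interval⇒ {T} {S'} iv) (mkΦ {T} {S'} φ)
      (tr-interval s) (subst (IsΦ (tr S) S) e (ψ-isΦ S)))

  treeOf-tr : ∀ {S} → Sub S → TreeOf (ψ S) (tr S)
  treeOf-tr {S} s = S , ⇒interval (tr-interval s) , unΦ (ψ-isΦ S)

  -- Summation over the states of active edges.

  -- Activities by kind: κ = true for internal, κ = false for external

  togK : Bool → Vec Bool n → Vec Bool n → Fin n → Bool
  togK true = toggledInt
  togK false = toggledExt

  actK : Bool → Vec Bool n → Fin n → Bool
  actK true = activeInt
  actK false = activeExt

  edges : List (Fin n)
  edges = filterᵇ canon H

  opaque
    tog : Bool → Vec Bool n → Fin n → Bool
    tog κ S = togK κ (tr S) S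

    act : Bool → Vec Bool n → Fin n → Bool
    act κ S = actK κ (tr S)

    nTog nAct : Bool → Vec Bool n → ℕ
    nTog κ S = ecount (togK κ (tr S) S)
    nAct κ S = ecount (actK κ (tr S))

    nTog≡ : ∀ κ S → nTog κ S ≡ ecount (togK κ (tr S) S)
    nTog≡ κ S = refl

    nAct≡ : ∀ κ S → nAct κ S ≡ ecount (actK κ (tr S))
    nAct≡ κ S = refl

    nTog-edges : ∀ κ S → nTog κ S ≡ count (tog κ S) edges
    nTog-edges κ S = count-∧-filterᵇ (tog κ S) canon H

    nAct-edges : ∀ κ S → nAct κ S ≡ count (act κ S) edges
    nAct-edges κ S = count-∧-filterᵇ (act κ S) canon H

    tog⇒act : ∀ κ {S} → Sub S → ∀ {h} → tog κ S h ≡ true → act κ S h ≡ true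
    tog⇒act true {S} s {h} p = ∧-intro (∧-fst p) (iact (tr-interval s) h (∧-snd {lookup (tr S) h} p))
    tog⇒act false {S} s {h} p = ∧-intro (∧-fst p) (iact (tr-interval s) h (∧-snd {not (lookup (tr S) h)} p))

  flip : Fin n → Vec Bool n → Vec Bool n
  flip e S = tabulate (λ x → lookup S x xor sameEdge x e)

  lookup-flip : ∀ e S x → lookup (flip e S) x ≡ lookup S x xor sameEdge x e
  lookup-flip e S x = lookup∘tabulate _ x

  flip-sub : ∀ {e S} → Sub S → Sub (flip e S)
  flip-sub {e} {S} s .inv x = trans (lookup-flip e S x) (trans (cong₂ _xor_ (inv s x) (sameEdge-inv x e))
      (sym (lookup-flip e S (α x))))

  flip-flip : ∀ e S → flip e (flip e S) ≡ S
  flip-flip e S = vec-ext (λ x → trans (lookup-flip e (flip e S) x)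
      (trans (cong (_xor sameEdge x e) (lookup-flip e S x)) (cancel (lookup S x) (sameEdge x e))))
    where
    cancel : ∀ a b → (a xor b) xor b ≡ a
    cancel true true = refl
    cancel true false = refl
    cancel false true = refl
    cancel false false = refl

  module _ {S : Vec Bool n} (s : Sub S) {κ : Bool} {e : Fin n} where

    opaque
      unfolding tog

      private
        kind : ∀ κ' T → Sub T → ∀ {h} → sameEdge h e ≡ true → actK κ' T e ≡ true → actK κ' T h ≡ true
        kind κ' T sT {h} q p with sameEdge⇒ {h} {e} q
        ... | inj₁ refl = p
        kind true T sT q p | inj₂ refl = ∧-intro (trans (sym (inv sT e)) (∧-fst p))
            (trans (active-α sT e) (∧-snd {lookup T e} p))
        kind false T sT q p | inj₂ refl = ∧-intro (trans (cong not (sym (inv sT e))) (∧-fst p))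
            (trans (active-α sT e) (∧-snd {not (lookup T e)} p))

        act⇒active : ∀ κ' T {h} → actK κ' T h ≡ true → active T h ≡ true
        act⇒active true T {h} p = ∧-snd {lookup T h} p
        act⇒active false T {h} p = ∧-snd {not (lookup T h)} p

      flip-interval : act κ S e ≡ true → Interval (tr S) (flip e S)
      flip-interval p .itree = itree (tr-interval s)
      flip-interval p .isub = flip-sub s
      flip-interval p .iact h q with tf-dec (sameEdge h e)
      ... | inj₁ he = act⇒active κ (tr S) (kind κ (tr S) (tree-sub (itree (tr-interval s))) he p)
      ... | inj₂ he = iact (tr-interval s) h (trans (cong (_xor lookup (tr S) h)
          (sym (trans (lookup-flip e S h) (trans (cong (lookup S h xor_) he) (𝔹ₚ.xor-identityʳ (lookup S h)))))) q)

      -- Disjointness of the intervals enters the sums here: both subgraphs lie in the interval of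
      -- `tr S`, so they share the activities.
      flip-tr : act κ S e ≡ true → tr (flip e S) ≡ tr S
      flip-tr p = sym (interval-unique (flip-interval p))

      flip-act : act κ S e ≡ true → ∀ κ' h → act κ' (flip e S) h ≡ act κ' S h
      flip-act p κ' h = cong (λ T → actK κ' T h) (flip-tr p)

      flip-tog-off : act κ S e ≡ true → ∀ κ' h → sameEdge h e ≡ false → tog κ' (flip e S) h ≡ tog κ' S h
      flip-tog-off p κ' h he = trans (cong (λ T → togK κ' T (flip e S) h) (flip-tr p)) (go κ')
        where
        go : ∀ κ' → togK κ' (tr S) (flip e S) h ≡ togK κ' (tr S) S h
        go true rewrite lookup-flip e S h | he | 𝔹ₚ.xor-identityʳ (lookup S h) = refl
        go false rewrite lookup-flip e S h | he | 𝔹ₚ.xor-identityʳ (lookup S h) = refl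

      flip-tog-on : act κ S e ≡ true → tog κ (flip e S) e ≡ not (tog κ S e)
      flip-tog-on p = trans (cong (λ T → togK κ T (flip e S) e) (flip-tr p)) (go κ p)
        where
        xor-true : ∀ a b → (a xor true) xor b ≡ not (a xor b)
        xor-true true true = refl
        xor-true true false = refl
        xor-true false true = refl
        xor-true false false = refl
        go : ∀ κ → actK κ (tr S) e ≡ true → togK κ (tr S) (flip e S) e ≡ not (togK κ (tr S) S e)
        go true q rewrite lookup-flip e S e | sameEdge-refl e | ∧-fst {lookup (tr S) e} q = xor-true (lookup S e) true
        go false q rewrite lookup-flip e S e | sameEdge-refl e | ∧-fst {not (lookup (tr S) e)} q = xor-true
            (lookup S e) (lookup (tr S) e)

      flip-tog-other : act κ S e ≡ true → ∀ h → tog (not κ) (flip e S) h ≡ tog (not κ) S h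
      flip-tog-other p h with tf-dec (sameEdge h e)
      ... | inj₂ he = flip-tog-off p (not κ) h he
      ... | inj₁ he = trans (cong (λ T → togK (not κ) T (flip e S) h) (flip-tr p))
          (go κ (kind κ (tr S) (tree-sub (itree (tr-interval s))) he p))
        where
        go : ∀ κ → actK κ (tr S) h ≡ true → togK (not κ) (tr S) (flip e S) h ≡ togK (not κ) (tr S) S h
        go true q rewrite ∧-fst {lookup (tr S) h} q = refl
        go false q rewrite not-≡f (∧-fst {not (lookup (tr S) h)} q) = refl

    flip-nTog-other : act κ S e ≡ true → nTog (not κ) (flip e S) ≡ nTog (not κ) S
    flip-nTog-other p = trans (nTog-edges (not κ) (flip e S))
        (trans (count-cong _ _ edges (λ h _ → flip-tog-other p h)) (sym (nTog-edges (not κ) S)))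

    flip-nAct : act κ S e ≡ true → ∀ κ' → nAct κ' (flip e S) ≡ nAct κ' S
    flip-nAct p κ' = trans (nAct-edges κ' (flip e S)) (trans (count-cong _ _ edges (λ h _ → flip-act p κ' h))
        (sym (nAct-edges κ' S)))

  -- Summing over the two states of one active edge at a time, using (z - 1) + 1 = z.
  module Reduce (κ : Bool) (c : Vec Bool n → ℕ → ℕ → ℤ)
    (rec : ∀ S u m → c S (suc u) m +ℤ c S u m ≡ c S u (suc m))
    (stable : ∀ {S e} → Sub S → act κ S e ≡ true → ∀ u m → c (flip e S) u m ≡ c S u m) where

    val : List (Fin n) → List (Fin n) → Vec Bool n → ℤ
    val done todo S = if count (tog κ S) done ≡ᵇ 0 then c S (count (tog κ S) todo) (count (act κ S) done) else + 0

    private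
      -- `b` is the state of the processed edge in `S` and `not b` its state in the partner. If
      -- something in `done` is toggled, all terms vanish; otherwise this is `rec`.
      algebra : ∀ S b d u m →
        (if d ≡ᵇ 0 then c S (𝟙 b + u) m else + 0) +ℤ (if d ≡ᵇ 0 then c S (𝟙 (not b) + u) m else + 0) ≡
        (if (𝟙 b + d) ≡ᵇ 0 then c S u (suc m) else + 0) +ℤ (if (𝟙 (not b) + d) ≡ᵇ 0 then c S u (suc m) else + 0)
      algebra S true zero u m = trans (rec S u m) (sym (ℤₚ.+-identityˡ _))
      algebra S false zero u m = trans (ℤₚ.+-comm (c S u m) _) (trans (rec S u m) (sym (ℤₚ.+-identityʳ _)))
      algebra S true (suc d) u m = refl
      algebra S false (suc d) u m = refl

      val≡ : ∀ S done todo {d u m c'} → count (tog κ S) done ≡ d → count (tog κ S) todo ≡ u → count (act κ S) done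
          ≡ m →
             c S u m ≡ c' → val done todo S ≡ (if d ≡ᵇ 0 then c' else + 0)
      val≡ S done todo refl refl refl refl = refl

    step : ∀ e done todo → (∀ x → x ∈ done → sameEdge x e ≡ false) → (∀ x → x ∈ todo → sameEdge x e ≡ false) →
           sumOver (val done (e ∷ todo)) allSubgraphs ≡ sumOver (val (e ∷ done) todo) allSubgraphs
    step e done todo off-done off-todo = sumOver-involution _ _ τ subgraphs-unique
        (λ S i → ∈-sub⁺ (τ-sub (∈-sub⁻ i))) (λ S i → τ-τ (∈-sub⁻ i)) (λ S i → pt (∈-sub⁻ i))
      where
      -- Although activity of `e` depends on `S`, this is an involution, because flipping `e` does
      -- not change activities.
      τ : Vec Bool n → Vec Bool n
      τ S = if act κ S e then flip e S else S
      τ-on : ∀ {S} → act κ S e ≡ true → τ S ≡ flip e S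
      τ-on {S} p = cong (λ b → if b then flip e S else S) p
      τ-off : ∀ {S} → act κ S e ≡ false → τ S ≡ S
      τ-off {S} p = cong (λ b → if b then flip e S else S) p
      τ-sub : ∀ {S} → Sub S → Sub (τ S)
      τ-sub {S} s with act κ S e
      ... | true = flip-sub s
      ... | false = s
      τ-τ : ∀ {S} → Sub S → τ (τ S) ≡ S
      τ-τ {S} s with tf-dec (act κ S e)
      ... | inj₂ p = trans (cong τ (τ-off p)) (τ-off p)
      ... | inj₁ p = trans (cong τ (τ-on p)) (trans (τ-on (trans (flip-act s {κ} p κ e) p)) (flip-flip e S))
      pt : ∀ {S} → Sub S → val done (e ∷ todo) S +ℤ val done (e ∷ todo) (τ S) ≡ val (e ∷ done) todo S +ℤ val
          (e ∷ done) todo (τ S)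
      pt {S} s with tf-dec (act κ S e)
      ... | inj₂ p = trans (cong (λ z → val done (e ∷ todo) S +ℤ val done (e ∷ todo) z) (τ-off p))
              (trans (cong₂ _+ℤ_ same same) (cong (λ z → val (e ∷ done) todo S +ℤ val (e ∷ done) todo z)
                  (sym (τ-off p))))
        where
        tog-off : tog κ S e ≡ false
        tog-off = not-t (λ q → t≢f (tog⇒act κ s q) p)
        count-off : ∀ xs → count (tog κ S) (e ∷ xs) ≡ count (tog κ S) xs
        count-off xs = trans (count-∷ (tog κ S) e xs) (cong (λ b → 𝟙 b + count (tog κ S) xs) tog-off)
        same : val done (e ∷ todo) S ≡ val (e ∷ done) todo S
        same = trans (val≡ S done (e ∷ todo) refl (count-off todo) refl refl)
          (sym (val≡ S (e ∷ done) todo (count-off done) refl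
              (trans (count-∷ (act κ S) e done) (cong (λ b → 𝟙 b + count (act κ S) done) p)) refl))
      ... | inj₁ p = trans (cong₂ _+ℤ_
              (val≡ S done (e ∷ todo) refl (count-∷ (tog κ S) e todo) refl refl)
              (trans (cong (val done (e ∷ todo)) (τ-on p)) (val≡ S' done (e ∷ todo) (tog-same done off-done)
                  (trans (count-∷ (tog κ S') e todo) (cong₂ (λ b k → 𝟙 b + k) on (tog-same todo off-todo)))
                  (act-same done) (stable s p _ _))))
            (trans (algebra S (tog κ S e) (count (tog κ S) done) (count (tog κ S) todo) (count (act κ S) done))
            (sym (cong₂ _+ℤ_
              (val≡ S (e ∷ done) todo (count-∷ (tog κ S) e done) refl act-suc refl)
              (trans (cong (val (e ∷ done) todo) (τ-on p)) (val≡ S' (e ∷ done) todo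
                  (trans (count-∷ (tog κ S') e done) (cong₂ (λ b k → 𝟙 b + k) on (tog-same done off-done)))
                 (tog-same todo off-todo) (trans (act-same (e ∷ done)) act-suc) (stable s p _ _))))))
        where
        S' : Vec Bool n
        S' = flip e S
        on : tog κ S' e ≡ not (tog κ S e)
        on = flip-tog-on s {κ} p
        tog-same : ∀ xs → (∀ x → x ∈ xs → sameEdge x e ≡ false) → count (tog κ S') xs ≡ count (tog κ S) xs
        tog-same xs off = count-cong _ _ xs (λ x i → flip-tog-off s {κ} p κ x (off x i))
        act-same : ∀ xs → count (act κ S') xs ≡ count (act κ S) xs
        act-same xs = count-cong _ _ xs (λ x _ → flip-act s {κ} p κ x)
        act-suc : count (act κ S) (e ∷ done) ≡ suc (count (act κ S) done)
        act-suc = trans (count-∷ (act κ S) e done) (cong (λ b → 𝟙 b + count (act κ S) done) p)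

    private
      off : ∀ {x e} → canon x ≡ true → canon e ≡ true → x ≢ e → sameEdge x e ≡ false
      off {x} {e} cx ce ne = sameEdge-no {x} {e} ne (λ { refl → t≢f cx (canon-not e ce) })

      -- The edges are processed in an order common to all subgraphs, while each subgraph decides
      -- which of them are active.
      steps : ∀ todo done → Unique todo → (∀ x → x ∈ todo → canon x ≡ true) → (∀ x → x ∈ done → canon x ≡ true) →
              (∀ x y → x ∈ todo → y ∈ done → x ≢ y) → sumOver (val done todo) allSubgraphs ≡ sumOver
                  (val (todo ʳ++ done) []) allSubgraphs
      steps [] done _ _ _ _ = refl
      steps (e ∷ todo) done (u ∷ us) ct cd dis = trans
        (step e done todo (λ x i → off (cd x i) (ct e (here refl)) (λ q → dis e x (here refl) i (sym q)))
                          (λ x i → off (ct x (there i)) (ct e (here refl)) (λ q → All.lookup u i (sym q))))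
        (steps todo (e ∷ done) us (λ x i → ct x (there i)) (λ
            { x (here refl) → ct e (here refl) ; x (there i) → cd x i })
          (λ { x y i (here refl) q → All.lookup u i (sym q) ; x y i (there j) → dis x y (there i) j }))

    reduced : sumOver (λ S → c S (nTog κ S) 0) allSubgraphs ≡
              sumOver (λ S → if nTog κ S ≡ᵇ 0 then c S 0 (nAct κ S) else + 0) allSubgraphs
    reduced = trans (sumOver-cong _ _ allSubgraphs (λ S _ → cong (λ k → c S k 0) (nTog-edges κ S)))
      (trans (steps edges [] (unique-filterᵇ canon uniqueF) (λ x i → proj₂ (∈-filterᵇ⁻ canon {H} i)) (λ x ())
          (λ x y _ ()))
      (sumOver-cong _ _ allSubgraphs (λ S _ → cong₂ (λ a b → if a ≡ᵇ 0 then c S 0 b else + 0)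
        (trans (count-ʳ++ (tog κ S) edges []) (trans (ℕₚ.+-identityʳ _) (sym (nTog-edges κ S))))
        (trans (count-ʳ++ (act κ S) edges []) (trans (ℕₚ.+-identityʳ _) (sym (nAct-edges κ S)))))))

  -- The six coefficient identities.

  module OfSubgraph {S : Vec Bool n} (s : Sub S) where
    private
      module F = PairCycles (tr S) S (ψ S) (tr-interval s) (ψ-isΦ S)

    numComp≡nTog : numComp S ∸ 1 ≡ nTog true S
    numComp≡nTog = trans (cong (_∸ 1) F.numComp-S) (sym (nTog≡ true S))

    nullity≡nTog : numE S + numComp S ∸ numV ≡ nTog false S
    nullity≡nTog = trans F.nullity-S (sym (nTog≡ false S))

    RC⇒ : ∀ {i} → RC i (ψ S) → nTog true S ≡ i
    RC⇒ (T , tO , e) with treeOf-unique {T} {S} {ψ S} s refl tO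
    ... | refl = ℕₚ.suc-injective (trans (cong suc (nTog≡ true S)) (trans (sym F.numRootComps≡) e))

    RC⇐ : ∀ {i} → nTog true S ≡ i → RC i (ψ S)
    RC⇐ e = tr S , treeOf-tr s , trans F.numRootComps≡ (cong suc (trans (sym (nTog≡ true S)) e))

    connected⇒ : v0Connected (ψ S) ≡ true → nTog true S ≡ 0
    connected⇒ p = trans (nTog≡ true S) (F.noInt⇐ (F.v0Connected⇒ p))

    connected⇐ : nTog true S ≡ 0 → v0Connected (ψ S) ≡ true
    connected⇐ e = F.v0Connected⇐ (F.noInt⇒ (trans (sym (nTog≡ true S)) e))

    RSC⇒ : ∀ {i} → nTog true S ≡ 0 → RSC i (ψ S) → nAct true S ≡ i
    RSC⇒ z (T , tO , e) with treeOf-unique {T} {S} {ψ S} s refl tO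
    ... | refl = ℕₚ.suc-injective (trans (cong suc (nAct≡ true S))
        (trans (sym (F.Rooted.numRootStrongComps≡ (F.noInt⇒ (trans (sym (nTog≡ true S)) z)))) e))

    RSC⇐ : ∀ {i} → nTog true S ≡ 0 → nAct true S ≡ i → RSC i (ψ S)
    RSC⇐ z e = tr S , treeOf-tr s , trans (F.Rooted.numRootStrongComps≡ (F.noInt⇒ (trans (sym (nTog≡ true S)) z)))
        (cong suc (trans (sym (nAct≡ true S)) e))

    minimal-⇒ : Minimal (ψ S) → nTog false S ≡ 0
    minimal-⇒ (T , tO , m) with treeOf-unique {T} {S} {ψ S} s refl tO
    ... | refl = trans (nTog≡ false S) (F.noExt⇐ (F.minimal⇒ m))

    minimal-⇐ : nTog false S ≡ 0 → Minimal (ψ S)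
    minimal-⇐ e = tr S , treeOf-tr s , F.minimal⇐ (F.noExt⇒ (trans (sym (nTog≡ false S)) e))

    acyclic-⇒ : Acyclic (ψ S) → nTog false S ≡ 0 × nAct false S ≡ 0
    acyclic-⇒ a = trans (nTog≡ false S) (F.noExt⇐ (λ x → not-t (λ p → t≢f (F.A-act p) (F.acyclic⇒ a x))))
                , trans (nAct≡ false S) (F.noActExt⇐ (F.acyclic⇒ a))

    acyclic-⇐ : nAct false S ≡ 0 → Acyclic (ψ S)
    acyclic-⇐ e = F.acyclic⇐ (F.noActExt⇒ (trans (sym (nAct≡ false S)) e))

    oriented : isOrientation (ψ S) ≡ true
    oriented = Φ-orientation (tr-interval s) (ψ-isΦ S)

  coeff-tutteAt : ∀ X y i → coeff (tutteAt X y) i ≡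
    sumOver (λ S → coeff ((X +P constP (- + 1)) ^P nTog true S) i *ℤ (y -ℤ + 1) ^ℤ nTog false S) allSubgraphs
  coeff-tutteAt X y i = trans (coeff-sumP _ allSubgraphs i) (sumOver-cong _ _ allSubgraphs (λ S j →
    trans (coeff-*constP ((X +P constP (- + 1)) ^P (numComp S ∸ 1)) _ i)
      (cong₂ (λ k l → coeff ((X +P constP (- + 1)) ^P k) i *ℤ (y -ℤ + 1) ^ℤ l)
        (OfSubgraph.numComp≡nTog (∈-sub⁻ j)) (OfSubgraph.nullity≡nTog (∈-sub⁻ j)))))

  -- The orientations with property `Q i` are listed as the image under `ψ` of the subgraphs passing
  -- the Boolean test `χ i`, so the coefficient only has to count those subgraphs.
  coeffsCount : ∀ P (Q : ℕ → Vec Bool n → Set) (χ : ℕ → Vec Bool n → Bool) →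
    (∀ i → coeff P i ≡ sumOver (λ S → ⟦ χ i S ⟧) allSubgraphs) → (∀ i O → Q i O → isOrientation O ≡ true) →
    (∀ i S → Sub S → χ i S ≡ true → Q i (ψ S)) → (∀ i S → Sub S → Q i (ψ S) → χ i S ≡ true) → CoeffsCount P Q
  coeffsCount P Q χ sums ori to from i = count (χ i) allSubgraphs ,
    (map ψ L , map-unique ψ (unique-filterᵇ (χ i) subgraphs-unique) (λ S S' j k → ψ-injective (subL j) (subL k)) ,
      (λ O → mk⇔ (mem⇒ O) (mem⇐ O)) , Listₚ.length-map ψ L) ,
    trans (sums i) (sumOver-count (χ i) allSubgraphs)
    where
    L : List (Vec Bool n)
    L = filterᵇ (χ i) allSubgraphs
    subL : ∀ {S} → S ∈ L → Sub S
    subL j = ∈-sub⁻ (proj₁ (∈-filterᵇ⁻ (χ i) {allSubgraphs} j))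
    mem⇒ : ∀ O → O ∈ map ψ L → Q i O
    mem⇒ O j with ∈-map⁻ ψ j
    ... | S , k , refl = to i S (subL k) (proj₂ (∈-filterᵇ⁻ (χ i) {allSubgraphs} k))
    mem⇐ : ∀ O → Q i O → O ∈ map ψ L
    mem⇐ O q with ψ-surjective {O} (ori i O q)
    ... | S , s , refl = ∈-map⁺ ψ (∈-filterᵇ⁺ (χ i) (∈-sub⁺ s) (from i S s q))

  int0 ext0 actExt0 : Vec Bool n → Bool
  int0 S = nTog true S ≡ᵇ 0
  ext0 S = nTog false S ≡ᵇ 0
  actExt0 S = nAct false S ≡ᵇ 0

  int≡ actInt≡ : ℕ → Vec Bool n → Bool
  int≡ i S = nTog true S ≡ᵇ i
  actInt≡ i S = nAct true S ≡ᵇ i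

  1^ : ∀ k → (+ 1) ^ℤ k ≡ + 1
  1^ = ℤₚ.^-zeroˡ

  signed-0 : ∀ m → signed 0 m ≡ ⟦ m ≡ᵇ 0 ⟧
  signed-0 m = trans (ℤₚ.*-identityˡ _) (0^ m)

  sum-12 : ∀ i → coeff (tutteAt onePlusX (+ 2)) i ≡ sumOver (λ S → ⟦ int≡ i S ⟧) allSubgraphs
  sum-12 i = trans (coeff-tutteAt onePlusX (+ 2) i) (sumOver-cong _ _ allSubgraphs (λ S _ →
    trans (cong₂ _*ℤ_ (coeff-x^ (nTog true S) i) (1^ (nTog false S))) (ℤₚ.*-identityʳ _)))

  sum-11 : ∀ i → coeff (tutteAt onePlusX (+ 1)) i ≡ sumOver (λ S → ⟦ int≡ i S ∧ ext0 S ⟧) allSubgraphs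
  sum-11 i = trans (coeff-tutteAt onePlusX (+ 1) i) (sumOver-cong _ _ allSubgraphs (λ S _ →
    trans (cong₂ _*ℤ_ (coeff-x^ (nTog true S) i) (0^ (nTog false S))) (⟦⟧-∧ (int≡ i S) (ext0 S))))

  module Ext0 (B : Vec Bool n → Bool) (B-flip : ∀ {S e} → Sub S → act false S e ≡ true → B (flip e S) ≡ B S) where

    -- Flipping an active external edge changes the sign and, by `B-flip`, not `B`. Subgraphs whose
    -- tree has an active external edge cancel, and the remaining ones have no toggled external edge
    -- and count once.
    sum-ext : sumOver (λ S → ⟦ B S ⟧ *ℤ (- + 1) ^ℤ nTog false S) allSubgraphs ≡
              sumOver (λ S → ⟦ ext0 S ∧ (B S ∧ actExt0 S) ⟧) allSubgraphs
    sum-ext = trans (sumOver-cong _ _ allSubgraphs (λ S _ → cong (⟦ B S ⟧ *ℤ_) (sym (ℤₚ.*-identityʳ _))))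
      (trans (Reduce.reduced false (λ S u m → ⟦ B S ⟧ *ℤ signed u m) rec
          (λ s p u m → cong (λ b → ⟦ b ⟧ *ℤ signed u m) (B-flip s p)))
      (sumOver-cong _ _ allSubgraphs (λ S _ → trans
        (cong (λ z → if ext0 S then z else + 0) (trans (cong (⟦ B S ⟧ *ℤ_) (signed-0 (nAct false S)))
            (⟦⟧-∧ (B S) (actExt0 S))))
        (if-⟦⟧ (ext0 S) (B S ∧ actExt0 S)))))
      where
      rec : ∀ S u m → ⟦ B S ⟧ *ℤ signed (suc u) m +ℤ ⟦ B S ⟧ *ℤ signed u m ≡ ⟦ B S ⟧ *ℤ signed u (suc m)
      rec S u m = trans (sym (ℤₚ.*-distribˡ-+ ⟦ B S ⟧ (signed (suc u) m) (signed u m)))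
          (cong (⟦ B S ⟧ *ℤ_) (signed-rec u m))

  sum-10 : ∀ i → coeff (tutteAt onePlusX (+ 0)) i ≡ sumOver (λ S → ⟦ ext0 S ∧ (int≡ i S ∧ actExt0 S) ⟧) allSubgraphs
  sum-10 i = trans (coeff-tutteAt onePlusX (+ 0) i) (trans
    (sumOver-cong _ _ allSubgraphs (λ S _ → cong (_*ℤ (- + 1) ^ℤ nTog false S) (coeff-x^ (nTog true S) i)))
    (Ext0.sum-ext (int≡ i) (λ s p → cong (_≡ᵇ i) (flip-nTog-other s {false} p))))

  -- The external weight `w` can be arbitrary, since flipping an active tree edge leaves
  -- `nTog false` alone. It is specialised to the powers of 1, 0 and -1 that belong to y = 2, 1 and
  -- 0.
  sum-int : ∀ (w : ℕ → ℤ) i → sumOver (λ S → coeff ((- + 1 ∷ + 1 ∷ []) ^P nTog true S) i *ℤ w (nTog false S))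
      allSubgraphs ≡
            sumOver (λ S → ⟦ int0 S ∧ actInt≡ i S ⟧ *ℤ w (nTog false S)) allSubgraphs
  sum-int w i = trans (sumOver-cong _ _ allSubgraphs (λ S _ → cong (_*ℤ w (nTog false S))
      (coeff-[x-1]^ (nTog true S) i)))
    (trans (Reduce.reduced true (λ S u m → shifted u m i *ℤ w (nTog false S)) rec
             (λ s p u m → cong (λ k → shifted u m i *ℤ w k) (flip-nTog-other s {true} p)))
    (sumOver-cong _ _ allSubgraphs (λ S _ → pull (int0 S) (actInt≡ i S) (w (nTog false S)))))
    where
    rec : ∀ S u m → shifted (suc u) m i *ℤ w (nTog false S) +ℤ shifted u m i *ℤ w (nTog false S) ≡ shifted u
        (suc m) i *ℤ w (nTog false S)
    rec S u m = solve 3 (λ a b c → (a :- b) :* c :+ b :* c := a :* c) refl (shifted u (suc m) i) (shifted u m i)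
        (w (nTog false S))
      where open +-*-Solver
    pull : ∀ a b z → (if a then ⟦ b ⟧ *ℤ z else + 0) ≡ ⟦ a ∧ b ⟧ *ℤ z
    pull true b z = refl
    pull false b z = refl

  sum-02 : ∀ i → coeff (tutteAt varX (+ 2)) i ≡ sumOver (λ S → ⟦ int0 S ∧ actInt≡ i S ⟧) allSubgraphs
  sum-02 i = trans (coeff-tutteAt varX (+ 2) i) (trans (sum-int ((+ 1) ^ℤ_) i) (sumOver-cong _ _ allSubgraphs (λ S _ →
    trans (cong (⟦ int0 S ∧ actInt≡ i S ⟧ *ℤ_) (1^ (nTog false S))) (ℤₚ.*-identityʳ _))))

  sum-01 : ∀ i → coeff (tutteAt varX (+ 1)) i ≡ sumOver (λ S → ⟦ (int0 S ∧ actInt≡ i S) ∧ ext0 S ⟧) allSubgraphs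
  sum-01 i = trans (coeff-tutteAt varX (+ 1) i) (trans (sum-int ((+ 0) ^ℤ_) i) (sumOver-cong _ _ allSubgraphs (λ S _ →
    trans (cong (⟦ int0 S ∧ actInt≡ i S ⟧ *ℤ_) (0^ (nTog false S))) (⟦⟧-∧ (int0 S ∧ actInt≡ i S) (ext0 S)))))

  sum-00 : ∀ i → coeff (tutteAt varX (+ 0)) i ≡ sumOver (λ S → ⟦ ext0 S ∧ ((int0 S ∧ actInt≡ i S) ∧ actExt0 S) ⟧)
      allSubgraphs
  sum-00 i = trans (coeff-tutteAt varX (+ 0) i) (trans (sum-int ((- + 1) ^ℤ_) i)
    (Ext0.sum-ext (λ S → int0 S ∧ actInt≡ i S) (λ s p → cong₂ (λ a b → (a ≡ᵇ 0) ∧ (b ≡ᵇ i))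
        (flip-nTog-other s {false} p) (flip-nAct s {false} p true))))

theorem47 : ∀ {n : ℕ} (M : RootedMap n) → let open MapDefs M in
    CoeffsCount (tutteAt onePlusX (+ 2)) (λ i O → isOrientation O ≡ true × RC i O)
    × CoeffsCount (tutteAt onePlusX (+ 1)) (λ i O → isOrientation O ≡ true × Minimal O × RC i O)
    × CoeffsCount (tutteAt onePlusX (+ 0)) (λ i O → isOrientation O ≡ true × Acyclic O × RC i O)
    × CoeffsCount (tutteAt varX (+ 2)) (λ i O → isOrientation O ≡ true × v0Connected O ≡ true × RSC i O)
    × CoeffsCount (tutteAt varX (+ 1)) (λ i O → isOrientation O ≡ true × v0Connected O ≡ true × Minimal O × RSC i O)
    × CoeffsCount (tutteAt varX (+ 0)) (λ i O → isOrientation O ≡ true × v0Connected O ≡ true × Acyclic O × RSC i O)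
theorem47 M =
      coeffsCount (tutteAt onePlusX (+ 2)) _ int≡ sum-12 (λ _ _ → proj₁)
        (λ i S s p → oriented s , RC⇐ s (≡ᵇ-⇒ p))
        (λ i S s (_ , r) → ≡ᵇ-t (RC⇒ s r))
    , coeffsCount (tutteAt onePlusX (+ 1)) _ (λ i S → int≡ i S ∧ ext0 S) sum-11 (λ _ _ → proj₁)
        (λ i S s p → oriented s , minimal-⇐ s (≡ᵇ-⇒ (∧-snd {int≡ i S} p)) , RC⇐ s (≡ᵇ-⇒ (∧-fst p)))
        (λ i S s (_ , m , r) → ∧-intro (≡ᵇ-t (RC⇒ s r)) (≡ᵇ-t (minimal-⇒ s m)))
    , coeffsCount (tutteAt onePlusX (+ 0)) _ (λ i S → ext0 S ∧ (int≡ i S ∧ actExt0 S)) sum-10 (λ _ _ → proj₁)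
        (λ i S s p → let q = ∧-snd {ext0 S} p in oriented s , acyclic-⇐ s (≡ᵇ-⇒ (∧-snd {int≡ i S} q)) , RC⇐ s (≡ᵇ-⇒ (∧-fst q)))
        (λ i S s (_ , a , r) → let e , f = acyclic-⇒ s a in ∧-intro (≡ᵇ-t e) (∧-intro (≡ᵇ-t (RC⇒ s r)) (≡ᵇ-t f)))
    , coeffsCount (tutteAt varX (+ 2)) _ (λ i S → int0 S ∧ actInt≡ i S) sum-02 (λ _ _ → proj₁)
        (λ i S s p → let z = ≡ᵇ-⇒ (∧-fst p) in oriented s , connected⇐ s z , RSC⇐ s z (≡ᵇ-⇒ (∧-snd {int0 S} p)))
        (λ i S s (_ , v , r) → let z = connected⇒ s v in ∧-intro (≡ᵇ-t z) (≡ᵇ-t (RSC⇒ s z r)))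
    , coeffsCount (tutteAt varX (+ 1)) _ (λ i S → (int0 S ∧ actInt≡ i S) ∧ ext0 S) sum-01 (λ _ _ → proj₁)
        (λ i S s p → let q = ∧-fst p ; z = ≡ᵇ-⇒ (∧-fst q) in
          oriented s , connected⇐ s z , minimal-⇐ s (≡ᵇ-⇒ (∧-snd {int0 S ∧ actInt≡ i S} p)) , RSC⇐ s z
              (≡ᵇ-⇒ (∧-snd {int0 S} q)))
        (λ i S s (_ , v , m , r) → let z = connected⇒ s v in ∧-intro (∧-intro (≡ᵇ-t z) (≡ᵇ-t (RSC⇒ s z r))) (≡ᵇ-t (minimal-⇒ s m)))
    , coeffsCount (tutteAt varX (+ 0)) _ (λ i S → ext0 S ∧ ((int0 S ∧ actInt≡ i S) ∧ actExt0 S)) sum-00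
        (λ _ _ → proj₁)
        (λ i S s p → let q = ∧-snd {ext0 S} p ; q′ = ∧-fst q ; z = ≡ᵇ-⇒ (∧-fst q′) in
          oriented s , connected⇐ s z , acyclic-⇐ s (≡ᵇ-⇒ (∧-snd {int0 S ∧ actInt≡ i S} q)) , RSC⇐ s z
              (≡ᵇ-⇒ (∧-snd {int0 S} q′)))
        (λ i S s (_ , v , a , r) → let z = connected⇒ s v ; (e , f) = acyclic-⇒ s a in
          ∧-intro (≡ᵇ-t e) (∧-intro (∧-intro (≡ᵇ-t z) (≡ᵇ-t (RSC⇒ s z r))) (≡ᵇ-t f)))
  where
  open MapDefs M
  open Map M
  open OfSubgraph
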